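{- Let $\mathcal{P}, \mathcal{Q} \subset \mathbb{R}^{n}$ be rational polytopes such that $\mathcal{P}\oplus\mathcal{Q}$ is a free sum. If either $\mathcal{P}^\vee$ or $\mathcal{Q}^\vee$ is a lattice polyhedron, then $$\operatorname{Ehr}_{\mathcal{P}\oplus\mathcal{Q}}(t) = (1-t)\operatorname{Ehr}_{\mathcal{P}}(t)\operatorname{Ehr}_{\mathcal{Q}}(t) \qquad (\ast)$$ and hence $$\delta_{\mathcal{P}\oplus\mathcal{Q}}(t) = \frac{(1-t)(1-t^{\operatorname{lcm}(\operatorname{den}\mathcal{P},\operatorname{den}\mathcal{Q})})^{\dim\mathcal{P}+\dim\mathcal{Q}+1}}{(1-t^{\operatorname{den}\mathcal{P}})^{\dim\mathcal{P}+1}(1-t^{\operatorname{den}\mathcal{Q}})^{\dim\mathcal{Q}+1}}\,\delta_{\mathcal{P}}(t)\,\delta_{\mathcal{Q}}(t). \qquad (\ast\ast)$$ Conversely, if either $(\ast)$ or $(\ast\ast)$ holds, then either $\mathcal{P}^\vee$ or $\mathcal{Q}^\vee$ is a lattice polyhedron. In particular, if $\mathcal{P},\mathcal{Q}\subset\mathbb{R}^n$ are lattice polytopes such that $\mathcal{P}\oplus\mathcal{Q}$ is a free sum, then $\delta_{\mathcal{P}\oplus\mathcal{Q}} = \delta_{\mathcal{P}}\,\delta_{\mathcal{Q}}$ if and only if either $\mathcal{P}^\vee$ or $\mathcal{Q}^\vee$ is a lattice polyhedron.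
   Context: A rational (resp. lattice) polytope has all vertices in $\mathbb{Q}^n$ (resp. $\mathbb{Z}^n$). For convex $\mathcal{J},\mathcal{K}\subset\mathbb{R}^n$, $\mathcal{J}\oplus\mathcal{K}:=\operatorname{conv}(\mathcal{J}\cup\mathcal{K})$; "$\mathcal{J}\oplus\mathcal{K}$ is a free sum" means there is $g\in\mathsf{SL}_n(\mathbb{Z})$ such that $g\mathcal{J}$ and $g\mathcal{K}$ each contain the origin and their linear spans are orthogonal coordinate subspaces (spanned by subsets of the standard basis vectors). For a rational polytope $\mathcal{P}$, $\operatorname{Ehr}_{\mathcal{P}}(t)=1+\sum_{k\ge1}|k\mathcal{P}\cap\mathbb{Z}^n|\,t^k$, $\operatorname{den}\mathcal{P}$ is the smallest positive integer $d$ such that $d\mathcal{P}$ is a lattice polytope, and the $\delta$-polynomial $\delta_{\mathcal{P}}(t)$ is the polynomial with $\operatorname{Ehr}_{\mathcal{P}}(t)=\delta_{\mathcal{P}}(t)/(1-t^{\operatorname{den}\mathcal{P}})^{\dim\mathcal{P}+1}$. For a polytope $\mathcal{P}$ containing the origin, $\mathcal{P}^\vee=\{\phi\in(\operatorname{lin}\mathcal{P})^*: \phi(a)\le1\ \forall a\in\mathcal{P}\}$ (dual relative to the linear span); it is a lattice polyhedron if its vertices lie in $\{\phi\in(\operatorname{lin}\mathcal{P})^*:\phi(a)\in\mathbb{Z}\ \forall a\in\operatorname{lin}\mathcal{P}\cap\mathbb{Z}^n\}$. -}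

module Defs where

open import Data.Nat as ℕ using (ℕ; zero; suc)
open import Data.Integer as ℤ using (ℤ; +_)
open import Data.Rational as ℚ using (ℚ; 0ℚ; 1ℚ; ½)
open import Data.Fin using (Fin; zero; suc; splitAt; punchIn; toℕ)
open import Data.Vec using (Vec; lookup; tabulate; map)
open import Data.List using (List; length)
open import Data.List.Membership.Propositional using (_∈_)
open import Data.List.Relation.Unary.Unique.Propositional using (Unique)
open import Data.Product using (Σ; _×_; ∃)
open import Data.Sum using ([_,_]′)
open import Data.Bool using (Bool; true; false)
open import Data.Nat.LCM using (lcm)
open import Relation.Nullary using (¬_)
open import Relation.Binary.PropositionalEquality using (_≡_)

sumℚ : (m : ℕ) → (Fin m → ℚ) → ℚ
sumℚ zero    f = 0ℚ
sumℚ (suc m) f = f zero ℚ.+ sumℚ m (λ i → f (suc i))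

sumℤ : (m : ℕ) → (Fin m → ℤ) → ℤ
sumℤ zero    f = + 0
sumℤ (suc m) f = f zero ℤ.+ sumℤ m (λ i → f (suc i))

Pt : ℕ → Set
Pt n = Vec ℚ n

LPt : ℕ → Set
LPt n = Vec ℤ n

ℤtoℚ : ℤ → ℚ
ℤtoℚ z = z ℚ./ 1

toℚv : ∀ {n} → LPt n → Pt n
toℚv = map ℤtoℚ

0v : ∀ {n} → Pt n
0v = tabulate (λ _ → 0ℚ)

e : ∀ {n} → Fin n → Pt n
e {suc n} zero    = tabulate λ { zero → 1ℚ ; (suc _) → 0ℚ }
e {suc n} (suc i) = tabulate λ { zero → 0ℚ ; (suc j) → lookup (e i) j }

_·_ : ∀ {n} → Pt n → Pt n → ℚ
_·_ {n} x y = sumℚ n (λ i → lookup x i ℚ.* lookup y i)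

_*v_ : ∀ {n} → ℚ → Pt n → Pt n
c *v x = map (c ℚ.*_) x

lincomb : ∀ {n m} → (Fin m → ℚ) → (Fin m → Pt n) → Pt n
lincomb {n} {m} c v = tabulate (λ i → sumℚ m (λ k → c k ℚ.* lookup (v k) i))

IsInt : ℚ → Set
IsInt q = Σ ℤ (λ z → q ≡ ℤtoℚ z)

record Polytope (n : ℕ) : Set where
  constructor poly
  field
    m    : ℕ
    gens : Fin m → Pt n
open Polytope public

_∈P_ : ∀ {n} → Pt n → Polytope n → Set
x ∈P P = Σ (Fin (m P) → ℚ) λ c →
  (∀ k → 0ℚ ℚ.≤ c k) × (sumℚ (m P) c ≡ 1ℚ) × (lincomb c (gens P) ≡ x)

InSpan : ∀ {n} → Polytope n → Pt n → Set
InSpan P x = Σ (Fin (m P) → ℚ) λ c → lincomb c (gens P) ≡ x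

scale : ∀ {n} → ℚ → Polytope n → Polytope n
scale c P = poly (m P) (λ k → c *v gens P k)

_⊕_ : ∀ {n} → Polytope n → Polytope n → Polytope n
P ⊕ Q = poly (m P ℕ.+ m Q) (λ k → [ gens P , gens Q ]′ (splitAt (m P) k))

SamePoly : ∀ {n} → Polytope n → Polytope n → Set
SamePoly {n} P Q = ∀ (x : Pt n) → (x ∈P P → x ∈P Q) × (x ∈P Q → x ∈P P)

IsLatticePolytope : ∀ {n} → Polytope n → Set
IsLatticePolytope {n} P = Σ ℕ λ r → Σ (Fin r → LPt n) λ w →
  SamePoly P (poly r (λ k → toℚv (w k)))

IsDen : ∀ {n} → Polytope n → ℕ → Set
IsDen P d = (1 ℕ.≤ d) × IsLatticePolytope (scale (+ d ℚ./ 1) P)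
  × (∀ d' → 1 ℕ.≤ d' → d' ℕ.< d → ¬ IsLatticePolytope (scale (+ d' ℚ./ 1) P))

AffInd : ∀ {n r} → (Fin (suc r) → Pt n) → Set
AffInd {n} {r} w = ∀ (c : Fin (suc r) → ℚ) → sumℚ (suc r) c ≡ 0ℚ →
  lincomb c w ≡ 0v → ∀ i → c i ≡ 0ℚ

IsDim : ∀ {n} → Polytope n → ℕ → Set
IsDim {n} P r =
  (Σ (Fin (suc r) → Pt n) λ w → (∀ i → w i ∈P P) × AffInd w)
  × (∀ (w : Fin (suc (suc r)) → Pt n) → (∀ i → w i ∈P P) → ¬ AffInd w)

Counts : ∀ {n} → (LPt n → Set) → ℕ → Set
Counts {n} S c = Σ (List (LPt n)) λ L → Unique L
  × (∀ z → z ∈ L → S z) × (∀ z → S z → z ∈ L) × (length L ≡ c)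

IsEhr : ∀ {n} → Polytope n → (ℕ → ℕ) → Set
IsEhr P e' = (e' 0 ≡ 1) ×
  (∀ k → Counts (λ z → toℚv z ∈P scale (+ suc k ℚ./ 1) P) (e' (suc k)))

Series : Set
Series = ℕ → ℤ

_≈s_ : Series → Series → Set
f ≈s g = ∀ k → f k ≡ g k

_⋆_ : Series → Series → Series
(f ⋆ g) k = sumℤ (suc k) (λ i → f (toℕ i) ℤ.* g (k ℕ.∸ toℕ i))

oneS : Series
oneS zero    = + 1
oneS (suc _) = + 0

-- 1 - t^d  (d ≥ 1 in all uses)
oneMinusT^ : ℕ → Series
oneMinusT^ d k with k ℕ.≟ 0 | k ℕ.≟ d
... | Relation.Nullary.yes _ | _ = + 1
... | Relation.Nullary.no _ | Relation.Nullary.yes _ = ℤ.- (+ 1)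
... | Relation.Nullary.no _ | Relation.Nullary.no _ = + 0

powS : Series → ℕ → Series
powS f zero    = oneS
powS f (suc j) = f ⋆ powS f j

natS : (ℕ → ℕ) → Series
natS e' k = + e' k

-- δ-polynomial as a series: Ehr(t) · (1 - t^den)^(dim+1)
delta : (ℕ → ℕ) → ℕ → ℕ → Series
delta e' d r = natS e' ⋆ powS (oneMinusT^ d) (suc r)

det : ∀ n → (Fin n → Fin n → ℤ) → ℤ
det zero    M = + 1
det (suc n) M = sumℤ (suc n) (λ j →
  sgn (toℕ j) ℤ.* (M zero j ℤ.* det n (λ a b → M (suc a) (punchIn j b))))
  where
  sgn : ℕ → ℤ
  sgn zero = + 1
  sgn (suc k) = ℤ.- sgn k

act : ∀ {n} → (Fin n → Fin n → ℤ) → Pt n → Pt n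
act {n} g x = tabulate (λ i → sumℚ n (λ j → ℤtoℚ (g i j) ℚ.* lookup x j))

actP : ∀ {n} → (Fin n → Fin n → ℤ) → Polytope n → Polytope n
actP g P = poly (m P) (λ k → act g (gens P k))

LinIsCoord : ∀ {n} → Polytope n → (Fin n → Bool) → Set
LinIsCoord {n} P I =
  (∀ k i → I i ≡ false → lookup (gens P k) i ≡ 0ℚ)
  × (∀ i → I i ≡ true → InSpan P (e i))

IsFreeSum : ∀ {n} → Polytope n → Polytope n → Set
IsFreeSum {n} P Q = Σ (Fin n → Fin n → ℤ) λ g → (det n g ≡ + 1) ×
  Σ (Fin n → Bool) λ I → Σ (Fin n → Bool) λ J →
    (∀ i → I i ≡ true → J i ≡ false)
    × (0v ∈P actP g P) × (0v ∈P actP g Q)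
    × LinIsCoord (actP g P) I × LinIsCoord (actP g Q) J

-- The dual P^∨ ⊂ (lin P)^*.  Functionals on lin P are represented by
-- y ∈ ℚⁿ, two representatives being identified when they agree on lin P
-- (equivalently on the generators).

InDual : ∀ {n} → Polytope n → Pt n → Set
InDual P y = ∀ k → y · gens P k ℚ.≤ 1ℚ

SameOnLin : ∀ {n} → Polytope n → Pt n → Pt n → Set
SameOnLin P y y' = ∀ k → y · gens P k ≡ y' · gens P k

IsDualVertex : ∀ {n} → Polytope n → Pt n → Set
IsDualVertex {n} P y = InDual P y ×
  (∀ (y₁ y₂ : Pt n) → InDual P y₁ → InDual P y₂ →
     (∀ k → y · gens P k ≡ ½ ℚ.* (y₁ · gens P k ℚ.+ y₂ · gens P k)) →
     SameOnLin P y₁ y₂)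

DualIsLattice : ∀ {n} → Polytope n → Set
DualIsLattice {n} P = ∀ (y : Pt n) → IsDualVertex P y →
  ∀ (z : LPt n) → InSpan P (toℚv z) → IsInt (y · toℚv z)

-- For a rational polytope P containing the origin let ‖x‖ be the least t with x ∈ t P.  A point x + y of
-- lin P ⊕ lin Q lies in k (P ⊕ Q) iff ‖x‖ + ‖y‖ ≤ k, whereas the coefficient of t^k in
-- (1 - t) Ehr_P Ehr_Q counts the lattice points with ⌈‖x‖⌉ + ⌈‖y‖⌉ ≤ k.  The two counts agree if one of
-- the gauges is integral at lattice points; otherwise suitable multiples of points with non-integral
-- gauges have fractional parts in (0, ½] and separate them.  The gauge is the maximum of 0 and the dual
-- vertices (Farkas), so it is integral whenever the dual is a lattice polyhedron; conversely, far inside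
-- the cone spanned by the generators tight at a non-integral dual vertex the gauge takes non-integral
-- values.  The identity for δ-polynomials is the one for Ehrhart series times an invertible series,
-- because dim (P ⊕ Q) = dim P + dim Q and den (P ⊕ Q) = lcm (den P, den Q).

module Submission where

-- The converse must produce one of two statements that quantify over all dual vertices, and it is
-- proved constructively. Both statements are therefore decided: a dual vertex is determined on the
-- linear span by the generators at which it is 1, so trying the finitely many subsets of generators
-- either proves the dual a lattice polyhedron or yields a lattice point and a functional certifying
-- that its gauge is not an integer. Integrality on all lattice points of lin P has to be tested on
-- finitely many of them. These come from the determinant condition: `g` has an integral inverse, so
-- there is an integer matrix that projects onto lin P and kills lin Q. The same matrix splits
-- lattice points into lattice points. Pairs with ceilings summing to at most k always give points
-- of k (P ⊕ Q). Equality of the counts thus forces every lattice point there to split, which is how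
-- a statement about numbers becomes one about points. Polytopes are given by generators that need
-- not be vertices. The divisibility of denominators needs one family of points serving two
-- multiples at once, and discarding redundant points supplies it.

-- Integer determinants and the integral inverse of a unimodular matrix.

module Determinant where

  open import Defs using (det; sumℤ)
  open import Data.Nat as ℕ using (ℕ; zero; suc)
  import Data.Nat.Properties as ℕₚ
  open import Data.Integer using (ℤ; +_; _+_; _*_; -_; _-_)
  open import Data.Integer.Properties hiding (_≟_)
  open import Data.Integer.Tactic.RingSolver using (solve-∀)
  open import Data.Fin using (Fin; zero; suc; toℕ; punchIn; punchOut; inject₁; _≟_)
  open import Data.Fin.Properties using (punchIn-punchOut; punchIn-injective; toℕ-inject₁; toℕ-injective; suc-injective)
  open import Data.List using (List; [])
  open import Data.Maybe using (nothing)
  open import Data.Product using (Σ; _×_; _,_; proj₁; proj₂)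
  open import Data.Empty using (⊥-elim)
  open import Function using (_∋_; _∘_)
  open import Level using (0ℓ)
  open import Relation.Nullary using (yes; no)
  open import Relation.Binary.Definitions using (tri<; tri≈; tri>)
  open import Relation.Binary.PropositionalEquality
  open import Tactic.RingSolver using (solve)
  open import Tactic.RingSolver.Core.AlmostCommutativeRing using (AlmostCommutativeRing)

  Matrix : ℕ → Set
  Matrix n = Fin n → Fin n → ℤ

  minor : ∀ {n} → Matrix (suc n) → Fin (suc n) → Matrix n
  minor M j a b = M (suc a) (punchIn j b)

  sumℤ-cong : ∀ {m} {f g : Fin m → ℤ} → (∀ i → f i ≡ g i) → sumℤ m f ≡ sumℤ m g
  sumℤ-cong {zero} h = refl
  sumℤ-cong {suc m} h = cong₂ _+_ (h zero) (sumℤ-cong (h ∘ suc))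

  sumℤ-zero : ∀ m {f : Fin m → ℤ} → (∀ i → f i ≡ + 0) → sumℤ m f ≡ + 0
  sumℤ-zero zero h = refl
  sumℤ-zero (suc m) h = cong₂ _+_ (h zero) (sumℤ-zero m (h ∘ suc))

  sumℤ-+ : ∀ m (f g : Fin m → ℤ) → sumℤ m (λ i → f i + g i) ≡ sumℤ m f + sumℤ m g
  sumℤ-+ zero f g = refl
  sumℤ-+ (suc m) f g = trans (cong (_+_ (f zero + g zero)) (sumℤ-+ m (f ∘ suc) (g ∘ suc)))
    (interchange (f zero) (g zero) _ _)
    where
    interchange : ∀ a b c d → (a + b) + (c + d) ≡ (a + c) + (b + d)
    interchange = solve-∀

  sumℤ-*ˡ : ∀ m (c : ℤ) (f : Fin m → ℤ) → c * sumℤ m f ≡ sumℤ m (λ i → c * f i)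
  sumℤ-*ˡ zero c f = *-zeroʳ c
  sumℤ-*ˡ (suc m) c f = trans (*-distribˡ-+ c _ _) (cong (_+_ (c * f zero)) (sumℤ-*ˡ m c (f ∘ suc)))

  sumℤ-swap : ∀ m n (f : Fin m → Fin n → ℤ) →
    sumℤ m (λ i → sumℤ n (f i)) ≡ sumℤ n (λ j → sumℤ m (λ i → f i j))
  sumℤ-swap zero n f = sym (sumℤ-zero n (λ _ → refl))
  sumℤ-swap (suc m) n f = trans (cong (_+_ (sumℤ n (f zero))) (sumℤ-swap m n (f ∘ suc)))
    (sym (sumℤ-+ n (f zero) _))

  sign : ℕ → ℤ
  sign zero = + 1
  sign (suc k) = - sign k

  sign-unique : (s : ℕ → ℤ) → s 0 ≡ + 1 → (∀ k → s (suc k) ≡ - s k) → ∀ k → s k ≡ sign k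
  sign-unique s p q zero = p
  sign-unique s p q (suc k) = trans (q k) (cong -_ (sign-unique s p q k))

  -- The sign in Defs.det is local to its where-block and cannot be named.  Running the ring
  -- solver over the trivial relation Traced, whose proofs carry an integer, reads the left factor
  -- off a product and so gives the local sign a name.
  data Traced (a b : ℤ) : Set where
    node : ℤ → Traced a b

  trace : ∀ {a b} → Traced a b → ℤ
  trace (node s) = s

  here : ∀ {a b} → Traced a b
  here {a} = node a

  leftFactor : AlmostCommutativeRing 0ℓ 0ℓ
  leftFactor = record
    { Carrier = ℤ ; _≈_ = Traced ; _+_ = _+_ ; _*_ = _*_ ; -_ = -_ ; 0# = + 0 ; 1# = + 1
    ; 0≟_ = λ _ → nothing
    ; isAlmostCommutativeRing = record
      { -‿cong = λ _ → here ; -‿*-distribˡ = λ _ _ → here ; -‿+-comm = λ _ _ → here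
      ; isCommutativeSemiring = record
        { *-comm = λ _ _ → here
        ; isSemiring = record
          { zero = (λ _ → here) , (λ _ → here)
          ; isSemiringWithoutAnnihilatingZero = record
            { *-cong = λ p _ → node (trace p) ; *-assoc = λ _ _ _ → here
            ; *-identity = (λ _ → here) , (λ _ → here)
            ; distrib = (λ _ _ _ → here) , (λ _ _ _ → here)
            ; +-isCommutativeMonoid = record
              { comm = λ _ _ → here
              ; isMonoid = record
                { identity = (λ _ → here) , (λ _ → here)
                ; isSemigroup = record
                  { assoc = λ _ _ _ → here
                  ; isMagma = record
                    { ∙-cong = λ _ _ → here
                    ; isEquivalence = record
                      { refl = here ; sym = λ p → node (trace p)
                      ; trans = λ _ q → node (trace q) } } } } } } } } } }

  replaceFactor : ∀ {a c x : ℤ} (p : Traced a a) → a ≡ trace p * x → trace p ≡ c → a ≡ c * x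
  replaceFactor {x = x} p eq q = trans eq (cong (_* x) q)

  mutual
    det-expand : ∀ n (M : Matrix (suc n)) →
      det (suc n) M ≡ sumℤ (suc n) (λ j → sign (toℕ j) * (M zero j * det n (minor M j)))
    det-expand n M = cong (λ t → + 1 * (M zero zero * det n (minor M zero)) + t)
      (sumℤ-cong (λ i → summand n M i))

    -- The left-hand sides written `_` in this block contain the sign local to `det`, which has no
    -- name; each is fixed by the use of the lemma in the preceding member of the block.
    -- Generalizing `toℕ i` to `k` then exposes the local sign as a function to which `sign-unique`
    -- applies.
    summand : ∀ n (M : Matrix (suc n)) (i : Fin n) →
      _ ≡ - sign (toℕ i) * (M zero (suc i) * det n (minor M (suc i)))
    summand n M i = replaceFactor (solve (List ℤ ∋ []) leftFactor) refl (local-sign-toℕ n M i)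

    local-sign-toℕ : ∀ n (M : Matrix (suc n)) (i : Fin n) → _ ≡ - sign (toℕ i)
    local-sign-toℕ n M i with toℕ i
    ... | k = cong -_ (local-sign n M k)

    local-sign : ∀ n (M : Matrix (suc n)) (k : ℕ) → _ ≡ sign k
    local-sign n M = sign-unique _ refl (λ _ → refl)

  det-cong : ∀ n {M N : Matrix n} → (∀ a b → M a b ≡ N a b) → det n M ≡ det n N
  det-cong zero h = refl
  det-cong (suc n) {M} {N} h = trans (det-expand n M) (trans (sumℤ-cong (λ j → cong (sign (toℕ j) *_)
    (cong₂ _*_ (h zero j) (det-cong n (λ a b → h (suc a) (punchIn j b)))))) (sym (det-expand n N)))

  infixl 10 _[_≔_]

  _[_≔_] : ∀ {n} → Matrix n → Fin n → (Fin n → ℤ) → Matrix n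
  (M [ j ≔ v ]) a b with b ≟ j
  ... | yes _ = v a
  ... | no _ = M a b

  ≔-at : ∀ {n} (M : Matrix n) j v a → (M [ j ≔ v ]) a j ≡ v a
  ≔-at M j v a with j ≟ j
  ... | yes _ = refl
  ... | no j≢j = ⊥-elim (j≢j refl)

  ≔-off : ∀ {n} (M : Matrix n) {j b} v a → b ≢ j → (M [ j ≔ v ]) a b ≡ M a b
  ≔-off M {j} {b} v a b≢j with b ≟ j
  ... | yes b≡j = ⊥-elim (b≢j b≡j)
  ... | no _ = refl

  Form : ∀ {n} → ((Fin n → ℤ) → ℤ) → Set
  Form {n} F = Σ (Fin n → ℤ) λ C → ∀ v → F v ≡ sumℤ n (λ k → C k * v k)

  -- Expansion along the first row: the term of column `i` contributes the coefficient of `v zero`,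
  -- and in every other minor the replaced column survives at position `punchOut j≢i`. The
  -- coefficients are the cofactors of column `i`, that is, row `i` of the adjugate.
  det-linear : ∀ n (M : Matrix n) i → Form (λ v → det n (M [ i ≔ v ]))
  det-linear (suc m) M i = (λ k → sumℤ (suc m) (λ j → proj₁ (term j) k)) , λ v → begin
    det (suc m) (M [ i ≔ v ])
      ≡⟨ det-expand m (M [ i ≔ v ]) ⟩
    sumℤ (suc m) (λ j → sign (toℕ j) * ((M [ i ≔ v ]) zero j * det m (minor (M [ i ≔ v ]) j)))
      ≡⟨ sumℤ-cong (λ j → proj₂ (term j) v) ⟩
    sumℤ (suc m) (λ j → sumℤ (suc m) (λ k → proj₁ (term j) k * v k))
      ≡⟨ sumℤ-swap (suc m) (suc m) (λ j k → proj₁ (term j) k * v k) ⟩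
    sumℤ (suc m) (λ k → sumℤ (suc m) (λ j → proj₁ (term j) k * v k))
      ≡⟨ sumℤ-cong (λ k → trans (sumℤ-cong (λ j → *-comm (proj₁ (term j) k) (v k)))
           (trans (sym (sumℤ-*ˡ (suc m) (v k) (λ j → proj₁ (term j) k))) (*-comm (v k) _))) ⟩
    sumℤ (suc m) (λ k → sumℤ (suc m) (λ j → proj₁ (term j) k) * v k) ∎
    where
    open ≡-Reasoning
    term : ∀ j → Form (λ v → sign (toℕ j) * ((M [ i ≔ v ]) zero j * det m (minor (M [ i ≔ v ]) j)))
    term j with j ≟ i
    ... | yes refl = C , λ v → begin
      s * (v zero * det m (minor (M [ i ≔ v ]) i))
        ≡⟨ cong (λ d → s * (v zero * d)) (det-cong m (λ a b → ≔-off M v (suc a) (punchInᵢ≢i i b))) ⟩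
      s * (v zero * det m (minor M i))
        ≡⟨ rearrange s (v zero) _ ⟩
      s * det m (minor M i) * v zero + + 0
        ≡⟨ cong (_+_ (s * det m (minor M i) * v zero)) (sym (sumℤ-zero m (λ k → *-zeroˡ (v (suc k))))) ⟩
      sumℤ (suc m) (λ k → C k * v k) ∎
      where
      open import Data.Fin.Properties using (punchInᵢ≢i)
      s = sign (toℕ i)
      C : Fin (suc m) → ℤ
      C zero = s * det m (minor M i)
      C (suc _) = + 0
      rearrange : ∀ a b c → a * (b * c) ≡ a * c * b + + 0
      rearrange = solve-∀
    ... | no j≢i = C , λ v → begin
      s * (M zero j * det m (minor (M [ i ≔ v ]) j))
        ≡⟨ cong (λ d → s * (M zero j * d)) (det-cong m (minor-≔ v)) ⟩
      s * (M zero j * det m (minor M j [ i′ ≔ v ∘ suc ]))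
        ≡⟨ cong (λ d → s * (M zero j * d)) (proj₂ IH (v ∘ suc)) ⟩
      s * (M zero j * sumℤ m (λ k → proj₁ IH k * v (suc k)))
        ≡⟨ sym (*-assoc s _ _) ⟩
      s * M zero j * sumℤ m (λ k → proj₁ IH k * v (suc k))
        ≡⟨ sumℤ-*ˡ m (s * M zero j) _ ⟩
      sumℤ m (λ k → s * M zero j * (proj₁ IH k * v (suc k)))
        ≡⟨ sumℤ-cong {m} (λ k → sym (*-assoc (s * M zero j) (proj₁ IH k) (v (suc k)))) ⟩
      sumℤ m (λ k → C (suc k) * v (suc k))
        ≡⟨ sym (+-identityˡ _) ⟩
      sumℤ (suc m) (λ k → C k * v k) ∎
      where
      s = sign (toℕ j)
      i′ = punchOut j≢i
      IH = det-linear m (minor M j) i′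
      C : Fin (suc m) → ℤ
      C zero = + 0
      C (suc k) = s * M zero j * proj₁ IH k
      minor-≔ : ∀ v a b → minor (M [ i ≔ v ]) j a b ≡ (minor M j [ i′ ≔ v ∘ suc ]) a b
      minor-≔ v a b with b ≟ i′
      ... | yes refl = trans (cong ((M [ i ≔ v ]) (suc a)) (punchIn-punchOut j≢i)) (≔-at M i v (suc a))
      ... | no b≢i′ = ≔-off M v (suc a)
        (λ eq → b≢i′ (punchIn-injective j b i′ (trans eq (sym (punchIn-punchOut j≢i)))))

  det-≔-+ : ∀ n (M : Matrix n) i u v →
    det n (M [ i ≔ (λ a → u a + v a) ]) ≡ det n (M [ i ≔ u ]) + det n (M [ i ≔ v ])
  det-≔-+ n M i u v with det-linear n M i
  ... | C , h = trans (h _) (trans (sumℤ-cong (λ k → *-distribˡ-+ (C k) (u k) (v k)))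
    (trans (sumℤ-+ n _ _) (sym (cong₂ _+_ (h u) (h v)))))

  inject₁≢suc : ∀ {n} (i : Fin n) → inject₁ i ≢ suc i
  inject₁≢suc (suc i) eq = inject₁≢suc i (suc-injective eq)

  sumℤ-adjacent-cancel : ∀ n (f : Fin (suc n) → ℤ) (i : Fin n) →
    (∀ j → j ≢ inject₁ i → j ≢ suc i → f j ≡ + 0) → f (inject₁ i) + f (suc i) ≡ + 0 →
    sumℤ (suc n) f ≡ + 0
  sumℤ-adjacent-cancel (suc n) f zero off c =
    trans (sym (+-assoc (f zero) (f (suc zero)) _))
      (cong₂ _+_ c (sumℤ-zero n (λ k → off (suc (suc k)) (λ ()) (λ ()))))
  sumℤ-adjacent-cancel (suc n) f (suc i) off c =
    cong₂ _+_ (off zero (λ ()) (λ ())) (sumℤ-adjacent-cancel n (f ∘ suc) i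
      (λ j p q → off (suc j) (p ∘ suc-injective) (q ∘ suc-injective)) c)

  punchIn-adjacent : ∀ {m} (j : Fin (suc (suc m))) (i : Fin (suc m)) → j ≢ inject₁ i → j ≢ suc i →
    Σ (Fin m) λ i′ → punchIn j (inject₁ i′) ≡ inject₁ i × punchIn j (suc i′) ≡ suc i
  punchIn-adjacent zero zero p q = ⊥-elim (p refl)
  punchIn-adjacent zero (suc i) p q = i , refl , refl
  punchIn-adjacent (suc zero) zero p q = ⊥-elim (q refl)
  punchIn-adjacent {suc m} (suc (suc j)) zero p q = zero , refl , refl
  punchIn-adjacent {suc m} (suc j) (suc i) p q with punchIn-adjacent j i (p ∘ cong suc) (q ∘ cong suc)
  ... | i′ , e₁ , e₂ = suc i′ , cong suc e₁ , cong suc e₂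

  punchIn-inject₁-suc : ∀ {n} (A : Fin (suc n) → ℤ) (i : Fin n) → A (inject₁ i) ≡ A (suc i) →
    ∀ b → A (punchIn (inject₁ i) b) ≡ A (punchIn (suc i) b)
  punchIn-inject₁-suc A zero eq zero = sym eq
  punchIn-inject₁-suc A zero eq (suc b) = refl
  punchIn-inject₁-suc A (suc i) eq zero = refl
  punchIn-inject₁-suc A (suc i) eq (suc b) = punchIn-inject₁-suc (A ∘ suc) i eq b

  -- In the expansion along the first row, the minors that keep both columns vanish by induction;
  -- the two remaining terms have equal minors and opposite signs.
  det-adjacent : ∀ n (M : Matrix (suc n)) (i : Fin n) →
    (∀ a → M a (inject₁ i) ≡ M a (suc i)) → det (suc n) M ≡ + 0
  det-adjacent (suc m) M i eq = trans (det-expand (suc m) M) (sumℤ-adjacent-cancel (suc m) _ i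
    (λ j p q → let (i′ , e₁ , e₂) = punchIn-adjacent j i p q in
       trans (cong (λ d → sign (toℕ j) * (M zero j * d)) (det-adjacent m (minor M j) i′
         (λ a → trans (cong (M (suc a)) e₁) (trans (eq (suc a)) (cong (M (suc a)) (sym e₂))))))
       (trans (cong (sign (toℕ j) *_) (*-zeroʳ (M zero j))) (*-zeroʳ (sign (toℕ j)))))
    (begin
      sign (toℕ (inject₁ i)) * (M zero (inject₁ i) * det (suc m) (minor M (inject₁ i)))
        + - sign (toℕ i) * (M zero (suc i) * det (suc m) (minor M (suc i)))
        ≡⟨ cong₂ (λ s t → s * t + - sign (toℕ i) * (M zero (suc i) * det (suc m) (minor M (suc i))))
             (cong sign (toℕ-inject₁ i))
             (cong₂ _*_ (eq zero) (det-cong (suc m)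
               (λ a b → punchIn-inject₁-suc (M (suc a)) i (eq (suc a)) b))) ⟩
      sign (toℕ i) * (M zero (suc i) * det (suc m) (minor M (suc i)))
        + - sign (toℕ i) * (M zero (suc i) * det (suc m) (minor M (suc i)))
        ≡⟨ cancel (sign (toℕ i)) _ ⟩
      + 0 ∎))
    where
    open ≡-Reasoning
    cancel : ∀ s x → s * x + - s * x ≡ + 0
    cancel = solve-∀

  -- Polarization: the determinant with `u + v` in both columns vanishes, and so do the two diagonal
  -- terms of its bilinear expansion.
  det-swap-adjacent : ∀ n (M : Matrix (suc n)) (i : Fin n) (u v : Fin (suc n) → ℤ) →
    det (suc n) (M [ inject₁ i ≔ u ] [ suc i ≔ v ]) + det (suc n) (M [ inject₁ i ≔ v ] [ suc i ≔ u ]) ≡ + 0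
  det-swap-adjacent n M i u v = begin
    D u v + D v u                             ≡⟨ pad (D u v) (D v u) ⟩
    (+ 0 + D u v) + (D v u + + 0)             ≡⟨ sym (cong₂ (λ x y → (x + D u v) + (D v u + y)) (diag u) (diag v)) ⟩
    (D u u + D u v) + (D v u + D v v)         ≡⟨ sym (cong₂ _+_ (right u) (right v)) ⟩
    D u w + D v w                             ≡⟨ cong₂ _+_ (comm u w) (comm v w) ⟩
    D′ u w + D′ v w                           ≡⟨ sym (det-≔-+ (suc n) (M [ suc i ≔ w ]) (inject₁ i) u v) ⟩
    D′ w w                                    ≡⟨ sym (comm w w) ⟩
    D w w                                     ≡⟨ diag w ⟩
    + 0 ∎
    where
    open ≡-Reasoning
    w : Fin (suc n) → ℤ
    w a = u a + v a
    D D′ : (Fin (suc n) → ℤ) → (Fin (suc n) → ℤ) → ℤ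
    D x y = det (suc n) (M [ inject₁ i ≔ x ] [ suc i ≔ y ])
    D′ x y = det (suc n) (M [ suc i ≔ y ] [ inject₁ i ≔ x ])
    pad : ∀ a b → a + b ≡ (+ 0 + a) + (b + + 0)
    pad = solve-∀
    right : ∀ x → D x w ≡ D x u + D x v
    right x = det-≔-+ (suc n) (M [ inject₁ i ≔ x ]) (suc i) u v
    diag : ∀ x → D x x ≡ + 0
    diag x = det-adjacent n (M [ inject₁ i ≔ x ] [ suc i ≔ x ]) i (λ a → trans (≔-off (M [ inject₁ i ≔ x ]) x a (inject₁≢suc i))
      (trans (≔-at M (inject₁ i) x a) (sym (≔-at (M [ inject₁ i ≔ x ]) (suc i) x a))))
    comm : ∀ x y → D x y ≡ D′ x y
    comm x y = det-cong (suc n) pointwise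
      where
      pointwise : ∀ a b → (M [ inject₁ i ≔ x ] [ suc i ≔ y ]) a b ≡ (M [ suc i ≔ y ] [ inject₁ i ≔ x ]) a b
      pointwise a b with b ≟ suc i | b ≟ inject₁ i
      ... | yes refl | yes p = ⊥-elim (inject₁≢suc i (sym p))
      ... | yes refl | no _ = sym (≔-at M (suc i) y a)
      ... | no _ | yes refl = ≔-at M (inject₁ i) x a
      ... | no p | no q = trans (≔-off M x a q) (sym (≔-off M y a p))

  -- Induction on the distance of the two columns: interchanging the right one with its left
  -- neighbour only changes the sign and brings the equal columns one step closer.
  det-repeated : ∀ d n (M : Matrix (suc n)) (p q : Fin (suc n)) → toℕ q ≡ suc d ℕ.+ toℕ p →
    (∀ a → M a p ≡ M a q) → det (suc n) M ≡ + 0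
  det-repeated zero n M p (suc q) pq eq with toℕ-injective {i = p} {inject₁ q}
    (sym (trans (toℕ-inject₁ q) (ℕₚ.suc-injective pq)))
  ... | refl = det-adjacent n M q eq
  det-repeated (suc d) n M p (suc q) pq eq = begin
    det (suc n) M                   ≡⟨ det-cong (suc n) unchanged ⟩
    D u v                           ≡⟨ sym (+-identityʳ _) ⟩
    D u v + + 0                     ≡⟨ cong (_+_ (D u v)) (sym swapped) ⟩
    D u v + D v u                   ≡⟨ det-swap-adjacent n M q u v ⟩
    + 0 ∎
    where
    open ≡-Reasoning
    u v : Fin (suc n) → ℤ
    u a = M a (inject₁ q)
    v a = M a (suc q)
    D : (Fin (suc n) → ℤ) → (Fin (suc n) → ℤ) → ℤ
    D x y = det (suc n) (M [ inject₁ q ≔ x ] [ suc q ≔ y ])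
    q-p : toℕ (inject₁ q) ≡ suc d ℕ.+ toℕ p
    q-p = trans (toℕ-inject₁ q) (ℕₚ.suc-injective pq)
    p≢q : p ≢ inject₁ q
    p≢q refl = ℕₚ.m≢1+n+m (toℕ p) {d} q-p
    p≢sq : p ≢ suc q
    p≢sq refl = ℕₚ.m≢1+n+m (toℕ p) {suc d} pq
    unchanged : ∀ a b → M a b ≡ (M [ inject₁ q ≔ u ] [ suc q ≔ v ]) a b
    unchanged a b with b ≟ suc q
    ... | yes refl = refl
    ... | no _ with b ≟ inject₁ q
    ...   | yes refl = refl
    ...   | no _ = refl
    swapped : D v u ≡ + 0
    swapped = det-repeated d n (M [ inject₁ q ≔ v ] [ suc q ≔ u ]) p (inject₁ q) q-p λ a → begin
      (M [ inject₁ q ≔ v ] [ suc q ≔ u ]) a p           ≡⟨ ≔-off (M [ inject₁ q ≔ v ]) u a p≢sq ⟩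
      (M [ inject₁ q ≔ v ]) a p                         ≡⟨ ≔-off M v a p≢q ⟩
      M a p                                             ≡⟨ eq a ⟩
      M a (suc q)                                       ≡⟨ sym (≔-at M (inject₁ q) v a) ⟩
      (M [ inject₁ q ≔ v ]) a (inject₁ q)               ≡⟨ sym (≔-off (M [ inject₁ q ≔ v ]) u a (inject₁≢suc q)) ⟩
      (M [ inject₁ q ≔ v ] [ suc q ≔ u ]) a (inject₁ q) ∎

  det-equal-columns : ∀ n (M : Matrix n) {p q} → p ≢ q → (∀ a → M a p ≡ M a q) → det n M ≡ + 0
  det-equal-columns (suc n) M {p} {q} p≢q eq with ℕₚ.<-cmp (toℕ p) (toℕ q)
  ... | tri< p<q _ _ = det-repeated _ n M p q (gap p<q) eq
    where
    gap : toℕ p ℕ.< toℕ q → toℕ q ≡ suc (toℕ q ℕ.∸ suc (toℕ p)) ℕ.+ toℕ p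
    gap lt = sym (trans (sym (ℕₚ.+-suc _ (toℕ p))) (ℕₚ.m∸n+n≡m lt))
  ... | tri≈ _ p≡q _ = ⊥-elim (p≢q (toℕ-injective p≡q))
  ... | tri> _ _ q<p = det-repeated _ n M q p (sym (trans (sym (ℕₚ.+-suc _ (toℕ q))) (ℕₚ.m∸n+n≡m q<p))) (sym ∘ eq)

  identity : ∀ {n} → Matrix n
  identity i j with j ≟ i
  ... | yes _ = + 1
  ... | no _ = + 0

  -- Cramer's rule. The inverse is the adjugate, with no division since the determinant is 1; entry
  -- (i, j) of the product is the determinant of `M` with column `i` overwritten by column `j`.
  det≡1⇒left-inverse : ∀ n (M : Matrix n) → det n M ≡ + 1 →
    Σ (Matrix n) λ H → ∀ i j → sumℤ n (λ k → H i k * M k j) ≡ identity i j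
  det≡1⇒left-inverse n M det≡1 = (λ i → proj₁ (det-linear n M i)) , λ i j →
    trans (sym (proj₂ (det-linear n M i) (λ k → M k j))) (cramer i j)
    where
    cramer : ∀ i j → det n (M [ i ≔ (λ k → M k j) ]) ≡ identity i j
    cramer i j with j ≟ i
    ... | yes refl = trans (det-cong n unchanged) det≡1
      where
      unchanged : ∀ a b → (M [ i ≔ (λ k → M k i) ]) a b ≡ M a b
      unchanged a b with b ≟ i
      ... | yes refl = refl
      ... | no _ = refl
    ... | no j≢i = det-equal-columns n (M [ i ≔ (λ k → M k j) ]) {i} {j} (j≢i ∘ sym)
      (λ a → trans (≔-at M i _ a) (sym (≔-off M _ a j≢i)))

-- Formal power series over the integers under the Cauchy product.

module Series where

  open import Defs using (Series; _≈s_; _⋆_; oneS; oneMinusT^; powS)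
  open Determinant using (sumℤ-cong; sumℤ-zero)
  open import Data.Nat as ℕ using (ℕ; zero; suc)
  import Data.Nat.Properties as ℕₚ
  open import Data.Nat.Induction using (<-rec)
  open import Data.Integer using (+_; _+_; _*_; -_; _-_)
  open import Data.Integer.Properties
  open import Data.Integer.Tactic.RingSolver using (solve-∀)
  open import Data.Fin using (zero; suc; toℕ)
  open import Data.Product using (_,_)
  open import Level using (0ℓ)
  open import Algebra.Bundles using (CommutativeMonoid)
  open import Relation.Binary.PropositionalEquality

  tail : Series → Series
  tail f k = f (suc k)

  ⋆-local : ∀ f {g h} k → (∀ j → j ℕ.≤ k → g j ≡ h j) → (f ⋆ g) k ≡ (f ⋆ h) k
  ⋆-local f k eq = sumℤ-cong {suc k} (λ i → cong (f (toℕ i) *_) (eq (k ℕ.∸ toℕ i) (ℕₚ.m∸n≤m k (toℕ i))))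

  ⋆-congʳ : ∀ f {g h} → g ≈s h → (f ⋆ g) ≈s (f ⋆ h)
  ⋆-congʳ f eq k = ⋆-local f k (λ j _ → eq j)

  ⋆-congˡ : ∀ {f g} h → f ≈s g → (f ⋆ h) ≈s (g ⋆ h)
  ⋆-congˡ h eq k = sumℤ-cong {suc k} (λ i → cong (_* h (k ℕ.∸ toℕ i)) (eq (toℕ i)))

  -- By definition `_⋆_` splits off the term with `f 0`; commutativity also needs the term with
  -- `g 0` split off at the other end.
  ⋆-lastʳ : ∀ f g k → (f ⋆ g) (suc k) ≡ (f ⋆ tail g) k + f (suc k) * g 0
  ⋆-lastʳ f g zero = rearrange (f 0 * g 1) (f 1 * g 0)
    where
    rearrange : ∀ a b → a + (b + + 0) ≡ a + + 0 + b
    rearrange = solve-∀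
  ⋆-lastʳ f g (suc k) = trans (cong (_+_ (f 0 * g (suc (suc k)))) (⋆-lastʳ (tail f) g k))
    (sym (+-assoc (f 0 * g (suc (suc k))) ((tail f ⋆ tail g) k) (f (suc (suc k)) * g 0)))

  ⋆-comm : ∀ f g → (f ⋆ g) ≈s (g ⋆ f)
  ⋆-comm f g zero = cong (λ t → t + + 0) (*-comm (f 0) (g 0))
  ⋆-comm f g (suc k) = begin
    f 0 * g (suc k) + (tail f ⋆ g) k    ≡⟨ cong (_+_ (f 0 * g (suc k))) (⋆-comm (tail f) g k) ⟩
    f 0 * g (suc k) + (g ⋆ tail f) k    ≡⟨ swap (f 0) (g (suc k)) ((g ⋆ tail f) k) ⟩
    (g ⋆ tail f) k + g (suc k) * f 0    ≡⟨ sym (⋆-lastʳ g f k) ⟩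
    (g ⋆ f) (suc k) ∎
    where
    open ≡-Reasoning
    swap : ∀ a b c → a * b + c ≡ c + b * a
    swap = solve-∀

  -- The shape is dictated by associativity: the tail of `f ⋆ g` is `f 0` times `tail g` plus
  -- `tail f ⋆ g`.
  ⋆-linearˡ : ∀ a f g h k → ((λ j → a * f j + g j) ⋆ h) k ≡ a * (f ⋆ h) k + (g ⋆ h) k
  ⋆-linearˡ a f g h zero = expand a (f 0) (g 0) (h 0)
    where
    expand : ∀ a f g h → (a * f + g) * h + + 0 ≡ a * (f * h + + 0) + (g * h + + 0)
    expand = solve-∀
  ⋆-linearˡ a f g h (suc k) = trans (cong (_+_ ((a * f 0 + g 0) * h (suc k))) (⋆-linearˡ a (tail f) (tail g) h k))
    (expand a (f 0) (g 0) (h (suc k)) ((tail f ⋆ h) k) ((tail g ⋆ h) k))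
    where
    expand : ∀ a f g h x y → (a * f + g) * h + (a * x + y) ≡ a * (f * h + x) + (g * h + y)
    expand = solve-∀

  ⋆-assoc : ∀ f g h → ((f ⋆ g) ⋆ h) ≈s (f ⋆ (g ⋆ h))
  ⋆-assoc f g h zero = expand (f 0) (g 0) (h 0)
    where
    expand : ∀ f g h → (f * g + + 0) * h + + 0 ≡ f * (g * h + + 0) + + 0
    expand = solve-∀
  ⋆-assoc f g h (suc k) = begin
    (f 0 * g 0 + + 0) * h (suc k) + ((λ j → f 0 * g (suc j) + (tail f ⋆ g) j) ⋆ h) k
      ≡⟨ cong (_+_ ((f 0 * g 0 + + 0) * h (suc k))) (⋆-linearˡ (f 0) (tail g) (tail f ⋆ g) h k) ⟩
    (f 0 * g 0 + + 0) * h (suc k) + (f 0 * (tail g ⋆ h) k + ((tail f ⋆ g) ⋆ h) k)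
      ≡⟨ expand (f 0) (g 0) (h (suc k)) ((tail g ⋆ h) k) (((tail f ⋆ g) ⋆ h) k) ⟩
    f 0 * (g 0 * h (suc k) + (tail g ⋆ h) k) + ((tail f ⋆ g) ⋆ h) k
      ≡⟨ cong (_+_ (f 0 * (g ⋆ h) (suc k))) (⋆-assoc (tail f) g h k) ⟩
    f 0 * (g ⋆ h) (suc k) + (tail f ⋆ (g ⋆ h)) k ∎
    where
    open ≡-Reasoning
    expand : ∀ f g h x y → (f * g + + 0) * h + (f * x + y) ≡ f * (g * h + x) + y
    expand = solve-∀

  zero-⋆ : ∀ {f} g → (∀ k → f k ≡ + 0) → ∀ k → (f ⋆ g) k ≡ + 0
  zero-⋆ g eq k = sumℤ-zero (suc k) (λ i → trans (cong (_* g (k ℕ.∸ toℕ i)) (eq (toℕ i))) (*-zeroˡ (g (k ℕ.∸ toℕ i))))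

  ⋆-identityˡ : ∀ f → (oneS ⋆ f) ≈s f
  ⋆-identityˡ f zero = trans (+-identityʳ (+ 1 * f 0)) (*-identityˡ (f 0))
  ⋆-identityˡ f (suc k) = trans (cong (_+_ (+ 1 * f (suc k))) (zero-⋆ f (λ _ → refl) k))
    (trans (+-identityʳ (+ 1 * f (suc k))) (*-identityˡ (f (suc k))))

  ⋆-commutativeMonoid : CommutativeMonoid 0ℓ 0ℓ
  ⋆-commutativeMonoid = record
    { Carrier = Series ; _≈_ = _≈s_ ; _∙_ = _⋆_ ; ε = oneS
    ; isCommutativeMonoid = record
      { isMonoid = record
        { isSemigroup = record
          { isMagma = record
            { isEquivalence = record
              { refl = λ _ → refl ; sym = λ p k → sym (p k) ; trans = λ p q k → trans (p k) (q k) }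
            ; ∙-cong = λ {f} {g} {u} {v} p q k → trans (⋆-congˡ u p k) (⋆-congʳ g q k) }
          ; assoc = ⋆-assoc }
        ; identity = ⋆-identityˡ , λ f k → trans (⋆-comm f oneS k) (⋆-identityˡ f k) }
      ; comm = ⋆-comm } }

  -- Coefficient `k` of `f ⋆ g` is `g k` plus terms in the earlier coefficients of `g`, so the
  -- coefficients can be recovered one after another.
  ⋆-cancelˡ : ∀ f {g h} → f 0 ≡ + 1 → (f ⋆ g) ≈s (f ⋆ h) → g ≈s h
  ⋆-cancelˡ f {g} {h} f₀ eq = <-rec (λ k → g k ≡ h k) step
    where
    step : ∀ k → (∀ {j} → j ℕ.< k → g j ≡ h j) → g k ≡ h k
    step zero _ = trans (sym (lead (g 0))) (trans (eq 0) (lead (h 0)))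
      where
      lead : ∀ x → f 0 * x + + 0 ≡ x
      lead x = trans (+-identityʳ (f 0 * x)) (trans (cong (_* x) f₀) (*-identityˡ x))
    step (suc k) IH = trans (sym (lead (g (suc k)) ((tail f ⋆ g) k))) (trans (cong₂ _-_ (eq (suc k))
        (⋆-local (tail f) k (λ j j≤k → IH (ℕ.s≤s j≤k)))) (lead (h (suc k)) ((tail f ⋆ h) k)))
      where
      lead : ∀ x y → (f 0 * x + y) - y ≡ x
      lead x y = trans (cong (λ t → (t * x + y) - y) f₀) (simplify x y)
        where
        simplify : ∀ x y → (+ 1 * x + y) - y ≡ x
        simplify = solve-∀

  ⋆-constant : ∀ {f g} → f 0 ≡ + 1 → g 0 ≡ + 1 → (f ⋆ g) 0 ≡ + 1
  ⋆-constant p q = cong₂ (λ a b → a * b + + 0) p q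

  powS-constant : ∀ {f} → f 0 ≡ + 1 → ∀ j → powS f j 0 ≡ + 1
  powS-constant p zero = refl
  powS-constant {f} p (suc j) = ⋆-constant {f} {powS f j} p (powS-constant p j)

  powS-+ : ∀ f a b → powS f (a ℕ.+ b) ≈s (powS f a ⋆ powS f b)
  powS-+ f zero b k = sym (⋆-identityˡ (powS f b) k)
  powS-+ f (suc a) b k = trans (⋆-congʳ f (powS-+ f a b) k) (sym (⋆-assoc f (powS f a) (powS f b) k))

  difference-zero : ∀ f → (oneMinusT^ 1 ⋆ f) 0 ≡ f 0
  difference-zero f = trans (+-identityʳ (+ 1 * f 0)) (*-identityˡ (f 0))

  difference-suc : ∀ f k → (oneMinusT^ 1 ⋆ f) (suc k) ≡ f (suc k) - f k
  difference-suc f k = cong₂ _+_ (*-identityˡ (f (suc k))) (below k)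
    where
    below : ∀ k → (tail (oneMinusT^ 1) ⋆ f) k ≡ - f k
    below zero = trans (+-identityʳ (- (+ 1) * f 0)) (-1*i≡-i (f 0))
    below (suc k) = trans (cong₂ _+_ (-1*i≡-i (f (suc k))) (zero-⋆ f (λ _ → refl) k)) (+-identityʳ (- f (suc k)))

-- Counting with duplicate-free lists, and the combinatorics of the product formula.

module Counting where

  open import Defs using (Series; _≈s_; _⋆_; oneMinusT^; natS)
  open Series using (tail; ⋆-assoc; difference-zero; difference-suc)
  open import Data.Nat as ℕ using (ℕ; zero; suc)
  import Data.Nat.Properties as ℕₚ
  open import Data.Integer as ℤ using (ℤ; +_; _-_)
  import Data.Integer.Properties as ℤₚ
  open import Data.List using (List; []; _∷_; _++_; length; map; filter; cartesianProduct)
  open import Data.List.Properties using (length-++; length-map)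
  open import Data.List.Membership.Propositional using (_∈_)
  open import Data.List.Membership.Propositional.Properties
  open import Data.List.Relation.Unary.Any using (here; there)
  open import Data.List.Relation.Unary.All using ([]; _∷_)
  open import Data.List.Relation.Unary.All.Properties using (¬Any⇒All¬)
  open import Data.List.Relation.Unary.Unique.Propositional using (Unique; []; _∷_)
  open import Data.List.Relation.Unary.Unique.Propositional.Properties as Unique using (Unique[x∷xs]⇒x∉xs)
  open import Data.Product using (Σ; _×_; _,_; proj₁; proj₂)
  open import Data.Sum using (inj₁; inj₂; [_,_]′)
  open import Data.Empty using (⊥; ⊥-elim)
  open import Function using (_∘_)
  open import Relation.Nullary using (yes; no; ¬?)
  open import Relation.Binary using (DecidableEquality)
  open import Relation.Binary.PropositionalEquality

  unique-tail : ∀ {A : Set} {x : A} {xs} → Unique (x ∷ xs) → Unique xs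
  unique-tail (_ ∷ u) = u

  length-⊆ : ∀ {A : Set} {xs ys : List A} → Unique xs → (∀ {x} → x ∈ xs → x ∈ ys) → length xs ℕ.≤ length ys
  length-⊆ {xs = []} _ _ = ℕ.z≤n
  length-⊆ {xs = x ∷ xs} u sub with ∈-∃++ (sub (here refl))
  ... | ys , zs , refl = ℕₚ.≤-trans (ℕ.s≤s (length-⊆ (unique-tail u) sub′))
    (ℕₚ.≤-reflexive (trans (cong suc (length-++ ys)) (trans (sym (ℕₚ.+-suc (length ys) (length zs))) (sym (length-++ ys)))))
    where
    sub′ : ∀ {y} → y ∈ xs → y ∈ ys ++ zs
    sub′ {y} y∈ with ∈-++⁻ ys (sub (there y∈))
    ... | inj₁ p = ∈-++⁺ˡ p
    ... | inj₂ (here refl) = ⊥-elim (Unique[x∷xs]⇒x∉xs u y∈)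
    ... | inj₂ (there p) = ∈-++⁺ʳ ys p

  length-≡ : ∀ {A : Set} {xs ys : List A} → Unique xs → Unique ys →
    (∀ {x} → x ∈ xs → x ∈ ys) → (∀ {x} → x ∈ ys → x ∈ xs) → length xs ≡ length ys
  length-≡ u v p q = ℕₚ.≤-antisym (length-⊆ u p) (length-⊆ v q)

  length-cartesianProduct : ∀ {A B : Set} (xs : List A) (ys : List B) →
    length (cartesianProduct xs ys) ≡ length xs ℕ.* length ys
  length-cartesianProduct [] ys = refl
  length-cartesianProduct (x ∷ xs) ys = trans (length-++ (map (x ,_) ys))
    (cong₂ ℕ._+_ (length-map (x ,_) ys) (length-cartesianProduct xs ys))

  +length-cartesianProduct : ∀ {A B : Set} (xs : List A) (ys : List B) {l b} → + length xs ≡ l → length ys ≡ b →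
    + length (cartesianProduct xs ys) ≡ l ℤ.* + b
  +length-cartesianProduct xs ys refl refl = trans (cong +_ (length-cartesianProduct xs ys)) (ℤₚ.pos-* (length xs) (length ys))

  module _ {A : Set} (_≟_ : DecidableEquality A) where
    open import Data.List.Membership.DecPropositional _≟_ using (_∈?_)

    length-complement : ∀ {xs ys : List A} → Unique xs → Unique ys → (∀ {x} → x ∈ xs → x ∈ ys) →
      length xs ℕ.+ length (filter (λ y → ¬? (y ∈? xs)) ys) ≡ length ys
    length-complement {xs} {ys} u v sub = trans (sym (length-++ xs)) (length-≡
      (Unique.++⁺ u (Unique.filter⁺ _ v) (λ (p , q) → proj₂ (∈-filter⁻ (λ y → ¬? (y ∈? xs)) {xs = ys} q) p)) v
      (λ p → [ sub , (λ q → proj₁ (∈-filter⁻ (λ y → ¬? (y ∈? xs)) q)) ]′ (∈-++⁻ xs p)) back)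
      where
      back : ∀ {x} → x ∈ ys → x ∈ xs ++ filter (λ y → ¬? (y ∈? xs)) ys
      back {x} p with x ∈? xs
      ... | yes q = ∈-++⁺ˡ q
      ... | no q = ∈-++⁺ʳ xs (∈-filter⁺ (λ y → ¬? (y ∈? xs)) p q)

    -- A missing `y` could be added to `xs`, giving a duplicate-free list inside `ys` that is longer
    -- than `ys`. This is what turns an equality of counts into membership.
    full-⊆ : ∀ {xs ys : List A} → Unique xs → (∀ {x} → x ∈ xs → x ∈ ys) → length ys ℕ.≤ length xs →
      ∀ {y} → y ∈ ys → y ∈ xs
    full-⊆ {xs} {ys} u sub le {y} y∈ with y ∈? xs
    ... | yes p = p
    ... | no ¬p = ⊥-elim (ℕₚ.<⇒≱ (length-⊆ {xs = y ∷ xs} {ys} (¬Any⇒All¬ xs ¬p ∷ u)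
      (λ { (here refl) → y∈ ; (there q) → sub q })) le)

  module _ {X Y : Set} (B : ℕ → List Y) where

    -- The disjoint union of the products of `L i` and `B (k - i)`. The recursion shifts `L` just as
    -- the sum in `_⋆_` shifts its left factor, so that lengths match term by term.
    pairs : ℕ → (ℕ → List X) → List (X × Y)
    pairs zero L = cartesianProduct (L 0) (B 0)
    pairs (suc k) L = cartesianProduct (L 0) (B (suc k)) ++ pairs k (L ∘ suc)

    pairs⁻ : ∀ k L {x y} → (x , y) ∈ pairs k L → Σ ℕ λ i → i ℕ.≤ k × x ∈ L i × y ∈ B (k ℕ.∸ i)
    pairs⁻ zero L p = 0 , ℕ.z≤n , ∈-cartesianProduct⁻ (L 0) (B 0) p
    pairs⁻ (suc k) L p with ∈-++⁻ (cartesianProduct (L 0) (B (suc k))) p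
    ... | inj₁ q = 0 , ℕ.z≤n , ∈-cartesianProduct⁻ (L 0) (B (suc k)) q
    ... | inj₂ q with pairs⁻ k (L ∘ suc) q
    ...   | i , i≤k , x∈ , y∈ = suc i , ℕ.s≤s i≤k , x∈ , y∈

    pairs⁺ : ∀ k L {x y} i → i ℕ.≤ k → x ∈ L i → y ∈ B (k ℕ.∸ i) → (x , y) ∈ pairs k L
    pairs⁺ zero L zero _ x∈ y∈ = ∈-cartesianProduct⁺ x∈ y∈
    pairs⁺ (suc k) L zero _ x∈ y∈ = ∈-++⁺ˡ (∈-cartesianProduct⁺ x∈ y∈)
    pairs⁺ (suc k) L (suc i) (ℕ.s≤s i≤k) x∈ y∈ = ∈-++⁺ʳ _ (pairs⁺ k (L ∘ suc) i i≤k x∈ y∈)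

    pairs-unique : ∀ k L → (∀ j → Unique (B j)) → (∀ i → Unique (L i)) →
      (∀ i j {x} → i ℕ.< j → x ∈ L i → x ∈ L j → ⊥) → Unique (pairs k L)
    pairs-unique zero L uB uL disjoint = Unique.cartesianProduct⁺ (uL 0) (uB 0)
    pairs-unique (suc k) L uB uL disjoint = Unique.++⁺ (Unique.cartesianProduct⁺ (uL 0) (uB (suc k)))
      (pairs-unique k (L ∘ suc) uB (uL ∘ suc) (λ i j lt → disjoint (suc i) (suc j) (ℕ.s≤s lt)))
      λ { {x , y} (p , q) → let (i , _ , x∈ , _) = pairs⁻ k (L ∘ suc) q in
          disjoint 0 (suc i) (ℕ.s≤s ℕ.z≤n) (proj₁ (∈-cartesianProduct⁻ (L 0) (B (suc k)) p)) x∈ }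

    -- `l` is integer-valued because it will be (1 - t) times a counting series, which is not given
    -- as a sequence of naturals.
    pairs-length : ∀ k L (l : Series) (b : ℕ → ℕ) → (∀ i → + length (L i) ≡ l i) → (∀ j → length (B j) ≡ b j) →
      + length (pairs k L) ≡ (l ⋆ natS b) k
    pairs-length zero L l b hl hb = trans (+length-cartesianProduct (L 0) (B 0) (hl 0) (hb 0)) (sym (ℤₚ.+-identityʳ _))
    pairs-length (suc k) L l b hl hb = trans (cong +_ (length-++ (cartesianProduct (L 0) (B (suc k)))))
      (trans (ℤₚ.pos-+ (length (cartesianProduct (L 0) (B (suc k)))) (length (pairs k (L ∘ suc))))
        (cong₂ ℤ._+_ (+length-cartesianProduct (L 0) (B (suc k)) (hl 0) (hb (suc k))) (pairs-length k (L ∘ suc) (tail l) b (hl ∘ suc) hb)))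

  -- In the application `A k`, `B k` and `S k` list the lattice points of k P, k Q and k (P ⊕ Q),
  -- and `f` splits a lattice point into its two components.
  module Convolution {X Y Z : Set} (_≟X_ : DecidableEquality X) (_≟Z_ : DecidableEquality (X × Y))
    (A : ℕ → List X) (B : ℕ → List Y) (S : ℕ → List Z) (f : Z → X × Y)
    (uA : ∀ k → Unique (A k)) (uB : ∀ k → Unique (B k)) (uS : ∀ k → Unique (S k))
    (monoA : ∀ k {x} → x ∈ A k → x ∈ A (suc k)) (monoB : ∀ k {y} → y ∈ B k → y ∈ B (suc k))
    (f-injective : ∀ {z z′} → f z ≡ f z′ → z ≡ z′)
    (a b s : ℕ → ℕ) (lA : ∀ k → length (A k) ≡ a k) (lB : ∀ k → length (B k) ≡ b k) (lS : ∀ k → length (S k) ≡ s k)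
    (combine : ∀ i j {x y} → x ∈ A i → y ∈ B j → Σ Z λ z → z ∈ S (i ℕ.+ j) × f z ≡ (x , y))
    where

    open import Data.List.Membership.DecPropositional _≟X_ using (_∈?_)

    -- The points that enter at step `k`, in the application those whose gauge has ceiling `k`.
    -- Their generating series is (1 - t) times that of `A`.
    layer : ℕ → List X
    layer zero = A 0
    layer (suc k) = filter (λ x → ¬? (x ∈? A k)) (A (suc k))

    A-mono : ∀ {i j x} → i ℕ.≤ j → x ∈ A i → x ∈ A j
    A-mono {i} i≤j p = go (ℕₚ.≤⇒≤′ i≤j)
      where
      go : ∀ {j} → i ℕ.≤′ j → _ ∈ A j
      go ℕ.≤′-refl = p
      go (ℕ.≤′-step le) = monoA _ (go le)

    B-mono : ∀ {i j y} → i ℕ.≤ j → y ∈ B i → y ∈ B j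
    B-mono {i} i≤j p = go (ℕₚ.≤⇒≤′ i≤j)
      where
      go : ∀ {j} → i ℕ.≤′ j → _ ∈ B j
      go ℕ.≤′-refl = p
      go (ℕ.≤′-step le) = monoB _ (go le)

    layer⊆A : ∀ k {x} → x ∈ layer k → x ∈ A k
    layer⊆A zero p = p
    layer⊆A (suc k) p = proj₁ (∈-filter⁻ (λ x → ¬? (x ∈? A k)) p)

    find-layer : ∀ k {x} → x ∈ A k → Σ ℕ λ i → i ℕ.≤ k × x ∈ layer i
    find-layer zero p = 0 , ℕ.z≤n , p
    find-layer (suc k) {x} p with x ∈? A k
    ... | yes q = let (i , i≤k , r) = find-layer k q in i , ℕₚ.m≤n⇒m≤1+n i≤k , r
    ... | no q = suc k , ℕₚ.≤-refl , ∈-filter⁺ (λ x → ¬? (x ∈? A k)) p q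

    layer-disjoint : ∀ i j {x} → i ℕ.< j → x ∈ layer i → x ∈ layer j → ⊥
    layer-disjoint i (suc j) (ℕ.s≤s i≤j) p q = proj₂ (∈-filter⁻ (λ x → ¬? (x ∈? A j)) {xs = A (suc j)} q) (A-mono i≤j (layer⊆A i p))

    layer-unique : ∀ k → Unique (layer k)
    layer-unique zero = uA 0
    layer-unique (suc k) = Unique.filter⁺ (λ x → ¬? (x ∈? A k)) (uA (suc k))

    layer-length : ∀ k → + length (layer k) ≡ (oneMinusT^ 1 ⋆ natS a) k
    layer-length zero = trans (cong +_ (lA 0)) (sym (difference-zero (natS a)))
    layer-length (suc k) = trans (subtract (length (A k)) (length (layer (suc k))) (length-complement _≟X_ (uA k) (uA (suc k)) (monoA k)))
      (trans (cong₂ (λ p q → + p - + q) (lA (suc k)) (lA k)) (sym (difference-suc (natS a) k)))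
      where
      subtract : ∀ p q {r} → p ℕ.+ q ≡ r → + q ≡ + r - + p
      subtract p q refl = trans (sym (ℤₚ.+-identityʳ (+ q))) (trans (cong (ℤ._+_ (+ q)) (sym (ℤₚ.+-inverseʳ (+ p))))
        (trans (sym (ℤₚ.+-assoc (+ q) (+ p) (ℤ.- + p))) (cong (_- + p) (ℤₚ.+-comm (+ q) (+ p)))))

    -- Taking layers for the first component makes every pair occur only once, at the step where
    -- that component enters.
    decompositions : ℕ → List (X × Y)
    decompositions k = pairs B k layer

    decompositions-unique : ∀ k → Unique (decompositions k)
    decompositions-unique k = pairs-unique B k layer uB layer-unique layer-disjoint

    decompositions-length : ∀ k → + length (decompositions k) ≡ (oneMinusT^ 1 ⋆ (natS a ⋆ natS b)) k
    decompositions-length k = trans (pairs-length B k layer (oneMinusT^ 1 ⋆ natS a) b layer-length lB)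
      (⋆-assoc (oneMinusT^ 1) (natS a) (natS b) k)

    images : ℕ → List (X × Y)
    images k = map f (S k)

    images-unique : ∀ k → Unique (images k)
    images-unique k = Unique.map⁺ f-injective (uS k)

    images-length : ∀ k → length (images k) ≡ s k
    images-length k = trans (length-map f (S k)) (lS k)

    -- This inclusion only uses that sums of a point of `A i` and a point of `B j` land in
    -- `S (i + j)`; the product formula therefore amounts to the reverse inclusion.
    decompositions⊆images : ∀ k {p} → p ∈ decompositions k → p ∈ images k
    decompositions⊆images k {x , y} p =
      let (i , i≤k , x∈ , y∈) = pairs⁻ B k layer p
          (z , z∈ , eq) = combine i (k ℕ.∸ i) (layer⊆A i x∈) y∈
      in subst (_∈ images k) eq (∈-map⁺ f (subst (λ t → z ∈ S t) (ℕₚ.m+[n∸m]≡n i≤k) z∈))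

    Decomposes : ℕ → Z → Set
    Decomposes k z = Σ ℕ λ i → Σ ℕ λ j → i ℕ.+ j ≡ k × proj₁ (f z) ∈ A i × proj₂ (f z) ∈ B j

    -- The first component may have entered before step `i`; the surplus is handed to the second
    -- one, whose sets increase.
    decomposes⇒∈ : ∀ k z → Decomposes k z → f z ∈ decompositions k
    decomposes⇒∈ k z (i , j , refl , x∈ , y∈) =
      let (i′ , i′≤i , x∈′) = find-layer i x∈
          i′≤k = ℕₚ.≤-trans i′≤i (ℕₚ.m≤m+n i j)
      in pairs⁺ B k layer i′ i′≤k x∈′ (B-mono (subst (ℕ._≤ (i ℕ.+ j) ℕ.∸ i′) (ℕₚ.m+n∸m≡n i j) (ℕₚ.∸-monoʳ-≤ (i ℕ.+ j) i′≤i)) y∈)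

    ∈⇒decomposes : ∀ k z → f z ∈ decompositions k → Decomposes k z
    ∈⇒decomposes k z p = let (i , i≤k , x∈ , y∈) = pairs⁻ B k layer p in
      i , k ℕ.∸ i , ℕₚ.m+[n∸m]≡n i≤k , layer⊆A i x∈ , y∈

    decompose⇒count : (∀ k z → z ∈ S k → Decomposes k z) → natS s ≈s (oneMinusT^ 1 ⋆ (natS a ⋆ natS b))
    decompose⇒count h k = trans (cong +_ (sym (images-length k))) (trans (cong +_ (length-≡ (images-unique k) (decompositions-unique k)
      back (decompositions⊆images k))) (decompositions-length k))
      where
      back : ∀ {p} → p ∈ images k → p ∈ decompositions k
      back p∈ with ∈-map⁻ f p∈
      ... | z , z∈ , refl = decomposes⇒∈ k z (h k z z∈)

    count⇒decompose : natS s ≈s (oneMinusT^ 1 ⋆ (natS a ⋆ natS b)) → ∀ k z → z ∈ S k → Decomposes k z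
    count⇒decompose h k z z∈ = ∈⇒decomposes k z (full-⊆ _≟Z_ (decompositions-unique k) (decompositions⊆images k)
      (ℕₚ.≤-reflexive (trans (images-length k) (ℤₚ.+-injective (trans (h k) (sym (decompositions-length k)))))) (∈-map⁺ f z∈))

-- Rational polytopes: duality, gauges, projections, lattice points, dimension and denominator.

module Polytopes where

  open import Defs
  open Determinant using (Matrix; identity; det≡1⇒left-inverse)
  open Counting
  open import Data.Nat as ℕ using (ℕ; zero; suc)
  import Data.Nat.Properties as ℕₚ
  open import Data.Nat.Divisibility using (_∣_; divides; ∣⇒≤; 0∣⇒≡0)
  open import Data.Nat.GCD using (gcd; gcd-GCD; gcd[m,n]∣m; gcd[m,n]∣n; gcd[m,n]≢0; module Bézout)
  open import Data.Nat.LCM using (lcm; m∣lcm[m,n]; n∣lcm[m,n]; lcm-least)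
  open import Data.Integer as ℤ using (ℤ; -[1+_])
  import Data.Integer.Properties as ℤₚ
  import Data.Integer.GCD as GCD
  open import Data.Rational
  open import Data.Rational.Properties
  import Data.Rational.Unnormalised as ℚᵘ
  import Data.Rational.Unnormalised.Properties as ℚᵘₚ
  open import Data.Bool using (Bool; true; false; if_then_else_)
  open import Data.Fin using (Fin; zero; suc; splitAt; punchIn; punchOut; _↑ˡ_; _↑ʳ_) renaming (_≟_ to _≟F_)
  open import Data.Fin.Properties using (splitAt-↑ˡ; splitAt-↑ʳ; splitAt⁻¹-↑ˡ; splitAt⁻¹-↑ʳ; punchIn-punchOut)
  open import Data.Vec as Vec using (Vec; []; _∷_; lookup; tabulate)
  open import Data.Vec.Properties using (lookup∘tabulate; tabulate∘lookup; tabulate-cong; lookup-map; ≡-dec)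
  open import Data.Vec.Functional using (insertAt)
  open import Data.Vec.Functional.Properties using (insertAt-lookup; insertAt-punchIn)
  open import Data.List using (List; []; _∷_; length)
  open import Data.List.Membership.Propositional using (_∈_)
  open import Data.List.Relation.Unary.All using ([])
  open import Data.List.Relation.Unary.AllPairs using ([]; _∷_)
  open import Data.List.Relation.Unary.Any using (here)
  open import Data.List.Relation.Unary.Unique.Propositional using (Unique)
  open import Data.Product using (Σ; _×_; _,_; proj₁; proj₂)
  import Data.Product.Properties as Product
  open import Data.Sum using (_⊎_; inj₁; inj₂; [_,_]′; fromInj₁) renaming (map to map⊎)
  open import Data.Empty using (⊥; ⊥-elim)
  open import Function using (_∘_; id)
  open import Level using (0ℓ)
  open import Relation.Nullary using (yes; no; ¬_; Dec; does)
  open import Relation.Nullary.Decidable using (dec⇒maybe)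
  open import Relation.Binary using (DecidableEquality)
  open import Relation.Binary.Definitions using (tri<; tri≈; tri>)
  open import Relation.Binary.PropositionalEquality
  open import Tactic.RingSolver using (solve-∀)
  open import Tactic.RingSolver.Core.AlmostCommutativeRing using (AlmostCommutativeRing; fromCommutativeRing)

  ℚ-ring : AlmostCommutativeRing 0ℓ 0ℓ
  ℚ-ring = fromCommutativeRing +-*-commutativeRing (λ x → dec⇒maybe (0ℚ ≟ x))

  -- Ordered field arithmetic

  isolateʳ : ∀ a b → b ≡ (a + b) - a
  isolateʳ = solve-∀ ℚ-ring

  -1*-≡- : ∀ a → - 1ℚ * a ≡ - a
  -1*-≡- = solve-∀ ℚ-ring

  1*+0 : ∀ a → 1ℚ * a + 0ℚ ≡ a
  1*+0 = solve-∀ ℚ-ring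

  1*0+ : ∀ a → 1ℚ * 0ℚ + a ≡ a
  1*0+ = solve-∀ ℚ-ring

  *-swap : ∀ a b c → a * (b * c) ≡ b * (a * c)
  *-swap = solve-∀ ℚ-ring

  *-rotate : ∀ a b c → a * b * c ≡ b * (a * c)
  *-rotate = solve-∀ ℚ-ring

  -+-cancel : ∀ a b → (b - a) + a ≡ b
  -+-cancel = solve-∀ ℚ-ring

  0≤-⇒≤ : ∀ {a b} → 0ℚ ≤ b - a → a ≤ b
  0≤-⇒≤ {a} {b} h = subst₂ _≤_ (+-identityˡ a) (-+-cancel a b) (+-monoˡ-≤ a h)

  ≤⇒0≤- : ∀ {a b} → a ≤ b → 0ℚ ≤ b - a
  ≤⇒0≤- {a} {b} h = subst (_≤ b - a) (+-inverseʳ a) (+-monoˡ-≤ (- a) h)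

  0<-⇒< : ∀ {a b} → 0ℚ < b - a → a < b
  0<-⇒< {a} {b} h = subst₂ _<_ (+-identityˡ a) (-+-cancel a b) (+-monoˡ-< a h)

  <⇒0<- : ∀ {a b} → a < b → 0ℚ < b - a
  <⇒0<- {a} {b} h = subst (_< b - a) (+-inverseʳ a) (+-monoˡ-< (- a) h)

  -≡0⇒≡ : ∀ {a b} → a - b ≡ 0ℚ → a ≡ b
  -≡0⇒≡ {a} {b} h = trans (cancel a b) (trans (cong (_+ b) h) (+-identityˡ b))
    where
    cancel : ∀ a b → a ≡ (a - b) + b
    cancel = solve-∀ ℚ-ring

  +-nonneg : ∀ {a b} → 0ℚ ≤ a → 0ℚ ≤ b → 0ℚ ≤ a + b
  +-nonneg {a} {b} p q = subst (_≤ a + b) (+-identityˡ 0ℚ) (+-mono-≤ p q)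

  *-nonneg : ∀ {a b} → 0ℚ ≤ a → 0ℚ ≤ b → 0ℚ ≤ a * b
  *-nonneg {a} {b} p q = nonNegative⁻¹ (a * b)
    {{nonNeg*nonNeg⇒nonNeg a {{nonNegative p}} b {{nonNegative q}}}}

  *-pos : ∀ {a b} → 0ℚ < a → 0ℚ < b → 0ℚ < a * b
  *-pos {a} {b} p q = positive⁻¹ (a * b) {{pos*pos⇒pos a {{positive p}} b {{positive q}}}}

  *-monoˡ : ∀ {a b c} → 0ℚ ≤ c → a ≤ b → c * a ≤ c * b
  *-monoˡ {c = c} p = *-monoˡ-≤-nonNeg c {{nonNegative p}}

  neg-nonneg : ∀ {a} → a ≤ 0ℚ → 0ℚ ≤ - a
  neg-nonneg = neg-antimono-≤

  neg-pos′ : ∀ {a} → a < 0ℚ → 0ℚ < - a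
  neg-pos′ = neg-antimono-<

  ≤∧≢⇒< : ∀ {a b} → a ≤ b → a ≢ b → a < b
  ≤∧≢⇒< {a} {b} p q with <-cmp a b
  ... | tri< lt _ _ = lt
  ... | tri≈ _ eq _ = ⊥-elim (q eq)
  ... | tri> _ _ gt = ⊥-elim (q (≤-antisym p (<⇒≤ gt)))

  inverse : ∀ {a} → a ≢ 0ℚ → Σ ℚ λ b → a * b ≡ 1ℚ
  inverse {a} h = (1/ a) {{≢-nonZero h}} , *-inverseʳ a {{≢-nonZero h}}

  inverse-pos : ∀ {a} → 0ℚ < a → Σ ℚ λ b → 0ℚ < b × a * b ≡ 1ℚ
  inverse-pos {a} p = (1/ a) {{nz}} , positive⁻¹ ((1/ a) {{nz}}) {{1/pos⇒pos a {{positive p}}}} , *-inverseʳ a {{nz}}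
    where nz = pos⇒nonZero a {{positive p}}

  *-cancelˡ-≡0 : ∀ {a b} → a ≢ 0ℚ → a * b ≡ 0ℚ → b ≡ 0ℚ
  *-cancelˡ-≡0 {a} {b} h ab≡0 with inverse h
  ... | c , ac≡1 = trans (sym (*-identityˡ b)) (trans (cong (_* b) (sym ac≡1))
    (trans (rearrange a b c) (trans (cong (c *_) ab≡0) (*-zeroʳ c))))
    where
    rearrange : ∀ a b c → a * c * b ≡ c * (a * b)
    rearrange = solve-∀ ℚ-ring

  square-nonneg : ∀ a → 0ℚ ≤ a * a
  square-nonneg a with ≤-total 0ℚ a
  ... | inj₁ p = *-nonneg p p
  ... | inj₂ p = subst (0ℚ ≤_) (signs a) (*-nonneg (neg-nonneg p) (neg-nonneg p))
    where
    signs : ∀ a → (- a) * (- a) ≡ a * a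
    signs = solve-∀ ℚ-ring

  0<1 : 0ℚ < 1ℚ
  0<1 = positive⁻¹ 1ℚ

  -- Finite sums

  sum-cong : ∀ {m} {f g : Fin m → ℚ} → (∀ i → f i ≡ g i) → sumℚ m f ≡ sumℚ m g
  sum-cong {zero} h = refl
  sum-cong {suc m} h = cong₂ _+_ (h zero) (sum-cong (h ∘ suc))

  sum-zero : ∀ m {f : Fin m → ℚ} → (∀ i → f i ≡ 0ℚ) → sumℚ m f ≡ 0ℚ
  sum-zero zero h = refl
  sum-zero (suc m) h = trans (cong₂ _+_ (h zero) (sum-zero m (h ∘ suc))) (+-identityˡ 0ℚ)

  sum-+ : ∀ m (f g : Fin m → ℚ) → sumℚ m (λ i → f i + g i) ≡ sumℚ m f + sumℚ m g
  sum-+ zero f g = sym (+-identityˡ 0ℚ)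
  sum-+ (suc m) f g = trans (cong ((f zero + g zero) +_) (sum-+ m (f ∘ suc) (g ∘ suc)))
    (interchange (f zero) (g zero) _ _)
    where
    interchange : ∀ a b c d → (a + b) + (c + d) ≡ (a + c) + (b + d)
    interchange = solve-∀ ℚ-ring

  sum-*ˡ : ∀ m (c : ℚ) (f : Fin m → ℚ) → sumℚ m (λ i → c * f i) ≡ c * sumℚ m f
  sum-*ˡ zero c f = sym (*-zeroʳ c)
  sum-*ˡ (suc m) c f = trans (cong (c * f zero +_) (sum-*ˡ m c (f ∘ suc))) (sym (*-distribˡ-+ c _ _))

  sum-*ʳ : ∀ m (c : ℚ) (f : Fin m → ℚ) → sumℚ m (λ i → f i * c) ≡ sumℚ m f * c
  sum-*ʳ m c f = trans (sum-cong (λ i → *-comm (f i) c)) (trans (sum-*ˡ m c f) (*-comm c _))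

  sum-swap : ∀ m n (f : Fin m → Fin n → ℚ) →
    sumℚ m (λ i → sumℚ n (f i)) ≡ sumℚ n (λ j → sumℚ m (λ i → f i j))
  sum-swap zero n f = sym (sum-zero n (λ _ → refl))
  sum-swap (suc m) n f = trans (cong (sumℚ n (f zero) +_) (sum-swap m n (f ∘ suc)))
    (sym (sum-+ n (f zero) _))

  sum-split : ∀ m m′ (f : Fin (m ℕ.+ m′) → ℚ) →
    sumℚ (m ℕ.+ m′) f ≡ sumℚ m (λ i → f (i ↑ˡ m′)) + sumℚ m′ (λ j → f (m ↑ʳ j))
  sum-split zero m′ f = sym (+-identityˡ _)
  sum-split (suc m) m′ f = trans (cong (f zero +_) (sum-split m m′ (f ∘ suc))) (sym (+-assoc (f zero) _ _))

  sum-nonneg : ∀ m {f : Fin m → ℚ} → (∀ i → 0ℚ ≤ f i) → 0ℚ ≤ sumℚ m f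
  sum-nonneg zero h = ≤-refl
  sum-nonneg (suc m) h = +-nonneg (h zero) (sum-nonneg m (h ∘ suc))

  sum-mono : ∀ m {f g : Fin m → ℚ} → (∀ i → f i ≤ g i) → sumℚ m f ≤ sumℚ m g
  sum-mono zero h = ≤-refl
  sum-mono (suc m) h = +-mono-≤ (h zero) (sum-mono m (h ∘ suc))

  sum-nonneg-≤0 : ∀ m {f : Fin m → ℚ} → (∀ i → 0ℚ ≤ f i) → sumℚ m f ≤ 0ℚ → ∀ i → f i ≡ 0ℚ
  sum-nonneg-≤0 (suc m) {f} h s zero =
    ≤-antisym (≤-trans (0≤-⇒≤ (subst (0ℚ ≤_) (isolateʳ (f zero) _) (sum-nonneg m (h ∘ suc)))) s) (h zero)
  sum-nonneg-≤0 (suc m) {f} h s (suc i) = sum-nonneg-≤0 m (h ∘ suc)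
    (≤-trans (0≤-⇒≤ (subst (0ℚ ≤_) (drop (f zero) _) (h zero))) s) i
    where
    drop : ∀ a b → a ≡ (a + b) - b
    drop = solve-∀ ℚ-ring

  point : ∀ {m} → Fin m → ℚ → Fin m → ℚ
  point zero q zero = q
  point zero q (suc _) = 0ℚ
  point (suc k) q zero = 0ℚ
  point (suc k) q (suc i) = point k q i

  sum-point-* : ∀ {m} (k : Fin m) q (f : Fin m → ℚ) → sumℚ m (λ i → point k q i * f i) ≡ q * f k
  sum-point-* {suc m} zero q f =
    trans (cong (q * f zero +_) (sum-zero m (λ i → *-zeroˡ (f (suc i))))) (+-identityʳ _)
  sum-point-* {suc m} (suc k) q f =
    trans (cong₂ _+_ (*-zeroˡ (f zero)) (sum-point-* k q (f ∘ suc))) (+-identityˡ _)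

  sum-point : ∀ {m} (k : Fin m) q → sumℚ m (point k q) ≡ q
  sum-point {m} k q = trans (sum-cong (λ i → sym (*-identityʳ (point k q i))))
    (trans (sum-point-* k q (λ _ → 1ℚ)) (*-identityʳ q))

  point-nonneg : ∀ {m} (k : Fin m) {q} → 0ℚ ≤ q → ∀ i → 0ℚ ≤ point k q i
  point-nonneg zero h zero = h
  point-nonneg zero h (suc i) = ≤-refl
  point-nonneg (suc k) h zero = ≤-refl
  point-nonneg (suc k) h (suc i) = point-nonneg k h i

  -- Integers inside the rationals

  toℚᵘ-ℤtoℚ : ∀ z → toℚᵘ (ℤtoℚ z) ℚᵘ.≃ (z ℚᵘ./ 1)
  toℚᵘ-ℤtoℚ z = toℚᵘ-fromℚᵘ (z ℚᵘ./ 1)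

  ℤtoℚ-+ : ∀ a b → ℤtoℚ (a ℤ.+ b) ≡ ℤtoℚ a + ℤtoℚ b
  ℤtoℚ-+ a b = toℚᵘ-injective (ℚᵘₚ.≃-trans (toℚᵘ-ℤtoℚ (a ℤ.+ b)) (ℚᵘₚ.≃-trans
    (ℚᵘ.*≡* (cong (ℤ._* ℤ.+ 1) (cong₂ ℤ._+_ (sym (ℤₚ.*-identityʳ a)) (sym (ℤₚ.*-identityʳ b)))))
    (ℚᵘₚ.≃-sym (ℚᵘₚ.≃-trans (toℚᵘ-homo-+ (ℤtoℚ a) (ℤtoℚ b))
      (ℚᵘₚ.+-cong (toℚᵘ-ℤtoℚ a) (toℚᵘ-ℤtoℚ b))))))

  ℤtoℚ-* : ∀ a b → ℤtoℚ (a ℤ.* b) ≡ ℤtoℚ a * ℤtoℚ b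
  ℤtoℚ-* a b = toℚᵘ-injective (ℚᵘₚ.≃-trans (toℚᵘ-ℤtoℚ (a ℤ.* b)) (ℚᵘₚ.≃-trans
    (ℚᵘ.*≡* refl)
    (ℚᵘₚ.≃-sym (ℚᵘₚ.≃-trans (toℚᵘ-homo-* (ℤtoℚ a) (ℤtoℚ b))
      (ℚᵘₚ.*-cong (toℚᵘ-ℤtoℚ a) (toℚᵘ-ℤtoℚ b))))))

  ℤtoℚ-injective : ∀ {a b} → ℤtoℚ a ≡ ℤtoℚ b → a ≡ b
  ℤtoℚ-injective {a} {b} eq with /-injective-≃ (a ℚᵘ./ 1) (b ℚᵘ./ 1) eq
  ... | ℚᵘ.*≡* h = trans (sym (ℤₚ.*-identityʳ a)) (trans h (ℤₚ.*-identityʳ b))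

  ℤtoℚ-mono-≤ : ∀ {a b} → a ℤ.≤ b → ℤtoℚ a ≤ ℤtoℚ b
  ℤtoℚ-mono-≤ {a} {b} h = toℚᵘ-cancel-≤ (ℚᵘₚ.≤-respˡ-≃ (ℚᵘₚ.≃-sym (toℚᵘ-ℤtoℚ a))
    (ℚᵘₚ.≤-respʳ-≃ (ℚᵘₚ.≃-sym (toℚᵘ-ℤtoℚ b)) (ℚᵘ.*≤* (ℤₚ.*-monoʳ-≤-nonNeg (ℤ.+ 1) h))))

  ℤtoℚ-cancel-≤ : ∀ {a b} → ℤtoℚ a ≤ ℤtoℚ b → a ℤ.≤ b
  ℤtoℚ-cancel-≤ {a} {b} h with ℚᵘₚ.≤-respˡ-≃ (toℚᵘ-ℤtoℚ a) (ℚᵘₚ.≤-respʳ-≃ (toℚᵘ-ℤtoℚ b) (toℚᵘ-mono-≤ h))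
  ... | ℚᵘ.*≤* le = subst₂ ℤ._≤_ (ℤₚ.*-identityʳ a) (ℤₚ.*-identityʳ b) le

  ℤtoℚ-neg : ∀ a → ℤtoℚ (ℤ.- a) ≡ - ℤtoℚ a
  ℤtoℚ-neg a = -≡0⇒≡ (trans (double (ℤtoℚ (ℤ.- a)) (ℤtoℚ a))
    (trans (sym (ℤtoℚ-+ (ℤ.- a) a)) (cong ℤtoℚ (ℤₚ.+-inverseˡ a))))
    where
    double : ∀ a b → a - - b ≡ a + b
    double = solve-∀ ℚ-ring

  abstract
    -- Abstract, so that it never unfolds to a normalized fraction; `ℕtoℚ-def` is the passage to
    -- `ℤtoℚ`.
    ℕtoℚ : ℕ → ℚ
    ℕtoℚ k = ℤtoℚ (ℤ.+ k)

    ℕtoℚ-def : ∀ k → ℕtoℚ k ≡ ℤtoℚ (ℤ.+ k)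
    ℕtoℚ-def k = refl

    ℕtoℚ-0 : ℕtoℚ 0 ≡ 0ℚ
    ℕtoℚ-0 = refl

    ℕtoℚ-1 : ℕtoℚ 1 ≡ 1ℚ
    ℕtoℚ-1 = refl

    ℕtoℚ-+ : ∀ a b → ℕtoℚ (a ℕ.+ b) ≡ ℕtoℚ a + ℕtoℚ b
    ℕtoℚ-+ a b = ℤtoℚ-+ (ℤ.+ a) (ℤ.+ b)

    ℕtoℚ-* : ∀ a b → ℕtoℚ (a ℕ.* b) ≡ ℕtoℚ a * ℕtoℚ b
    ℕtoℚ-* a b = trans (cong ℤtoℚ (ℤₚ.pos-* a b)) (ℤtoℚ-* (ℤ.+ a) (ℤ.+ b))

    ℕtoℚ-mono : ∀ {a b} → a ℕ.≤ b → ℕtoℚ a ≤ ℕtoℚ b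
    ℕtoℚ-mono h = ℤtoℚ-mono-≤ (ℤ.+≤+ h)

    ℕtoℚ-cancel-≤ : ∀ {a b} → ℕtoℚ a ≤ ℕtoℚ b → a ℕ.≤ b
    ℕtoℚ-cancel-≤ {a} {b} h = ℤₚ.drop‿+≤+ (ℤtoℚ-cancel-≤ {ℤ.+ a} {ℤ.+ b} h)

  ℕtoℚ-isInt : ∀ k → IsInt (ℕtoℚ k)
  ℕtoℚ-isInt k = ℤ.+ k , ℕtoℚ-def k

  ℕtoℚ-nonneg : ∀ a → 0ℚ ≤ ℕtoℚ a
  ℕtoℚ-nonneg a = subst (_≤ ℕtoℚ a) ℕtoℚ-0 (ℕtoℚ-mono ℕ.z≤n)

  ℕtoℚ-pos : ∀ {a} → 1 ℕ.≤ a → 0ℚ < ℕtoℚ a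
  ℕtoℚ-pos {a} h = <-≤-trans 0<1 (subst (_≤ ℕtoℚ a) ℕtoℚ-1 (ℕtoℚ-mono h))

  ℕtoℚ-suc : ∀ a → ℕtoℚ (suc a) ≡ 1ℚ + ℕtoℚ a
  ℕtoℚ-suc a = trans (ℕtoℚ-+ 1 a) (cong (_+ ℕtoℚ a) ℕtoℚ-1)

  ℕtoℚ-cancel-< : ∀ {a b} → ℕtoℚ a < ℕtoℚ b → a ℕ.< b
  ℕtoℚ-cancel-< {a} {b} h with ℕₚ.<-≤-connex a b
  ... | inj₁ lt = lt
  ... | inj₂ ge = ⊥-elim (<-irrefl refl (<-≤-trans h (ℕtoℚ-mono ge)))

  isInt? : ∀ q → Dec (IsInt q)
  isInt? q@(mkℚ a zero c) = yes (a , toℚᵘ-injective (ℚᵘₚ.≃-sym (toℚᵘ-ℤtoℚ a)))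
  isInt? q@(mkℚ a (suc d) c) = no λ { (z , eq) → ℕₚ.1+n≢0 (cong ℕ.pred (trans (cong ↧ₙ_ eq) (den1 z))) }
    where
    den1 : ∀ z → ↧ₙ (ℤtoℚ z) ≡ 1
    den1 z = ℕₚ.m*n≡1⇒m≡1 (↧ₙ (ℤtoℚ z)) ℤ.∣ GCD.gcd z (ℤ.+ 1) ∣ (ℤₚ.+-injective (trans (ℤₚ.pos-* (↧ₙ (ℤtoℚ z)) ℤ.∣ GCD.gcd z (ℤ.+ 1) ∣) (↧-/ z 1)))

  denominator-clears : ∀ q → IsInt (ℕtoℚ (↧ₙ q) * q)
  denominator-clears q@(mkℚ a d c) = a , trans (cong (_* q) (ℕtoℚ-def (suc d))) (toℚᵘ-injective (ℚᵘₚ.≃-trans (toℚᵘ-homo-* (ℤtoℚ (ℤ.+ suc d)) q)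
    (ℚᵘₚ.≃-trans (ℚᵘₚ.*-congʳ (toℚᵘ-ℤtoℚ (ℤ.+ suc d)))
      (ℚᵘₚ.≃-trans (ℚᵘ.*≡* (trans (ℤₚ.*-identityʳ _) (trans (ℤₚ.*-comm (ℤ.+ suc d) a) (cong (λ t → a ℤ.* ℤ.+ t) (sym (ℕₚ.+-identityʳ (suc d)))))))
        (ℚᵘₚ.≃-sym (toℚᵘ-ℤtoℚ a))))))

  isInt-+ : ∀ {a b} → IsInt a → IsInt b → IsInt (a + b)
  isInt-+ (x , refl) (y , refl) = x ℤ.+ y , sym (ℤtoℚ-+ x y)

  isInt-* : ∀ {a b} → IsInt a → IsInt b → IsInt (a * b)
  isInt-* (x , refl) (y , refl) = x ℤ.* y , sym (ℤtoℚ-* x y)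

  isInt-neg : ∀ {a} → IsInt a → IsInt (- a)
  isInt-neg (x , refl) = ℤ.- x , sym (ℤtoℚ-neg x)

  isInt-sum : ∀ m {f : Fin m → ℚ} → (∀ i → IsInt (f i)) → IsInt (sumℚ m f)
  isInt-sum zero h = ℤ.+ 0 , refl
  isInt-sum (suc m) h = isInt-+ (h zero) (isInt-sum m (h ∘ suc))

  isInt-nonneg : ∀ {a} → IsInt a → 0ℚ ≤ a → Σ ℕ λ k → a ≡ ℕtoℚ k
  isInt-nonneg (ℤ.+ k , eq) h = k , trans eq (sym (ℕtoℚ-def k))
  isInt-nonneg (-[1+ k ] , refl) h with ℤtoℚ-cancel-≤ {ℤ.+ 0} { -[1+ k ]} h
  ... | ()

  floorℕ : ∀ q → 0ℚ ≤ q → Σ ℕ λ k → ℕtoℚ k ≤ q × q < ℕtoℚ (suc k)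
  -- A nonnegative rational is at most its numerator, as the denominator is at least 1; the search
  -- descends from there.
  floorℕ q h = search (suc ℤ.∣ ↥ q ∣) bound
    where
    search : ∀ k → q < ℕtoℚ k → Σ ℕ λ k → ℕtoℚ k ≤ q × q < ℕtoℚ (suc k)
    search zero lt = ⊥-elim (<-irrefl refl (<-≤-trans (subst (q <_) ℕtoℚ-0 lt) h))
    search (suc k) lt with ℕtoℚ k ≤? q
    ... | yes le = k , le , lt
    ... | no nle = search k (≰⇒> nle)
    bound : q < ℕtoℚ (suc ℤ.∣ ↥ q ∣)
    bound = ≤-<-trans {q} {ℕtoℚ ℤ.∣ ↥ q ∣} (le q h)
      (0<-⇒< (subst (0ℚ <_) (sym (trans (cong (_- ℕtoℚ ℤ.∣ ↥ q ∣) (ℕtoℚ-suc ℤ.∣ ↥ q ∣)) (drop 1ℚ (ℕtoℚ ℤ.∣ ↥ q ∣)))) 0<1))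
      where
      drop : ∀ a b → (a + b) - b ≡ a
      drop = solve-∀ ℚ-ring
      le : ∀ q → 0ℚ ≤ q → q ≤ ℕtoℚ ℤ.∣ ↥ q ∣
      le q@(mkℚ (ℤ.+ a) d c) _ = subst (q ≤_) (sym (ℕtoℚ-def a)) (toℚᵘ-cancel-≤ (ℚᵘₚ.≤-respʳ-≃ (ℚᵘₚ.≃-sym (toℚᵘ-ℤtoℚ (ℤ.+ a)))
        (ℚᵘ.*≤* (ℤₚ.*-monoˡ-≤-nonNeg (ℤ.+ a) {ℤ.+ 1} {ℤ.+ suc d} (ℤ.+≤+ (ℕ.s≤s ℕ.z≤n))))))
      le q@(mkℚ -[1+ a ] d c) (*≤* ())

  -- Vectors, Farkas and Fredholm

  lookup-ext : ∀ {n} {x y : Pt n} → (∀ i → lookup x i ≡ lookup y i) → x ≡ y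
  lookup-ext {x = x} {y} h = trans (sym (tabulate∘lookup x)) (trans (tabulate-cong h) (tabulate∘lookup y))

  addmul : ∀ {n} → ℚ → Pt n → Pt n → Pt n
  addmul c x y = tabulate (λ i → c * lookup x i + lookup y i)

  dot-comm : ∀ {n} (x y : Pt n) → x · y ≡ y · x
  dot-comm x y = sum-cong (λ i → *-comm (lookup x i) (lookup y i))

  dot-addmul : ∀ {n} (w : Pt n) c x y → w · addmul c x y ≡ c * (w · x) + w · y
  dot-addmul {n} w c x y = trans
    (sum-cong (λ i → trans (cong (lookup w i *_) (lookup∘tabulate _ i)) (expand (lookup w i) c (lookup x i) (lookup y i))))
    (trans (sum-+ n _ _) (cong (_+ w · y) (sum-*ˡ n c _)))
    where
    expand : ∀ w c x y → w * (c * x + y) ≡ c * (w * x) + w * y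
    expand = solve-∀ ℚ-ring

  addmul-dot : ∀ {n} c (x y w : Pt n) → addmul c x y · w ≡ c * (x · w) + y · w
  addmul-dot c x y w = trans (dot-comm (addmul c x y) w) (trans (dot-addmul w c x y)
    (cong₂ (λ s t → c * s + t) (dot-comm w x) (dot-comm w y)))

  dot-*v : ∀ {n} (w : Pt n) c x → w · (c *v x) ≡ c * (w · x)
  dot-*v {n} w c x = trans
    (sum-cong (λ i → trans (cong (lookup w i *_) (lookup-map i (c *_) x)) (*-swap (lookup w i) c (lookup x i))))
    (sum-*ˡ n c _)

  *v-dot : ∀ {n} c (x w : Pt n) → (c *v x) · w ≡ c * (x · w)
  *v-dot c x w = trans (dot-comm (c *v x) w) (trans (dot-*v w c x) (cong (c *_) (dot-comm w x)))

  dot-0v : ∀ {n} (w : Pt n) → w · 0v ≡ 0ℚ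
  dot-0v {n} w = sum-zero n (λ i → trans (cong (lookup w i *_) (lookup∘tabulate _ i)) (*-zeroʳ (lookup w i)))

  dot-lincomb : ∀ {n m} (w : Pt n) c (v : Fin m → Pt n) →
    w · lincomb c v ≡ sumℚ m (λ k → c k * (w · v k))
  dot-lincomb {n} {m} w c v = begin
    w · lincomb c v
      ≡⟨ sum-cong (λ i → cong (lookup w i *_) (lookup∘tabulate _ i)) ⟩
    sumℚ n (λ i → lookup w i * sumℚ m (λ k → c k * lookup (v k) i))
      ≡⟨ sum-cong (λ i → sym (sum-*ˡ m (lookup w i) _)) ⟩
    sumℚ n (λ i → sumℚ m (λ k → lookup w i * (c k * lookup (v k) i)))
      ≡⟨ sum-swap n m _ ⟩
    sumℚ m (λ k → sumℚ n (λ i → lookup w i * (c k * lookup (v k) i)))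
      ≡⟨ sum-cong (λ k → trans (sum-cong (λ i → *-swap (lookup w i) (c k) (lookup (v k) i))) (sum-*ˡ n (c k) _)) ⟩
    sumℚ m (λ k → c k * (w · v k)) ∎
    where
    open ≡-Reasoning

  lookup-e : ∀ {n} (i j : Fin n) → lookup (e i) j ≡ point i 1ℚ j
  lookup-e zero zero = refl
  lookup-e zero (suc j) = lookup∘tabulate _ j
  lookup-e (suc i) zero = refl
  lookup-e (suc i) (suc j) = trans (lookup∘tabulate _ j) (lookup-e i j)

  e-dot : ∀ {n} i (x : Pt n) → e i · x ≡ lookup x i
  e-dot i x = trans (sum-cong (λ j → cong (_* lookup x j) (lookup-e i j)))
    (trans (sum-point-* i 1ℚ (lookup x)) (*-identityˡ _))

  -- Vector identities are checked by pairing with an arbitrary functional.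
  dot-ext : ∀ {n} {x y : Pt n} → (∀ w → w · x ≡ w · y) → x ≡ y
  dot-ext {x = x} {y} h = lookup-ext (λ i → trans (sym (e-dot i x)) (trans (h (e i)) (e-dot i y)))

  lincomb-cong : ∀ {n m} {c d : Fin m → ℚ} {v w : Fin m → Pt n} →
    (∀ k → c k ≡ d k) → (∀ k → v k ≡ w k) → lincomb c v ≡ lincomb d w
  lincomb-cong h g = tabulate-cong (λ i → sum-cong (λ k → cong₂ _*_ (h k) (cong (λ x → lookup x i) (g k))))

  lincomb-point : ∀ {n m} (k : Fin m) q (v : Fin m → Pt n) → lincomb (point k q) v ≡ q *v v k
  lincomb-point k q v = dot-ext (λ w → trans (dot-lincomb w (point k q) v)
    (trans (sum-point-* k q (λ i → w · v i)) (sym (dot-*v w q (v k)))))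

  lincomb-*v : ∀ {n m} t (c : Fin m → ℚ) (v : Fin m → Pt n) → lincomb (λ k → t * c k) v ≡ t *v lincomb c v
  lincomb-*v {m = m} t c v = dot-ext (λ w → trans (dot-lincomb w (λ k → t * c k) v) (trans
    (trans (sum-cong (λ k → *-assoc t (c k) (w · v k))) (sum-*ˡ m t _))
    (sym (trans (dot-*v w t (lincomb c v)) (cong (t *_) (dot-lincomb w c v))))))

  lincomb-addmul : ∀ {n m} t (c d : Fin m → ℚ) (v : Fin m → Pt n) →
    lincomb (λ k → t * c k + d k) v ≡ addmul t (lincomb c v) (lincomb d v)
  lincomb-addmul {m = m} t c d v = dot-ext λ w → begin
    w · lincomb (λ k → t * c k + d k) v
      ≡⟨ dot-lincomb w (λ k → t * c k + d k) v ⟩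
    sumℚ m (λ k → (t * c k + d k) * (w · v k))
      ≡⟨ sum-cong (λ k → expand t (c k) (d k) (w · v k)) ⟩
    sumℚ m (λ k → t * (c k * (w · v k)) + d k * (w · v k))
      ≡⟨ trans (sum-+ m _ _) (cong (_+ sumℚ m (λ k → d k * (w · v k))) (sum-*ˡ m t _)) ⟩
    t * sumℚ m (λ k → c k * (w · v k)) + sumℚ m (λ k → d k * (w · v k))
      ≡⟨ sym (cong₂ (λ x y → t * x + y) (dot-lincomb w c v) (dot-lincomb w d v)) ⟩
    t * (w · lincomb c v) + w · lincomb d v
      ≡⟨ sym (dot-addmul w t (lincomb c v) (lincomb d v)) ⟩
    w · addmul t (lincomb c v) (lincomb d v) ∎
    where
    open ≡-Reasoning
    expand : ∀ t c d x → (t * c + d) * x ≡ t * (c * x) + d * x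
    expand = solve-∀ ℚ-ring

  prepend0 : ∀ {m} → (Fin m → ℚ) → Fin (suc m) → ℚ
  prepend0 c zero = 0ℚ
  prepend0 c (suc k) = c k

  lincomb-prepend0 : ∀ {n m} (c : Fin m → ℚ) (v : Fin (suc m) → Pt n) → lincomb (prepend0 c) v ≡ lincomb c (v ∘ suc)
  lincomb-prepend0 {m = m} c v = dot-ext λ w → trans (dot-lincomb w (prepend0 c) v) (trans
    (cong (_+ sumℚ m (λ k → c k * (w · v (suc k)))) (*-zeroˡ (w · v zero)))
    (trans (+-identityˡ (sumℚ m (λ k → c k * (w · v (suc k))))) (sym (dot-lincomb w c (v ∘ suc)))))

  lincomb-lincomb : ∀ {n m r} (c : Fin m → ℚ) (d : Fin m → Fin r → ℚ) (v : Fin r → Pt n) →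
    lincomb c (λ k → lincomb (d k) v) ≡ lincomb (λ j → sumℚ m (λ k → c k * d k j)) v
  lincomb-lincomb {m = m} {r} c d v = dot-ext λ w → begin
    w · lincomb c (λ k → lincomb (d k) v)
      ≡⟨ trans (dot-lincomb w c (λ k → lincomb (d k) v)) (sum-cong (λ k → cong (c k *_) (dot-lincomb w (d k) v))) ⟩
    sumℚ m (λ k → c k * sumℚ r (λ j → d k j * (w · v j)))
      ≡⟨ sum-cong (λ k → sym (sum-*ˡ r (c k) _)) ⟩
    sumℚ m (λ k → sumℚ r (λ j → c k * (d k j * (w · v j))))
      ≡⟨ sum-swap m r _ ⟩
    sumℚ r (λ j → sumℚ m (λ k → c k * (d k j * (w · v j))))
      ≡⟨ sum-cong (λ j → trans (sum-cong (λ k → sym (*-assoc (c k) (d k j) (w · v j)))) (sum-*ʳ m (w · v j) _)) ⟩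
    sumℚ r (λ j → sumℚ m (λ k → c k * d k j) * (w · v j))
      ≡⟨ sym (dot-lincomb w (λ j → sumℚ m (λ k → c k * d k j)) v) ⟩
    w · lincomb (λ j → sumℚ m (λ k → c k * d k j)) v ∎
    where open ≡-Reasoning

  InCone : ∀ {n m} → (Fin m → Pt n) → Pt n → Set
  InCone {m = m} a b = Σ (Fin m → ℚ) λ u → (∀ k → 0ℚ ≤ u k) × lincomb u a ≡ b

  InSpanOf : ∀ {n m} → (Fin m → Pt n) → Pt n → Set
  InSpanOf {m = m} a b = Σ (Fin m → ℚ) λ u → lincomb u a ≡ b

  dot-self-zero : ∀ {n} {x : Pt n} → x · x ≤ 0ℚ → x ≡ 0v
  dot-self-zero {n} {x} h = lookup-ext λ i → trans
    (square-zero (lookup x i) (sum-nonneg-≤0 n (λ i → square-nonneg (lookup x i)) h i))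
    (sym (lookup∘tabulate _ i))
    where
    square-zero : ∀ a → a * a ≡ 0ℚ → a ≡ 0ℚ
    square-zero a h with a ≟ 0ℚ
    ... | yes eq = eq
    ... | no neq = *-cancelˡ-≡0 neq h

  -- Bartl's proof: by induction on the number of vectors, projecting along the first one.
  farkas : ∀ {n} m (a : Fin m → Pt n) (b : Pt n) →
    InCone a b ⊎ Σ (Pt n) λ x → (∀ k → x · a k ≤ 0ℚ) × 0ℚ < x · b
  farkas zero a b with b · b ≤? 0ℚ
  ... | yes h = inj₁ ((λ ()) , (λ ()) , sym (dot-self-zero h))
  ... | no h = inj₂ (b , (λ ()) , ≰⇒> h)
  farkas (suc m) a b with farkas m (a ∘ suc) b
  ... | inj₁ (u , pos , eq) = inj₁ (prepend0 u , (λ { zero → ≤-refl ; (suc k) → pos k }) , trans (lincomb-prepend0 u a) eq)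
  ... | inj₂ (y , neg , pos) with y · a zero ≤? 0ℚ
  ... | yes h = inj₂ (y , (λ { zero → h ; (suc k) → neg k }) , pos)
  ... | no h with inverse-pos (≰⇒> h)
  -- The multiple `x = t *v y` takes the value 1 at `a zero`, so subtracting `x · v` times `a zero`
  -- from `v` projects onto the hyperplane where `x` vanishes.
  ... | t , t>0 , yt≡1 with farkas m (λ k → addmul (- ((t *v y) · a (suc k))) (a zero) (a (suc k)))
                                     (addmul (- ((t *v y) · b)) (a zero) b)
  ... | inj₁ (u , upos , eq) = inj₁ (u′ , pos′ , dot-ext combine)
    where
    open ≡-Reasoning
    x = t *v y
    u′ : Fin (suc m) → ℚ
    u′ zero = x · b - sumℚ m (λ k → u k * (x · a (suc k)))
    u′ (suc k) = u k
    x·b>0 : 0ℚ < x · b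
    x·b>0 = subst (0ℚ <_) (sym (*v-dot t y b)) (*-pos t>0 pos)
    x·a≤0 : ∀ k → 0ℚ ≤ - (x · a (suc k))
    x·a≤0 k = subst (0ℚ ≤_) (trans (move t (y · a (suc k))) (cong -_ (sym (*v-dot t y (a (suc k))))))
      (*-nonneg (<⇒≤ t>0) (neg-nonneg (neg k)))
      where
      move : ∀ a b → a * (- b) ≡ - (a * b)
      move = solve-∀ ℚ-ring
    pos′ : ∀ k → 0ℚ ≤ u′ k
    pos′ zero = +-nonneg (<⇒≤ x·b>0) (subst (0ℚ ≤_) (trans
      (sum-cong {f = λ k → u k * - (x · a (suc k))} {λ k → - 1ℚ * (u k * (x · a (suc k)))} (λ k → move (u k) (x · a (suc k))))
      (trans (sum-*ˡ m (- 1ℚ) (λ k → u k * (x · a (suc k)))) (-1*-≡- _)))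
      (sum-nonneg m (λ k → *-nonneg (upos k) (x·a≤0 k))))
      where
      move : ∀ a b → a * (- b) ≡ - 1ℚ * (a * b)
      move = solve-∀ ℚ-ring
    pos′ (suc k) = upos k
    combine : ∀ w → w · lincomb u′ a ≡ w · b
    combine w = begin
      w · lincomb u′ a
        ≡⟨ dot-lincomb w u′ a ⟩
      (x · b - A) * w₀ + W
        ≡⟨ regroup (x · b) A w₀ W ⟩
      (x · b) * w₀ + (- w₀ * A + W)
        ≡⟨ cong ((x · b) * w₀ +_) (sym projected) ⟩
      (x · b) * w₀ + (- (x · b) * w₀ + w · b)
        ≡⟨ cancel ((x · b) * w₀) (x · b) w₀ (w · b) refl ⟩
      w · b ∎
      where
      w₀ = w · a zero
      A = sumℚ m (λ k → u k * (x · a (suc k)))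
      W = sumℚ m (λ k → u k * (w · a (suc k)))
      regroup : ∀ p A w W → (p - A) * w + W ≡ p * w + (- w * A + W)
      regroup = solve-∀ ℚ-ring
      cancel′ : ∀ p w q → p * w + (- p * w + q) ≡ q
      cancel′ = solve-∀ ℚ-ring
      cancel : ∀ r p w q → r ≡ p * w → r + (- p * w + q) ≡ q
      cancel r p w q refl = cancel′ p w q
      expand : ∀ u x w v → u * (- x * w + v) ≡ - w * (u * x) + u * v
      expand = solve-∀ ℚ-ring
      projected : - (x · b) * w₀ + w · b ≡ - w₀ * A + W
      projected = begin
        - (x · b) * w₀ + w · b
          ≡⟨ sym (dot-addmul w (- (x · b)) (a zero) b) ⟩
        w · addmul (- (x · b)) (a zero) b
          ≡⟨ cong (w ·_) (sym eq) ⟩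
        w · lincomb u (λ k → addmul (- (x · a (suc k))) (a zero) (a (suc k)))
          ≡⟨ dot-lincomb w u (λ k → addmul (- (x · a (suc k))) (a zero) (a (suc k))) ⟩
        sumℚ m (λ k → u k * (w · addmul (- (x · a (suc k))) (a zero) (a (suc k))))
          ≡⟨ sum-cong (λ k → trans (cong (u k *_) (dot-addmul w (- (x · a (suc k))) (a zero) (a (suc k))))
               (expand (u k) (x · a (suc k)) w₀ (w · a (suc k)))) ⟩
        sumℚ m (λ k → - w₀ * (u k * (x · a (suc k))) + u k * (w · a (suc k)))
          ≡⟨ trans (sum-+ m _ _) (cong (_+ W) (sum-*ˡ m (- w₀) _)) ⟩
        - w₀ * A + W ∎
  ... | inj₂ (z , zneg , zpos) = inj₂ (z′ , z′neg , subst (0ℚ <_) (shift b) zpos)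
    where
    x = t *v y
    -- The adjoint of the projection: `z′` vanishes at `a zero` and takes at any `v` the value of
    -- `z` at the projection of `v`.
    z′ = addmul (- (z · a zero)) x z
    swap : ∀ p q r → - p * q + r ≡ - q * p + r
    swap = solve-∀ ℚ-ring
    shift : ∀ v → z · addmul (- (x · v)) (a zero) v ≡ z′ · v
    shift v = trans (dot-addmul z (- (x · v)) (a zero) v) (trans (swap (x · v) (z · a zero) (z · v))
      (sym (addmul-dot (- (z · a zero)) x z v)))
    z′neg : ∀ k → z′ · a k ≤ 0ℚ
    z′neg zero = ≤-reflexive (trans (addmul-dot (- (z · a zero)) x z (a zero))
      (trans (cong (λ s → - (z · a zero) * s + z · a zero)
        (trans (*v-dot t y (a zero)) (trans (*-comm t _) yt≡1))) (cancel (z · a zero))))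
      where
      cancel : ∀ p → - p * 1ℚ + p ≡ 0ℚ
      cancel = solve-∀ ℚ-ring
    z′neg (suc k) = subst (_≤ 0ℚ) (shift (a (suc k))) (zneg k)

  join : ∀ {n m m′} → (Fin m → Pt n) → (Fin m′ → Pt n) → Fin (m ℕ.+ m′) → Pt n
  join {m = m} a b k = [ a , b ]′ (splitAt m k)

  join-↑ˡ : ∀ {n m m′} (a : Fin m → Pt n) (b : Fin m′ → Pt n) k → join a b (k ↑ˡ m′) ≡ a k
  join-↑ˡ {m = m} {m′} a b k = cong [ a , b ]′ (splitAt-↑ˡ m k m′)

  join-↑ʳ : ∀ {n m m′} (a : Fin m → Pt n) (b : Fin m′ → Pt n) k → join a b (m ↑ʳ k) ≡ b k
  join-↑ʳ {m = m} {m′} a b k = cong [ a , b ]′ (splitAt-↑ʳ m m′ k)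

  lincomb-join : ∀ {n m m′} (c : Fin (m ℕ.+ m′) → ℚ) (a : Fin m → Pt n) (b : Fin m′ → Pt n) →
    lincomb c (join a b) ≡ addmul 1ℚ (lincomb (λ k → c (k ↑ˡ m′)) a) (lincomb (λ k → c (m ↑ʳ k)) b)
  lincomb-join {m = m} {m′} c a b = dot-ext λ w → begin
    w · lincomb c (join a b)
      ≡⟨ trans (dot-lincomb w c (join a b)) (sum-split m m′ _) ⟩
    sumℚ m (λ k → c (k ↑ˡ m′) * (w · join a b (k ↑ˡ m′))) + sumℚ m′ (λ k → c (m ↑ʳ k) * (w · join a b (m ↑ʳ k)))
      ≡⟨ cong₂ _+_
           (trans (sum-cong (λ k → cong (λ v → c (k ↑ˡ m′) * (w · v)) (join-↑ˡ a b k))) (sym (dot-lincomb w (λ k → c (k ↑ˡ m′)) a)))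
           (trans (sum-cong (λ k → cong (λ v → c (m ↑ʳ k) * (w · v)) (join-↑ʳ a b k))) (sym (dot-lincomb w (λ k → c (m ↑ʳ k)) b))) ⟩
    w · A + w · B
      ≡⟨ sym (trans (dot-addmul w 1ℚ A B) (cong (_+ w · B) (*-identityˡ (w · A)))) ⟩
    w · addmul 1ℚ A B ∎
    where
    open ≡-Reasoning
    A = lincomb (λ k → c (k ↑ˡ m′)) a
    B = lincomb (λ k → c (m ↑ʳ k)) b

  -- The cone over the vectors and their negatives is their linear span, and a functional that is
  -- nonpositive on all of them is zero on each. Besides being an alternative, this decides
  -- membership in a span.
  fredholm : ∀ {n} m (a : Fin m → Pt n) (b : Pt n) →
    InSpanOf a b ⊎ Σ (Pt n) λ x → (∀ k → x · a k ≡ 0ℚ) × 0ℚ < x · b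
  fredholm m a b with farkas (m ℕ.+ m) (join a (λ k → (- 1ℚ) *v a k)) b
  ... | inj₁ (u , _ , eq) = inj₁ ((λ k → - 1ℚ * u (m ↑ʳ k) + u (k ↑ˡ m)) , trans (lincomb-addmul (- 1ℚ) (λ k → u (m ↑ʳ k)) (λ k → u (k ↑ˡ m)) a)
    (trans (dot-ext λ w → trans (dot-addmul w (- 1ℚ) R L) (sym (trans (cong (w ·_) (lincomb-join u a (λ k → (- 1ℚ) *v a k)))
      (trans (dot-addmul w 1ℚ L R′) (trans (cong (λ v → 1ℚ * (w · L) + v) (flip w)) (swap (w · L) (w · R))))))) eq))
    where
    L = lincomb (λ k → u (k ↑ˡ m)) a
    R = lincomb (λ k → u (m ↑ʳ k)) a
    R′ = lincomb (λ k → u (m ↑ʳ k)) (λ k → (- 1ℚ) *v a k)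
    swap : ∀ l r → 1ℚ * l + - 1ℚ * r ≡ - 1ℚ * r + l
    swap = solve-∀ ℚ-ring
    move : ∀ c x → c * (- 1ℚ * x) ≡ - 1ℚ * (c * x)
    move = solve-∀ ℚ-ring
    flip : ∀ w → w · R′ ≡ - 1ℚ * (w · R)
    flip w = trans (dot-lincomb w (λ k → u (m ↑ʳ k)) (λ k → (- 1ℚ) *v a k)) (trans (sum-cong (λ k → trans
      (cong (u (m ↑ʳ k) *_) (dot-*v w (- 1ℚ) (a k))) (move (u (m ↑ʳ k)) (w · a k))))
      (trans (sum-*ˡ m (- 1ℚ) _) (cong (- 1ℚ *_) (sym (dot-lincomb w (λ k → u (m ↑ʳ k)) a)))))
  ... | inj₂ (x , neg , pos) = inj₂ (x , (λ k → ≤-antisym (subst (λ v → x · v ≤ 0ℚ) (join-↑ˡ a (λ k → (- 1ℚ) *v a k) k) (neg (k ↑ˡ m)))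
    (subst (0ℚ ≤_) (trans (cong -_ (dot-*v x (- 1ℚ) (a k))) (double (x · a k)))
      (neg-nonneg (subst (λ v → x · v ≤ 0ℚ) (join-↑ʳ a (λ k → (- 1ℚ) *v a k) k) (neg (m ↑ʳ k)))))) , pos)
    where
    double : ∀ a → - (- 1ℚ * a) ≡ a
    double = solve-∀ ℚ-ring

  -- Dual vertices

  -- Stands in for excluded middle over a finite index set; a failing index comes with its evidence.
  allOrSome : ∀ {m} {A B : Fin m → Set} → (∀ k → A k ⊎ B k) → (∀ k → A k) ⊎ Σ (Fin m) B
  allOrSome {zero} f = inj₁ λ ()
  allOrSome {suc m} f with f zero | allOrSome (f ∘ suc)
  ... | inj₂ b | _ = inj₂ (zero , b)
  ... | inj₁ _ | inj₂ (k , b) = inj₂ (suc k , b)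
  ... | inj₁ a | inj₁ as = inj₁ λ { zero → a ; (suc k) → as k }

  -- For `P` containing the origin and t ≥ 0 this is membership in t P, the origin absorbing the
  -- weight that is missing from `t`. At t = 0 only the origin is left, in accordance with the
  -- constant term 1 of the Ehrhart series.
  Dilate : ∀ {n} → Polytope n → ℚ → Pt n → Set
  Dilate P t x = Σ (Fin (m P) → ℚ) λ c → (∀ k → 0ℚ ≤ c k) × sumℚ (m P) c ≤ t × lincomb c (gens P) ≡ x

  dual-bound : ∀ {n} (P : Polytope n) {t x φ} → InDual P φ → Dilate P t x → φ · x ≤ t
  dual-bound P {t} {x} {φ} φ∈ (c , c≥0 , sum≤t , refl) = ≤-trans (≤-reflexive (dot-lincomb φ c (gens P)))
    (≤-trans (sum-mono (m P) (λ k → subst (c k * (φ · gens P k) ≤_) (*-identityʳ (c k)) (*-monoˡ (c≥0 k) (φ∈ k)))) sum≤t)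

  -- The extra generator (1 , 0) absorbs the slack in sum c ≤ t.
  homogenized : ∀ {n} (P : Polytope n) → Fin (suc (m P)) → Pt (suc n)
  homogenized P zero = 1ℚ ∷ 0v
  homogenized P (suc k) = 1ℚ ∷ gens P k

  -- The separating functional is returned with an unnormalized bound `s`, because `s` may be 0 when
  -- `x` lies outside the cone over `P`.
  dilate? : ∀ {n} (P : Polytope n) t x →
    Dilate P t x ⊎ Σ ℚ λ s → Σ (Pt n) λ φ → 0ℚ ≤ s × (∀ k → φ · gens P k ≤ s) × s * t < φ · x
  dilate? {n} P t x with farkas (suc (m P)) (homogenized P) (t ∷ x)
  ... | inj₁ (u , u≥0 , eq) = inj₁ (u ∘ suc , u≥0 ∘ suc , 0≤-⇒≤ (subst (0ℚ ≤_) first (u≥0 zero)) , dot-ext rest)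
    where
    pair : ∀ w₀ (w : Pt n) → (w₀ ∷ w) · lincomb u (homogenized P) ≡ w₀ * t + w · x
    pair w₀ w = cong ((w₀ ∷ w) ·_) eq
    S = sumℚ (m P) (u ∘ suc)
    first : u zero ≡ t - S
    first = -≡0⇒≡ (trans (isolate (u zero) t S) (trans (cong (_- t) (trans (sym value) (trans (pair 1ℚ 0v) (unit t))))
      (+-inverseʳ t)))
      where
      zero-dot : ∀ v → 0v {n} · v ≡ 0ℚ
      zero-dot v = trans (dot-comm 0v v) (dot-0v v)
      unit : ∀ t → 1ℚ * t + 0v · x ≡ t
      unit t = trans (cong (1ℚ * t +_) (zero-dot x)) (trans (+-identityʳ _) (*-identityˡ t))
      value : (1ℚ ∷ 0v) · lincomb u (homogenized P) ≡ u zero + S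
      value = trans (dot-lincomb (1ℚ ∷ 0v) u (homogenized P)) (sum-cong {f = λ k → u k * ((1ℚ ∷ 0v) · homogenized P k)}
        {g = u} λ { zero → trans (cong (λ z → u zero * (1ℚ * 1ℚ + z)) (zero-dot 0v)) (one (u zero))
                  ; (suc k) → trans (cong (λ z → u (suc k) * (1ℚ * 1ℚ + z)) (zero-dot (gens P k))) (one (u (suc k))) })
        where
        one : ∀ a → a * (1ℚ * 1ℚ + 0ℚ) ≡ a
        one = solve-∀ ℚ-ring
      isolate : ∀ a t s → a - (t - s) ≡ (a + s) - t
      isolate = solve-∀ ℚ-ring
    rest : ∀ w → w · lincomb (u ∘ suc) (gens P) ≡ w · x
    rest w = trans (dot-lincomb w (u ∘ suc) (gens P)) (trans (sym value) (trans (pair 0ℚ w)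
      (trans (cong (_+ w · x) (*-zeroˡ t)) (+-identityˡ (w · x)))))
      where
      value : (0ℚ ∷ w) · lincomb u (homogenized P) ≡ sumℚ (m P) (λ k → u (suc k) * (w · gens P k))
      value = trans (dot-lincomb (0ℚ ∷ w) u (homogenized P)) (trans (cong₂ _+_
        (trans (cong (λ z → u zero * (0ℚ * 1ℚ + z)) (dot-0v w)) (none (u zero)))
        (sum-cong {f = λ k → u (suc k) * (0ℚ * 1ℚ + w · gens P k)} (λ k → drop (u (suc k)) (w · gens P k)))) (+-identityˡ _))
        where
        none : ∀ a → a * (0ℚ * 1ℚ + 0ℚ) ≡ 0ℚ
        none = solve-∀ ℚ-ring
        drop : ∀ a b → a * (0ℚ * 1ℚ + b) ≡ a * b
        drop = solve-∀ ℚ-ring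
  ... | inj₂ (s ∷ φ , neg , pos) = inj₂ (- s , φ , neg-nonneg (subst (_≤ 0ℚ) (trans (cong (s * 1ℚ +_) (dot-0v φ)) (unit s)) (neg zero))
    , (λ k → 0≤-⇒≤ (subst (0ℚ ≤_) (isolate s (φ · gens P k)) (neg-nonneg (neg (suc k)))))
    , 0<-⇒< (subst (0ℚ <_) (isolate′ s t (φ · x)) pos))
    where
    unit : ∀ a → a * 1ℚ + 0ℚ ≡ a
    unit = solve-∀ ℚ-ring
    isolate : ∀ s p → - (s * 1ℚ + p) ≡ - s - p
    isolate = solve-∀ ℚ-ring
    isolate′ : ∀ s t p → s * t + p ≡ p - - s * t
    isolate′ = solve-∀ ℚ-ring

  χ : ∀ {m} → Vec Bool m → Fin m → ℚ
  χ T k = if lookup T k then 1ℚ else 0ℚ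

  χ-nonneg : ∀ {m} (T : Vec Bool m) k → 0ℚ ≤ χ T k
  χ-nonneg T k with lookup T k
  ... | true = <⇒≤ 0<1
  ... | false = ≤-refl

  χ-isInt : ∀ {m} (T : Vec Bool m) k → IsInt (χ T k)
  χ-isInt T k with lookup T k
  ... | true = ℤ.+ 1 , refl
  ... | false = ℤ.+ 0 , refl

  -- Generators outside `T` are replaced by zero instead of being removed, so every subfamily keeps
  -- the index set `Fin (m P)`.
  mask : ∀ {n} (P : Polytope n) → Vec Bool (m P) → Fin (m P) → Pt n
  mask P T k = χ T k *v gens P k

  tight : ∀ {n} (P : Polytope n) → Pt n → Vec Bool (m P)
  tight P φ = tabulate (λ k → does (φ · gens P k ≟ 1ℚ))

  -- An equation of this shape expresses that a functional is 1 on a set `T` of generators; it is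
  -- used in this form throughout, without a case distinction.
  χ-tight : ∀ {n} (P : Polytope n) φ k → χ (tight P φ) k * (φ · gens P k) ≡ χ (tight P φ) k
  χ-tight P φ k rewrite lookup∘tabulate (λ k → does (φ · gens P k ≟ 1ℚ)) k with φ · gens P k ≟ 1ℚ
  ... | yes eq = trans (*-identityˡ (φ · gens P k)) eq
  ... | no _ = *-zeroˡ (φ · gens P k)

  tight-χ : ∀ {n} (P : Polytope n) φ k → φ · gens P k ≡ 1ℚ → χ (tight P φ) k ≡ 1ℚ
  tight-χ P φ k eq rewrite lookup∘tabulate (λ k → does (φ · gens P k ≟ 1ℚ)) k with φ · gens P k ≟ 1ℚ
  ... | yes _ = refl
  ... | no neq = ⊥-elim (neq eq)

  tight-zero : ∀ {n} (P : Polytope n) φ d → (∀ k → d · mask P (tight P φ) k ≡ 0ℚ) →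
    ∀ k → φ · gens P k ≡ 1ℚ → d · gens P k ≡ 0ℚ
  tight-zero P φ d h k eq = trans (sym (*-identityˡ (d · gens P k))) (trans (cong (_* (d · gens P k)) (sym (tight-χ P φ k eq)))
    (trans (sym (dot-*v d (χ (tight P φ) k) (gens P k))) (h k)))

  Spanning : ∀ {n} (P : Polytope n) → Vec Bool (m P) → Set
  Spanning P T = ∀ k → InSpanOf (mask P T) (gens P k)

  spanning-agree : ∀ {n} (P : Polytope n) T → Spanning P T → ∀ y y′ →
    (∀ k → χ T k * (y · gens P k) ≡ χ T k * (y′ · gens P k)) → SameOnLin P y y′
  spanning-agree P T span y y′ h k with span k
  ... | u , eq = begin
    y · gens P k                                   ≡⟨ cong (y ·_) (sym eq) ⟩
    y · lincomb u (mask P T)                        ≡⟨ dot-lincomb y u (mask P T) ⟩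
    sumℚ (m P) (λ j → u j * (y · mask P T j))       ≡⟨ sum-cong (λ j → cong (u j *_) (trans (dot-*v y (χ T j) (gens P j))
                                                       (trans (h j) (sym (dot-*v y′ (χ T j) (gens P j)))))) ⟩
    sumℚ (m P) (λ j → u j * (y′ · mask P T j))      ≡⟨ sym (dot-lincomb y′ u (mask P T)) ⟩
    y′ · lincomb u (mask P T)                       ≡⟨ cong (y′ ·_) eq ⟩
    y′ · gens P k ∎
    where open ≡-Reasoning

  sameOnLin-span : ∀ {n} (P : Polytope n) {y y′ x} → SameOnLin P y y′ → InSpan P x → y · x ≡ y′ · x
  sameOnLin-span P {y} {y′} same (c , refl) = trans (dot-lincomb y c (gens P))
    (trans (sum-cong (λ k → cong (c k *_) (same k))) (sym (dot-lincomb y′ c (gens P))))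

  mean-tight : ∀ {a b} → a ≤ 1ℚ → b ≤ 1ℚ → 1ℚ ≡ ½ * (a + b) → a ≡ 1ℚ
  mean-tight {a} {b} a≤1 b≤1 eq = ≤-antisym a≤1 (0≤-⇒≤ (subst (0ℚ ≤_)
    (trans (move a b (½ * (a + b)) refl) (trans (cong (λ t → (a + 1ℚ) - (t + t)) (sym eq)) (shrink a))) (≤⇒0≤- b≤1)))
    where
    move′ : ∀ a b → 1ℚ - b ≡ (a + 1ℚ) - (½ * (a + b) + ½ * (a + b))
    move′ = solve-∀ ℚ-ring
    move : ∀ a b t → t ≡ ½ * (a + b) → 1ℚ - b ≡ (a + 1ℚ) - (t + t)
    move a b t refl = move′ a b
    shrink : ∀ a → (a + 1ℚ) - (1ℚ + 1ℚ) ≡ a - 1ℚ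
    shrink = solve-∀ ℚ-ring

  -- If `φ` is the midpoint of two points of the dual, both must be 1 wherever `φ` is, and these
  -- generators determine a functional on lin P.
  spanning⇒vertex : ∀ {n} (P : Polytope n) φ → InDual P φ → Spanning P (tight P φ) → IsDualVertex P φ
  spanning⇒vertex P φ φ∈ span = φ∈ , λ y₁ y₂ y₁∈ y₂∈ mean → spanning-agree P (tight P φ) span y₁ y₂ λ k →
    trans (at-one y₁ y₂ y₁∈ y₂∈ mean k)
      (sym (at-one y₂ y₁ y₂∈ y₁∈ (λ k → trans (mean k) (cong (½ *_) (+-comm (y₁ · gens P k) (y₂ · gens P k)))) k))
    where
    at-one : ∀ y y′ → InDual P y → InDual P y′ → (∀ k → φ · gens P k ≡ ½ * (y · gens P k + y′ · gens P k)) →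
      ∀ k → χ (tight P φ) k * (y · gens P k) ≡ χ (tight P φ) k
    at-one y y′ y∈ y′∈ mean k rewrite lookup∘tabulate (λ k → does (φ · gens P k ≟ 1ℚ)) k with φ · gens P k ≟ 1ℚ
    ... | yes eq = trans (*-identityˡ (y · gens P k)) (mean-tight (y∈ k) (y′∈ k) (trans (sym eq) (mean k)))
    ... | no _ = *-zeroˡ (y · gens P k)

  shrink-step : ∀ {ε ε′ u v} → 0ℚ ≤ ε′ → ε′ ≤ ε → 0ℚ ≤ u → ε * v ≤ u → ε′ * v ≤ u
  shrink-step {ε} {ε′} {u} {v} p q r h with ≤-total 0ℚ v
  ... | inj₁ 0≤v = ≤-trans (subst₂ _≤_ (*-comm v ε′) (*-comm v ε) (*-monoˡ 0≤v q)) h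
  ... | inj₂ v≤0 = ≤-trans (subst (ε′ * v ≤_) (*-zeroʳ ε′) (*-monoˡ p v≤0)) r

  -- The ratio test of the simplex method, for slacks `u` and rates `v`: either no constraint ever
  -- blocks, or the largest admissible step comes with a constraint that it exhausts.
  ratio-test : ∀ m (u v : Fin m → ℚ) → (∀ k → 0ℚ ≤ u k) → (∀ k → v k ≤ 0ℚ) ⊎
    Σ ℚ λ ε → 0ℚ ≤ ε × (∀ k → ε * v k ≤ u k) × Σ (Fin m) λ k → 0ℚ < v k × ε * v k ≡ u k
  ratio-test zero u v u≥0 = inj₁ λ ()
  ratio-test (suc m) u v u≥0 with v zero ≤? 0ℚ | ratio-test m (u ∘ suc) (v ∘ suc) (u≥0 ∘ suc)
  ... | yes v₀≤0 | inj₁ v≤0 = inj₁ λ { zero → v₀≤0 ; (suc k) → v≤0 k }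
  ... | yes v₀≤0 | inj₂ (ε , ε≥0 , bound , k , pos , eq) = inj₂ (ε , ε≥0
    , (λ { zero → ≤-trans (subst (ε * v zero ≤_) (*-zeroʳ ε) (*-monoˡ ε≥0 v₀≤0)) (u≥0 zero) ; (suc j) → bound j })
    , suc k , pos , eq)
  ... | no v₀≰0 | tail with inverse-pos (≰⇒> v₀≰0)
  ... | t , t>0 , v₀t≡1 = choose tail
    where
    ε₀ = t * u zero
    ε₀≥0 : 0ℚ ≤ ε₀
    ε₀≥0 = *-nonneg (<⇒≤ t>0) (u≥0 zero)
    ε₀-eq : ε₀ * v zero ≡ u zero
    ε₀-eq = trans (rotate t (u zero) (v zero)) (trans (cong (_* u zero) v₀t≡1) (*-identityˡ (u zero)))
      where
      rotate : ∀ t u v → t * u * v ≡ v * t * u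
      rotate = solve-∀ ℚ-ring
    choose : _ → _
    choose (inj₁ v≤0) = inj₂ (ε₀ , ε₀≥0
      , (λ { zero → ≤-reflexive ε₀-eq
           ; (suc k) → ≤-trans (subst (ε₀ * v (suc k) ≤_) (*-zeroʳ ε₀) (*-monoˡ ε₀≥0 (v≤0 k))) (u≥0 (suc k)) })
      , zero , ≰⇒> v₀≰0 , ε₀-eq)
    choose (inj₂ (ε , ε≥0 , bound , k , pos , eq)) with ≤-total ε ε₀
    ... | inj₁ ε≤ε₀ = inj₂ (ε , ε≥0
      , (λ { zero → shrink-step ε≥0 ε≤ε₀ (u≥0 zero) (≤-reflexive ε₀-eq) ; (suc j) → bound j }) , suc k , pos , eq)
    ... | inj₂ ε₀≤ε = inj₂ (ε₀ , ε₀≥0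
      , (λ { zero → ≤-reflexive ε₀-eq ; (suc j) → shrink-step ε₀≥0 ε₀≤ε (u≥0 (suc j)) (bound j) })
      , zero , ≰⇒> v₀≰0 , ε₀-eq)

  small-step : ∀ m (u v : Fin m → ℚ) → (∀ k → 0ℚ ≤ u k) → (∀ k → 0ℚ < v k → u k ≢ 0ℚ) →
    Σ ℚ λ ε → 0ℚ < ε × (∀ k → ε * v k ≤ u k)
  small-step m u v u≥0 sep with ratio-test m u v u≥0
  ... | inj₁ v≤0 = 1ℚ , 0<1 , λ k → ≤-trans (≤-reflexive (*-identityˡ (v k))) (≤-trans (v≤0 k) (u≥0 k))
  ... | inj₂ (ε , ε≥0 , bound , k , pos , eq) = ε , ≤∧≢⇒< ε≥0
    (λ { refl → sep k pos (trans (sym eq) (*-zeroˡ (v k))) }) , bound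

  two-sided-step : ∀ m (u v : Fin m → ℚ) → (∀ k → 0ℚ ≤ u k) → (∀ k → u k ≡ 0ℚ → v k ≡ 0ℚ) →
    Σ ℚ λ ε → 0ℚ < ε × (∀ k → ε * v k ≤ u k) × (∀ k → ε * - v k ≤ u k)
  two-sided-step m u v u≥0 at-zero
    with small-step m u v u≥0 (λ j pos h → <-irrefl (sym (at-zero j h)) pos)
       | small-step m u (λ j → - v j) u≥0 (λ j pos h → <-irrefl (sym (cong -_ (at-zero j h))) pos)
  ... | ε₁ , p₁ , b₁ | ε₂ , p₂ , b₂ with ≤-total ε₁ ε₂
  ...   | inj₁ le = ε₁ , p₁ , b₁ , λ j → shrink-step (<⇒≤ p₁) le (u≥0 j) (b₂ j)
  ...   | inj₂ le = ε₂ , p₂ , (λ j → shrink-step (<⇒≤ p₂) le (u≥0 j) (b₁ j)) , b₂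

  -- The functionals `y + ε d` and `y - ε d` lie in the dual and have midpoint `y`, so they agree on
  -- lin P.
  vertex-rigid : ∀ {n} (P : Polytope n) y → IsDualVertex P y → ∀ d ε → 0ℚ < ε →
    (∀ j → ε * (d · gens P j) ≤ 1ℚ - y · gens P j) → (∀ j → ε * - (d · gens P j) ≤ 1ℚ - y · gens P j) →
    ∀ k → d · gens P k ≡ 0ℚ
  vertex-rigid P y (y∈ , extreme) d ε ε>0 up down k = *-cancelˡ-≡0 (λ h → <-irrefl (sym h) ε>0)
    (trans (difference (y · gens P k) ε (d · gens P k))
      (trans (cong (½ *_) (trans (cong₂ _-_ (sym (y₁-value k)) (sym (y₂-value k)))
        (trans (cong (_- y₂ · gens P k) (extreme y₁ y₂ y₁∈ y₂∈ mean k)) (+-inverseʳ (y₂ · gens P k))))) (*-zeroʳ ½)))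
    where
    y₁ = addmul ε d y
    y₂ = addmul (- ε) d y
    y₁-value : ∀ j → y₁ · gens P j ≡ ε * (d · gens P j) + y · gens P j
    y₁-value j = addmul-dot ε d y (gens P j)
    y₂-value : ∀ j → y₂ · gens P j ≡ - ε * (d · gens P j) + y · gens P j
    y₂-value j = addmul-dot (- ε) d y (gens P j)
    difference : ∀ a e v → e * v ≡ ½ * ((e * v + a) - (- e * v + a))
    difference = solve-∀ ℚ-ring
    average : ∀ a e v → a ≡ ½ * ((e * v + a) + (- e * v + a))
    average = solve-∀ ℚ-ring
    regroup₁ : ∀ a b → (1ℚ - a) - b ≡ 1ℚ - (b + a)
    regroup₁ = solve-∀ ℚ-ring
    regroup₂ : ∀ a e v → (1ℚ - a) - e * - v ≡ 1ℚ - (- e * v + a)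
    regroup₂ = solve-∀ ℚ-ring
    y₁∈ : InDual P y₁
    y₁∈ j = 0≤-⇒≤ (subst (0ℚ ≤_) (trans (regroup₁ (y · gens P j) (ε * (d · gens P j))) (cong (λ t → 1ℚ - t) (sym (y₁-value j))))
      (≤⇒0≤- (up j)))
    y₂∈ : InDual P y₂
    y₂∈ j = 0≤-⇒≤ (subst (0ℚ ≤_) (trans (regroup₂ (y · gens P j) ε (d · gens P j)) (cong (λ t → 1ℚ - t) (sym (y₂-value j))))
      (≤⇒0≤- (down j)))
    mean : ∀ j → y · gens P j ≡ ½ * (y₁ · gens P j + y₂ · gens P j)
    mean j = trans (average (y · gens P j) ε (d · gens P j)) (cong (½ *_) (sym (cong₂ _+_ (y₁-value j) (y₂-value j))))

  -- Otherwise some `d` vanishes on the tight generators but not on all. The remaining generators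
  -- have positive slack, so small steps along `d` in both directions stay in the dual, against
  -- rigidity.
  vertex⇒spanning : ∀ {n} (P : Polytope n) y → IsDualVertex P y → Spanning P (tight P y)
  vertex⇒spanning P y vertex k = fromInj₁ impossible (fredholm (m P) (mask P (tight P y)) (gens P k))
    where
    impossible : Σ (Pt _) (λ d → (∀ j → d · mask P (tight P y) j ≡ 0ℚ) × 0ℚ < d · gens P k) →
      InSpanOf (mask P (tight P y)) (gens P k)
    impossible (d , d⊥ , d>0) =
      let (ε , ε>0 , up , down) = two-sided-step (m P) (λ j → 1ℚ - y · gens P j) (λ j → d · gens P j)
            (λ j → ≤⇒0≤- (proj₁ vertex j)) (λ j h → tight-zero P y d d⊥ j (sym (-≡0⇒≡ h)))
      in ⊥-elim (<-irrefl (sym (vertex-rigid P y vertex d ε ε>0 up down k)) d>0)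

  -- The number of generators that are not tight, which decreases along the ascent in `toVertex`.
  slackCount : ∀ m → (Fin m → ℚ) → ℕ
  slackCount zero p = 0
  slackCount (suc m) p with p zero ≟ 1ℚ
  ... | yes _ = slackCount m (p ∘ suc)
  ... | no _ = suc (slackCount m (p ∘ suc))

  slackCount-≤ : ∀ m (p q : Fin m → ℚ) → (∀ k → p k ≡ 1ℚ → q k ≡ 1ℚ) → slackCount m q ℕ.≤ slackCount m p
  slackCount-≤ zero p q h = ℕ.z≤n
  slackCount-≤ (suc m) p q h with p zero ≟ 1ℚ | q zero ≟ 1ℚ
  ... | yes _ | yes _ = slackCount-≤ m (p ∘ suc) (q ∘ suc) (h ∘ suc)
  ... | yes a | no b = ⊥-elim (b (h zero a))
  ... | no _ | yes _ = ℕₚ.m≤n⇒m≤1+n (slackCount-≤ m (p ∘ suc) (q ∘ suc) (h ∘ suc))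
  ... | no _ | no _ = ℕ.s≤s (slackCount-≤ m (p ∘ suc) (q ∘ suc) (h ∘ suc))

  slackCount-< : ∀ m (p q : Fin m → ℚ) → (∀ k → p k ≡ 1ℚ → q k ≡ 1ℚ) →
    ∀ k → p k ≢ 1ℚ → q k ≡ 1ℚ → slackCount m q ℕ.< slackCount m p
  slackCount-< (suc m) p q h zero p≢1 q≡1 with p zero ≟ 1ℚ | q zero ≟ 1ℚ
  ... | yes a | _ = ⊥-elim (p≢1 a)
  ... | no _ | no b = ⊥-elim (b q≡1)
  ... | no _ | yes _ = ℕ.s≤s (slackCount-≤ m (p ∘ suc) (q ∘ suc) (h ∘ suc))
  slackCount-< (suc m) p q h (suc k) p≢1 q≡1 with p zero ≟ 1ℚ | q zero ≟ 1ℚ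
  ... | yes _ | yes _ = slackCount-< m (p ∘ suc) (q ∘ suc) (h ∘ suc) k p≢1 q≡1
  ... | yes a | no b = ⊥-elim (b (h zero a))
  ... | no _ | yes _ = ℕₚ.m≤n⇒m≤1+n (slackCount-< m (p ∘ suc) (q ∘ suc) (h ∘ suc) k p≢1 q≡1)
  ... | no _ | no _ = ℕ.s≤s (slackCount-< m (p ∘ suc) (q ∘ suc) (h ∘ suc) k p≢1 q≡1)

  cone-positive : ∀ {n} (P : Polytope n) {x} d → InCone (gens P) x → 0ℚ < d · x → Σ (Fin (m P)) λ k → 0ℚ < d · gens P k
  cone-positive P d (c , c≥0 , refl) pos = [ (λ neg → ⊥-elim (<-irrefl refl (<-≤-trans pos (nonpos neg)))) , id ]′
    (allOrSome (λ k → sign? (d · gens P k)))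
    where
    sign? : ∀ q → q ≤ 0ℚ ⊎ 0ℚ < q
    sign? q with q ≤? 0ℚ
    ... | yes h = inj₁ h
    ... | no h = inj₂ (≰⇒> h)
    nonpos : (∀ k → d · gens P k ≤ 0ℚ) → d · lincomb c (gens P) ≤ 0ℚ
    nonpos neg = ≤-trans (≤-reflexive (dot-lincomb d c (gens P)))
      (≤-trans (sum-mono (m P) (λ k → *-monoˡ (c≥0 k) (neg k)))
        (≤-reflexive (sum-zero (m P) (λ k → *-zeroʳ (c k)))))

  AscentDirection : ∀ {n} (P : Polytope n) → Pt n → Pt n → Set
  AscentDirection {n} P x φ = Σ (Pt n) λ d → (∀ k → φ · gens P k ≡ 1ℚ → d · gens P k ≡ 0ℚ) ×
    0ℚ ≤ d · x × Σ (Fin (m P)) λ k → 0ℚ < d · gens P k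

  -- A direction that is negative at `x` is reversed. It is then positive at `x`, and as `x` lies in
  -- the cone of the generators, also at one of them; that generator keeps the ascent from running
  -- off to infinity.
  orient : ∀ {n} (P : Polytope n) x φ → InCone (gens P) x → ∀ d →
    (∀ k → φ · gens P k ≡ 1ℚ → d · gens P k ≡ 0ℚ) → ∀ k → 0ℚ < d · gens P k → AscentDirection P x φ
  orient P x φ x∈ d d⊥ k pos = [ (λ h → d , d⊥ , h , k , pos) , reversed ]′ (sign? (d · x))
    where
    sign? : ∀ q → 0ℚ ≤ q ⊎ q < 0ℚ
    sign? q with 0ℚ ≤? q
    ... | yes h = inj₁ h
    ... | no h = inj₂ (≰⇒> h)
    reversed : d · x < 0ℚ → AscentDirection P x φ
    reversed h = d′ , (λ j eq → trans (*v-dot (- 1ℚ) d (gens P j)) (trans (cong (- 1ℚ *_) (d⊥ j eq)) (*-zeroʳ (- 1ℚ))))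
      , <⇒≤ pos′ , cone-positive P d′ x∈ pos′
      where
      d′ = (- 1ℚ) *v d
      pos′ : 0ℚ < d′ · x
      pos′ = subst (0ℚ <_) (sym (trans (*v-dot (- 1ℚ) d x) (-1*-≡- (d · x)))) (neg-pos′ h)

  -- The step length comes from the ratio test applied to the slacks; generators already tight stay
  -- so because `d` vanishes on them.
  ascend : ∀ {n} (P : Polytope n) x φ → InDual P φ → AscentDirection P x φ →
    Σ (Pt n) λ ψ → InDual P ψ × φ · x ≤ ψ · x × (∀ k → φ · gens P k ≡ 1ℚ → ψ · gens P k ≡ 1ℚ) ×
      Σ (Fin (m P)) λ k → φ · gens P k ≢ 1ℚ × ψ · gens P k ≡ 1ℚ
  ascend {n} P x φ φ∈ (d , d⊥ , d·x≥0 , j , pos) =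
    [ (λ neg → ⊥-elim (<-irrefl refl (<-≤-trans pos (neg j)))) , move ]′
    (ratio-test (m P) (λ k → 1ℚ - φ · gens P k) (λ k → d · gens P k) (λ k → ≤⇒0≤- (φ∈ k)))
    where
    move : Σ ℚ (λ ε → 0ℚ ≤ ε × (∀ k → ε * (d · gens P k) ≤ 1ℚ - φ · gens P k) × Σ (Fin (m P)) λ k →
           0ℚ < d · gens P k × ε * (d · gens P k) ≡ 1ℚ - φ · gens P k) →
      Σ (Pt n) λ ψ → InDual P ψ × φ · x ≤ ψ · x × (∀ k → φ · gens P k ≡ 1ℚ → ψ · gens P k ≡ 1ℚ) ×
        Σ (Fin (m P)) λ k → φ · gens P k ≢ 1ℚ × ψ · gens P k ≡ 1ℚ
    move (ε , ε≥0 , bound , k , k-pos , k-eq) = ψ , ψ∈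
      , subst₂ _≤_ (+-identityˡ (φ · x)) (sym (addmul-dot ε d φ x)) (+-monoˡ-≤ (φ · x) (*-nonneg ε≥0 d·x≥0))
      , (λ i eq → trans (value i) (trans (cong (λ t → ε * t + φ · gens P i) (d⊥ i eq))
          (trans (cong (_+ φ · gens P i) (*-zeroʳ ε)) (trans (+-identityˡ (φ · gens P i)) eq))))
      , k , (λ eq → <-irrefl (sym (d⊥ k eq)) k-pos)
      , trans (value k) (trans (cong (_+ φ · gens P k) k-eq) (cancel 1ℚ (φ · gens P k)))
      where
      ψ = addmul ε d φ
      value : ∀ i → ψ · gens P i ≡ ε * (d · gens P i) + φ · gens P i
      value i = addmul-dot ε d φ (gens P i)
      cancel : ∀ a b → (a - b) + b ≡ a
      cancel = solve-∀ ℚ-ring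
      ψ∈ : InDual P ψ
      ψ∈ i = subst₂ _≤_ (sym (value i)) (cancel 1ℚ (φ · gens P i)) (+-monoˡ-≤ (φ · gens P i) (bound i))

  -- The dual may be unbounded, but not in a direction that increases the value at `x`, since `x`
  -- lies in the cone over `P`. Each ascent makes another generator tight, so `N` suffices as fuel;
  -- the ascent ends when the tight generators span.
  toVertex : ∀ {n} (P : Polytope n) x → InCone (gens P) x → ∀ N φ → InDual P φ →
    slackCount (m P) (λ k → φ · gens P k) ℕ.≤ N → Σ (Pt n) λ ψ → IsDualVertex P ψ × φ · x ≤ ψ · x
  toVertex {n} P x x∈ N φ φ∈ count = [ (λ span → φ , spanning⇒vertex P φ φ∈ span , ≤-refl) , climb N count ]′
    (allOrSome (λ k → fredholm (m P) (mask P (tight P φ)) (gens P k)))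
    where
    climb : ∀ N → slackCount (m P) (λ k → φ · gens P k) ℕ.≤ N →
      Σ (Fin (m P)) (λ k → Σ (Pt n) λ d → (∀ j → d · mask P (tight P φ) j ≡ 0ℚ) × 0ℚ < d · gens P k) →
      Σ (Pt n) λ ψ → IsDualVertex P ψ × φ · x ≤ ψ · x
    climb N count (k , d , d⊥ , pos) =
      let (ψ , ψ∈ , le , keep , j , slack , hit) = ascend P x φ φ∈ (orient P x φ x∈ d (tight-zero P φ d d⊥) k pos)
          less = ℕₚ.<-≤-trans (slackCount-< (m P) (λ k → φ · gens P k) (λ k → ψ · gens P k) keep j slack hit) count
      in continue N ψ ψ∈ le less
      where
      continue : ∀ N ψ → InDual P ψ → φ · x ≤ ψ · x → slackCount (m P) (λ k → ψ · gens P k) ℕ.< N →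
        Σ (Pt n) λ ψ → IsDualVertex P ψ × φ · x ≤ ψ · x
      continue (suc N) ψ ψ∈ le (ℕ.s≤s less) =
        let (ψ′ , vertex , le′) = toVertex P x x∈ N ψ ψ∈ less in ψ′ , vertex , ≤-trans le le′

  dilate⇒cone : ∀ {n} (P : Polytope n) {t x} → Dilate P t x → InCone (gens P) x
  dilate⇒cone P (c , c≥0 , _ , eq) = c , c≥0 , eq

  -- Were `z` outside k P, a separating functional would, once normalized and moved to a dual vertex
  -- `ψ`, satisfy k < ψ · z ≤ t < k + 1, although `ψ · z` is an integer.
  floor-dilate : ∀ {n} (P : Polytope n) → DualIsLattice P → ∀ (z : LPt n) t k → Dilate P t (toℚv z) →
    t < ℕtoℚ (suc k) → Dilate P (ℕtoℚ k) (toℚv z)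
  floor-dilate {n} P lattice z t k z∈ t<1+k = fromInj₁ (⊥-elim ∘ separated) (dilate? P (ℕtoℚ k) (toℚv z))
    where
    no-integer : ∀ (ψ : Pt n) → IsDualVertex P ψ → ℕtoℚ k < ψ · toℚv z → ⊥
    no-integer ψ vertex k<ψz =
      let (j , eq) = isInt-nonneg (lattice ψ vertex z (proj₁ z∈ , proj₂ (proj₂ (proj₂ z∈))))
                       (≤-trans (ℕtoℚ-nonneg k) (<⇒≤ k<ψz))
      in ℕₚ.<⇒≱ (ℕtoℚ-cancel-< (subst (ℕtoℚ k <_) eq k<ψz))
           (ℕ.s≤s⁻¹ (ℕtoℚ-cancel-< (≤-<-trans (subst (_≤ t) eq (dual-bound P {φ = ψ} (proj₁ vertex) z∈)) t<1+k)))
    separated : Σ ℚ (λ s → Σ (Pt n) λ φ → 0ℚ ≤ s × (∀ k → φ · gens P k ≤ s) × s * ℕtoℚ k < φ · toℚv z) → ⊥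
    separated (s , φ , s≥0 , bound , lt) = [ recession , proper ]′ (zero? s s≥0)
      where
      zero? : ∀ s → 0ℚ ≤ s → s ≡ 0ℚ ⊎ 0ℚ < s
      zero? s h with s ≟ 0ℚ
      ... | yes eq = inj₁ eq
      ... | no neq = inj₂ (≤∧≢⇒< h (neq ∘ sym))
      -- With bound 0 there is nothing to normalize, but a functional nonpositive on the generators
      -- cannot be positive at `z`, which lies in their cone.
      recession : s ≡ 0ℚ → ⊥
      recession s≡0 =
        let (j , pos) = cone-positive P φ (dilate⇒cone P z∈)
              (subst (_< φ · toℚv z) (trans (cong (_* ℕtoℚ k) s≡0) (*-zeroˡ (ℕtoℚ k))) lt)
        in <-irrefl refl (<-≤-trans pos (subst (φ · gens P j ≤_) s≡0 (bound j)))
      proper : 0ℚ < s → ⊥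
      proper s>0 =
        let (r , r>0 , sr≡1) = inverse-pos s>0
            φ₀ = r *v φ
            φ₀∈ = λ j → subst₂ _≤_ (sym (*v-dot r φ (gens P j))) (trans (*-comm r s) sr≡1) (*-monoˡ (<⇒≤ r>0) (bound j))
            (ψ , vertex , le) = toVertex P (toℚv z) (dilate⇒cone P z∈) _ φ₀ φ₀∈ ℕₚ.≤-refl
            k<φ₀z = subst₂ _<_ (trans (sym (*-assoc r s (ℕtoℚ k))) (trans (cong (_* ℕtoℚ k) (trans (*-comm r s) sr≡1)) (*-identityˡ (ℕtoℚ k))))
                      (sym (*v-dot r φ (toℚv z))) (*-monoʳ-<-pos r {{positive r>0}} lt)
        in no-integer ψ vertex (<-≤-trans k<φ₀z le)

  -- Deciding whether the dual is a lattice polyhedron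

  toLPt : ∀ {n} (x : Pt n) → (∀ i → IsInt (lookup x i)) → Σ (LPt n) λ z → toℚv z ≡ x
  toLPt x h = tabulate (proj₁ ∘ h) , lookup-ext (λ i → trans (lookup-map i ℤtoℚ (tabulate (proj₁ ∘ h)))
    (trans (cong ℤtoℚ (lookup∘tabulate (proj₁ ∘ h) i)) (sym (proj₂ (h i)))))

  toℚv-isInt : ∀ {n} (z : LPt n) i → IsInt (lookup (toℚv z) i)
  toℚv-isInt z i = lookup z i , lookup-map i ℤtoℚ z

  common-multiple : ∀ m (A : Fin m → ℕ → Set) → (∀ k M N → A k N → A k (M ℕ.* N)) →
    (∀ k → Σ ℕ λ N → 1 ℕ.≤ N × A k N) → Σ ℕ λ N → 1 ℕ.≤ N × ∀ k → A k N
  common-multiple zero A mult f = 1 , ℕₚ.≤-refl , λ ()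
  common-multiple (suc m) A mult f =
    let (M , M≥1 , a) = f zero
        (N , N≥1 , as) = common-multiple m (A ∘ suc) (mult ∘ suc) (f ∘ suc)
    in N ℕ.* M , ℕₚ.*-mono-≤ N≥1 M≥1
     , λ { zero → mult zero N M a ; (suc k) → subst (A (suc k)) (ℕₚ.*-comm M N) (mult (suc k) M N (as k)) }

  common-denominator : ∀ {n m} (v : Fin m → Pt n) → Σ ℕ λ N → 1 ℕ.≤ N × ∀ k i → IsInt (ℕtoℚ N * lookup (v k) i)
  common-denominator {n} {m} v = common-multiple m _ (λ k M N h i → multiple M N (lookup (v k) i) (h i)) λ k →
    common-multiple n (λ i N → IsInt (ℕtoℚ N * lookup (v k) i)) (λ i M N → multiple M N (lookup (v k) i))
      (λ i → ↧ₙ lookup (v k) i , ℕ.s≤s ℕ.z≤n , denominator-clears (lookup (v k) i))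
    where
    multiple : ∀ M N q → IsInt (ℕtoℚ N * q) → IsInt (ℕtoℚ (M ℕ.* N) * q)
    multiple M N q h = subst IsInt (sym (trans (cong (_* q) (ℕtoℚ-* M N)) (*-assoc (ℕtoℚ M) (ℕtoℚ N) q)))
      (isInt-* (ℕtoℚ-isInt M) h)

  common-bound : ∀ m (c : Fin m → ℚ) → Σ ℕ λ M → ∀ k → 0ℚ ≤ c k + ℕtoℚ M
  common-bound zero c = 0 , λ ()
  common-bound (suc m) c =
    let (M , h) = single (c zero)
        (N , hs) = common-bound m (c ∘ suc)
    in M ℕ.+ N , λ { zero → enlarge (c zero) M (M ℕ.+ N) (ℕₚ.m≤m+n M N) h
                   ; (suc k) → enlarge (c (suc k)) N (M ℕ.+ N) (ℕₚ.m≤n+m N M) (hs k) }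
    where
    enlarge : ∀ q M N → M ℕ.≤ N → 0ℚ ≤ q + ℕtoℚ M → 0ℚ ≤ q + ℕtoℚ N
    enlarge q M N le h = ≤-trans h (+-monoʳ-≤ q (ℕtoℚ-mono le))
    single : ∀ q → Σ ℕ λ M → 0ℚ ≤ q + ℕtoℚ M
    single q with 0ℚ ≤? q
    ... | yes h = 0 , +-nonneg h (ℕtoℚ-nonneg 0)
    ... | no h = let (k , _ , lt) = floorℕ (- q) (neg-nonneg (<⇒≤ (≰⇒> h)))
                 in suc k , subst (0ℚ ≤_) (flip (ℕtoℚ (suc k)) q) (≤⇒0≤- (<⇒≤ lt))
      where
      flip : ∀ a q → a - - q ≡ q + a
      flip = solve-∀ ℚ-ring

  -- The functional φ certifies that sum c is the gauge of P at z, the least t with z ∈ t P.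
  record NonIntegralGauge {n} (P : Polytope n) : Set where
    field
      φ : Pt n
      φ∈ : InDual P φ
      z : LPt n
      c : Fin (m P) → ℚ
      c≥0 : ∀ k → 0ℚ ≤ c k
      z-eq : lincomb c (gens P) ≡ toℚv z
      gauge : sumℚ (m P) c ≡ φ · toℚv z
      nonintegral : ¬ IsInt (sumℚ (m P) c)

  -- Adding a large lattice multiple of the tight generators moves z into the cone they span.
  nonIntegralGauge : ∀ {n} (P : Polytope n) T φ → (∀ k → χ T k * (φ · gens P k) ≡ χ T k) → InDual P φ →
    Spanning P T → ∀ z → InSpan P (toℚv z) → ¬ IsInt (φ · toℚv z) → NonIntegralGauge P
  nonIntegralGauge {n} P T φ φT φ∈ span z (d , d-eq) nonint = record
    { φ = φ ; φ∈ = φ∈ ; z = proj₁ lattice ; c = c′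
    ; c≥0 = λ k → *-nonneg (χ-nonneg T k) (c′≥0 k)
    ; z-eq = sym (proj₂ lattice)
    ; gauge = trans (sym (trans (dot-lincomb φ c′ (gens P)) (sum-cong (λ k → trans (*-rotate (χ T k) (c k + ℕtoℚ K) (φ · gens P k))
        (trans (cong ((c k + ℕtoℚ K) *_) (φT k)) (*-comm (c k + ℕtoℚ K) (χ T k))))))) (cong (φ ·_) (sym (proj₂ lattice)))
    ; nonintegral = λ h → nonint (subst IsInt (sym φz) (isInt-+ h (isInt-neg (isInt-* (ℕtoℚ-isInt K) (isInt-sum (m P) (χ-isInt T)))))) }
    where
    c : Fin (m P) → ℚ
    c j = sumℚ (m P) (λ k → d k * proj₁ (span k) j)
    z-mask : toℚv z ≡ lincomb c (mask P T)
    z-mask = trans (sym d-eq) (trans (lincomb-cong {c = d} (λ _ → refl) (λ k → sym (proj₂ (span k))))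
      (lincomb-lincomb d (λ k → proj₁ (span k)) (mask P T)))
    N = proj₁ (common-denominator (gens P))
    N≥1 = proj₁ (proj₂ (common-denominator (gens P)))
    N-clears = proj₂ (proj₂ (common-denominator (gens P)))
    M = proj₁ (common-bound (m P) c)
    -- `N` turns all generators into lattice vectors, and `M`, which is at most `K`, makes all
    -- coefficients nonnegative.
    K = M ℕ.* N
    c′ : Fin (m P) → ℚ
    c′ k = χ T k * (c k + ℕtoℚ K)
    c′≥0 : ∀ k → 0ℚ ≤ c k + ℕtoℚ K
    c′≥0 k = ≤-trans (proj₂ (common-bound (m P) c) k)
      (+-monoʳ-≤ (c k) (ℕtoℚ-mono (subst (ℕ._≤ K) (ℕₚ.*-identityʳ M) (ℕₚ.*-monoʳ-≤ M N≥1))))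
    coordinate : ∀ i → lookup (lincomb c′ (gens P)) i ≡
      lookup (toℚv z) i + sumℚ (m P) (λ k → χ T k * (ℕtoℚ M * (ℕtoℚ N * lookup (gens P k) i)))
    coordinate i = begin
      lookup (lincomb c′ (gens P)) i
        ≡⟨ lookup∘tabulate _ i ⟩
      sumℚ (m P) (λ k → χ T k * (c k + ℕtoℚ K) * lookup (gens P k) i)
        ≡⟨ sum-cong (λ k → trans (cong (λ t → χ T k * (c k + t) * lookup (gens P k) i) (ℕtoℚ-* M N))
             (expand (χ T k) (c k) (ℕtoℚ M) (ℕtoℚ N) (lookup (gens P k) i))) ⟩
      sumℚ (m P) (λ k → c k * (χ T k * lookup (gens P k) i) + χ T k * (ℕtoℚ M * (ℕtoℚ N * lookup (gens P k) i)))
        ≡⟨ sum-+ (m P) _ _ ⟩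
      sumℚ (m P) (λ k → c k * (χ T k * lookup (gens P k) i)) + sumℚ (m P) (λ k → χ T k * (ℕtoℚ M * (ℕtoℚ N * lookup (gens P k) i)))
        ≡⟨ cong (_+ sumℚ (m P) (λ k → χ T k * (ℕtoℚ M * (ℕtoℚ N * lookup (gens P k) i))))
             (trans (sum-cong (λ k → cong (c k *_) (sym (lookup-map i (χ T k *_) (gens P k)))))
               (trans (sym (lookup∘tabulate (λ i → sumℚ (m P) (λ k → c k * lookup (mask P T k) i)) i))
                 (cong (λ x → lookup x i) (sym z-mask)))) ⟩
      lookup (toℚv z) i + sumℚ (m P) (λ k → χ T k * (ℕtoℚ M * (ℕtoℚ N * lookup (gens P k) i))) ∎
      where
      open ≡-Reasoning
      expand : ∀ x c a b g → x * (c + a * b) * g ≡ c * (x * g) + x * (a * (b * g))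
      expand = solve-∀ ℚ-ring
    lattice = toLPt (lincomb c′ (gens P)) λ i → subst IsInt (sym (coordinate i))
      (isInt-+ (toℚv-isInt z i) (isInt-sum (m P) (λ k → isInt-* (χ-isInt T k) (isInt-* (ℕtoℚ-isInt M) (N-clears k i)))))
    -- The shift changes the value of `φ` by `K` times the size of `T`, an integer, so
    -- non-integrality at the original `z` passes to the shifted point.
    φz : φ · toℚv z ≡ sumℚ (m P) c′ + - (ℕtoℚ K * sumℚ (m P) (χ T))
    φz = begin
      φ · toℚv z
        ≡⟨ trans (cong (φ ·_) z-mask) (dot-lincomb φ c (mask P T)) ⟩
      sumℚ (m P) (λ k → c k * (φ · mask P T k))
        ≡⟨ sum-cong (λ k → trans (cong (c k *_) (trans (dot-*v φ (χ T k) (gens P k)) (φT k)))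
             (split (c k) (χ T k) (ℕtoℚ K))) ⟩
      sumℚ (m P) (λ k → c′ k + - ℕtoℚ K * χ T k)
        ≡⟨ trans (sum-+ (m P) c′ _) (cong (sumℚ (m P) c′ +_) (trans (sum-*ˡ (m P) (- ℕtoℚ K) (χ T)) (negate (ℕtoℚ K) _))) ⟩
      sumℚ (m P) c′ + - (ℕtoℚ K * sumℚ (m P) (χ T)) ∎
      where
      open ≡-Reasoning
      split : ∀ c x k → c * x ≡ x * (c + k) + - k * x
      split = solve-∀ ℚ-ring
      negate : ∀ k s → - k * s ≡ - (k * s)
      negate = solve-∀ ℚ-ring

  subsets : ∀ m {A : Vec Bool m → Set} {B : Set} → (∀ T → A T ⊎ B) → (∀ T → A T) ⊎ B
  subsets zero f = map⊎ (λ { a [] → a }) id (f [])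
  subsets (suc m) f with subsets m (f ∘ (true ∷_)) | subsets m (f ∘ (false ∷_))
  ... | inj₂ b | _ = inj₂ b
  ... | inj₁ _ | inj₂ b = inj₂ b
  ... | inj₁ t | inj₁ s = inj₁ λ { (true ∷ T) → t T ; (false ∷ T) → s T }

  -- A functional is integral on all lattice points of lin P as soon as it is so on these finitely
  -- many.
  record LatticeGenerators {n} (P : Polytope n) : Set where
    field
      size : ℕ
      vectors : Fin size → LPt n
      in-span : ∀ i → InSpan P (toℚv (vectors i))
      generate : ∀ (z : LPt n) → InSpan P (toℚv z) → Σ (Fin size → ℤ) λ a →
        toℚv z ≡ lincomb (ℤtoℚ ∘ a) (toℚv ∘ vectors)

  -- The system φ = 1 on `T` has no solution if (1, 0) is a combination of the vectors (1, g) with g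
  -- in `T`. Otherwise Fredholm gives (s, w) with s > 0 orthogonal to all of them, and φ is -w / s.
  tight-functional : ∀ {n} (P : Polytope n) T → (Σ (Pt n) λ φ → ∀ k → χ T k * (φ · gens P k) ≡ χ T k) ⊎
    (∀ y → ¬ (∀ k → χ T k * (y · gens P k) ≡ χ T k))
  tight-functional {n} P T = [ inj₂ ∘ inconsistent , inj₁ ∘ solution ]′
    (fredholm (m P) (λ k → χ T k *v (1ℚ ∷ gens P k)) (1ℚ ∷ 0v))
    where
    a : Fin (m P) → Pt (suc n)
    a k = χ T k *v (1ℚ ∷ gens P k)
    value : ∀ s (w : Pt n) k → (s ∷ w) · a k ≡ s * χ T k + χ T k * (w · gens P k)
    value s w k = trans (dot-*v (s ∷ w) (χ T k) (1ℚ ∷ gens P k)) (expand (χ T k) s (w · gens P k))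
      where
      expand : ∀ x s g → x * (s * 1ℚ + g) ≡ s * x + x * g
      expand = solve-∀ ℚ-ring
    unit : ∀ s (w : Pt n) → (s ∷ w) · (1ℚ ∷ 0v) ≡ s
    unit s w = trans (cong (s * 1ℚ +_) (dot-0v w)) (trans (+-identityʳ (s * 1ℚ)) (*-identityʳ s))
    inconsistent : InSpanOf a (1ℚ ∷ 0v) → ∀ y → ¬ (∀ k → χ T k * (y · gens P k) ≡ χ T k)
    inconsistent (u , eq) y h = <-irrefl (sym (trans (sym vanishes) (trans (cong ((- 1ℚ ∷ y) ·_) eq) (unit (- 1ℚ) y)))) (neg-antimono-< 0<1)
      where
      cancel : ∀ x → - 1ℚ * x + x ≡ 0ℚ
      cancel = solve-∀ ℚ-ring
      vanishes : (- 1ℚ ∷ y) · lincomb u a ≡ 0ℚ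
      vanishes = trans (dot-lincomb (- 1ℚ ∷ y) u a) (sum-zero (m P) (λ k → trans (cong (u k *_)
        (trans (value (- 1ℚ) y k) (trans (cong (λ t → - 1ℚ * χ T k + t) (h k)) (cancel (χ T k))))) (*-zeroʳ (u k))))
    solution : (Σ (Pt (suc n)) λ x → (∀ k → x · a k ≡ 0ℚ) × 0ℚ < x · (1ℚ ∷ 0v)) →
      Σ (Pt n) λ φ → ∀ k → χ T k * (φ · gens P k) ≡ χ T k
    solution (s ∷ w , orth , pos) with inverse-pos (subst (0ℚ <_) (unit s w) pos)
    ... | r , _ , sr≡1 = (- r) *v w , λ k → trans (cong (χ T k *_) (*v-dot (- r) w (gens P k)))
      (trans (rearrange (χ T k) r (w · gens P k) s) (trans (cong₂ (λ p q → p * χ T k - r * q) sr≡1 (trans (sym (value s w k)) (orth k)))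
        (tidy (χ T k) r)))
      where
      rearrange : ∀ x r g s → x * (- r * g) ≡ s * r * x - r * (s * x + x * g)
      rearrange = solve-∀ ℚ-ring
      tidy : ∀ x r → 1ℚ * x - r * 0ℚ ≡ x
      tidy = solve-∀ ℚ-ring

  span-dot : ∀ {n} (P : Polytope n) T → Spanning P T → ∀ {φ y} → (∀ k → χ T k * (φ · gens P k) ≡ χ T k) →
    (∀ k → χ T k * (y · gens P k) ≡ χ T k) → SameOnLin P y φ
  span-dot P T span {φ} {y} φT yT = spanning-agree P T span y φ (λ k → trans (yT k) (sym (φT k)))

  IntegralFor : ∀ {n} (P : Polytope n) → Vec Bool (m P) → Set
  IntegralFor {n} P T = Spanning P T → ∀ y → InDual P y → (∀ k → χ T k * (y · gens P k) ≡ χ T k) →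
    ∀ (z : LPt n) → InSpan P (toℚv z) → IsInt (y · toℚv z)

  -- If `T` spans, being 1 on `T` determines a functional on lin P, so testing the one computed `φ`
  -- settles all `y` at once. When `φ` does not exist, `T` does not span or `φ` is outside the dual,
  -- `IntegralFor` holds vacuously.
  integralFor? : ∀ {n} (P : Polytope n) → LatticeGenerators P → ∀ T → IntegralFor P T ⊎ NonIntegralGauge P
  integralFor? {n} P L T = [ with-functional , (λ none → inj₁ λ _ y _ yT → ⊥-elim (none y yT)) ]′ (tight-functional P T)
    where
    open LatticeGenerators L
    dec⊎ : ∀ {A : Set} → Dec A → A ⊎ ¬ A
    dec⊎ (yes a) = inj₁ a
    dec⊎ (no ¬a) = inj₂ ¬a
    with-functional : (Σ (Pt n) λ φ → ∀ k → χ T k * (φ · gens P k) ≡ χ T k) → IntegralFor P T ⊎ NonIntegralGauge P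
    with-functional (φ , φT) = [ with-span , (λ (k , d , d⊥ , pos) → inj₁ λ span → ⊥-elim (not-spanning k d d⊥ pos (span k))) ]′
      (allOrSome (λ k → fredholm (m P) (mask P T) (gens P k)))
      where
      not-spanning : ∀ k d → (∀ j → d · mask P T j ≡ 0ℚ) → 0ℚ < d · gens P k → InSpanOf (mask P T) (gens P k) → ⊥
      not-spanning k d d⊥ pos (u , eq) = <-irrefl (sym (trans (cong (d ·_) (sym eq)) (trans (dot-lincomb d u (mask P T))
        (sum-zero (m P) (λ j → trans (cong (u j *_) (d⊥ j)) (*-zeroʳ (u j))))))) pos
      with-span : Spanning P T → IntegralFor P T ⊎ NonIntegralGauge P
      with-span span = [ with-dual , (λ (k , nle) → inj₁ λ _ y y∈ yT →
          ⊥-elim (nle (subst (_≤ 1ℚ) (span-dot P T span {φ} {y} φT yT k) (y∈ k)))) ]′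
        (allOrSome (λ k → dec⊎ (φ · gens P k ≤? 1ℚ)))
        where
        with-dual : InDual P φ → IntegralFor P T ⊎ NonIntegralGauge P
        with-dual φ∈ = [ inj₁ ∘ all-integral , (λ (i , nonint) → inj₂ (nonIntegralGauge P T φ φT φ∈ span (vectors i) (in-span i) nonint)) ]′
          (allOrSome (λ i → dec⊎ (isInt? (φ · toℚv (vectors i)))))
          where
          all-integral : (∀ i → IsInt (φ · toℚv (vectors i))) → IntegralFor P T
          all-integral ints _ y _ yT z z∈ = let (a , eq) = generate z z∈ in
            subst IsInt (sym (trans (sameOnLin-span P {y} {φ} (span-dot P T span {φ} {y} φT yT) z∈)
              (trans (cong (φ ·_) eq) (dot-lincomb φ (ℤtoℚ ∘ a) (toℚv ∘ vectors)))))
              (isInt-sum size (λ i → isInt-* (a i , refl) (ints i)))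

  -- Every dual vertex is 1 on its own tight set, which spans; hence running over all subsets of
  -- generators reaches every vertex without a list of them.
  dualIsLattice? : ∀ {n} (P : Polytope n) → LatticeGenerators P → DualIsLattice P ⊎ NonIntegralGauge P
  dualIsLattice? P L = map⊎ (λ integral y vertex → integral (tight P y) (vertex⇒spanning P y vertex) y (proj₁ vertex) (χ-tight P y)) id
    (subsets (m P) (integralFor? P L))

  -- Projections of a free sum

  row : ∀ {n} → Matrix n → Fin n → Pt n
  row M i = tabulate (λ j → ℤtoℚ (M i j))

  lookup-act : ∀ {n} (M : Matrix n) x i → lookup (act M x) i ≡ row M i · x
  lookup-act M x i = trans (lookup∘tabulate _ i)
    (sum-cong (λ j → cong (_* lookup x j) (sym (lookup∘tabulate (λ j → ℤtoℚ (M i j)) j))))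

  act-lincomb : ∀ {n m} (M : Matrix n) c (v : Fin m → Pt n) → act M (lincomb c v) ≡ lincomb c (act M ∘ v)
  act-lincomb M c v = lookup-ext λ i → trans (lookup-act M (lincomb c v) i) (trans (dot-lincomb (row M i) c v)
    (trans (sum-cong (λ k → cong (c k *_) (sym (lookup-act M (v k) i)))) (sym (lookup∘tabulate _ i))))

  act-0v : ∀ {n} (M : Matrix n) → act M 0v ≡ 0v
  act-0v M = lookup-ext λ i → trans (lookup-act M 0v i) (trans (dot-0v (row M i)) (sym (lookup∘tabulate _ i)))

  act-isInt : ∀ {n} (M : Matrix n) {x} → (∀ i → IsInt (lookup x i)) → ∀ i → IsInt (lookup (act M x) i)
  act-isInt {n} M {x} h i = subst IsInt (sym (lookup∘tabulate _ i)) (isInt-sum n (λ j → isInt-* (M i j , refl) (h j)))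

  lincomb-e : ∀ {n} (x : Pt n) → x ≡ lincomb (lookup x) e
  lincomb-e {n} x = dot-ext λ w → trans (sum-cong (λ i → trans (*-comm (lookup w i) (lookup x i))
    (cong (lookup x i *_) (sym (trans (dot-comm w (e i)) (e-dot i w)))))) (sym (dot-lincomb w (lookup x) e))

  ℤtoℚ-sum : ∀ n (f : Fin n → ℤ) → ℤtoℚ (sumℤ n f) ≡ sumℚ n (ℤtoℚ ∘ f)
  ℤtoℚ-sum zero f = refl
  ℤtoℚ-sum (suc n) f = trans (ℤtoℚ-+ (f zero) (sumℤ n (f ∘ suc))) (cong (ℤtoℚ (f zero) +_) (ℤtoℚ-sum n (f ∘ suc)))

  ℤtoℚ-identity : ∀ {n} (i j : Fin n) → ℤtoℚ (identity i j) ≡ point i 1ℚ j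
  ℤtoℚ-identity zero zero = refl
  ℤtoℚ-identity zero (suc j) = refl
  ℤtoℚ-identity (suc i) zero = refl
  ℤtoℚ-identity (suc i) (suc j) = trans (cong ℤtoℚ (step i j)) (ℤtoℚ-identity i j)
    where
    step : ∀ {n} (i j : Fin n) → identity (suc i) (suc j) ≡ identity i j
    step i j with j ≟F i
    ... | yes _ = refl
    ... | no _ = refl

  act-left-inverse : ∀ {n} (H g : Matrix n) → (∀ i j → sumℤ n (λ k → H i k ℤ.* g k j) ≡ identity i j) →
    ∀ x → act H (act g x) ≡ x
  act-left-inverse {n} H g inv x = lookup-ext λ i → begin
    lookup (act H (act g x)) i
      ≡⟨ trans (lookup∘tabulate _ i) (sum-cong (λ k → cong (ℤtoℚ (H i k) *_) (lookup∘tabulate _ k))) ⟩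
    sumℚ n (λ k → ℤtoℚ (H i k) * sumℚ n (λ j → ℤtoℚ (g k j) * lookup x j))
      ≡⟨ sum-cong (λ k → sym (sum-*ˡ n (ℤtoℚ (H i k)) (λ j → ℤtoℚ (g k j) * lookup x j))) ⟩
    sumℚ n (λ k → sumℚ n (λ j → ℤtoℚ (H i k) * (ℤtoℚ (g k j) * lookup x j)))
      ≡⟨ sum-swap n n (λ k j → ℤtoℚ (H i k) * (ℤtoℚ (g k j) * lookup x j)) ⟩
    sumℚ n (λ j → sumℚ n (λ k → ℤtoℚ (H i k) * (ℤtoℚ (g k j) * lookup x j)))
      ≡⟨ sum-cong (λ j → trans (sum-cong (λ k → trans (sym (*-assoc (ℤtoℚ (H i k)) (ℤtoℚ (g k j)) (lookup x j)))
           (cong (_* lookup x j) (sym (ℤtoℚ-* (H i k) (g k j)))))) (sum-*ʳ n (lookup x j) (λ k → ℤtoℚ (H i k ℤ.* g k j)))) ⟩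
    sumℚ n (λ j → sumℚ n (λ k → ℤtoℚ (H i k ℤ.* g k j)) * lookup x j)
      ≡⟨ sum-cong (λ j → cong (_* lookup x j) (trans (sym (ℤtoℚ-sum n (λ k → H i k ℤ.* g k j)))
           (trans (cong ℤtoℚ (inv i j)) (ℤtoℚ-identity i j)))) ⟩
    sumℚ n (λ j → point i 1ℚ j * lookup x j)
      ≡⟨ trans (sum-point-* i 1ℚ (lookup x)) (*-identityˡ (lookup x i)) ⟩
    lookup x i ∎
    where open ≡-Reasoning

  -- The matrix is integral, and this is what makes the components of a lattice point lattice points
  -- again.
  record Projection {n} (P Q : Polytope n) : Set where
    field
      π : Matrix n
      fixes : ∀ k → act π (gens P k) ≡ gens P k
      kills : ∀ k → act π (gens Q k) ≡ 0v
      into : ∀ x → InSpan P (act π x)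

    fixes-span : ∀ {x} → InSpan P x → act π x ≡ x
    fixes-span (c , refl) = trans (act-lincomb π c (gens P)) (lincomb-cong {c = c} (λ _ → refl) fixes)

    kills-span : ∀ {x} → InSpan Q x → act π x ≡ 0v
    kills-span (c , refl) = trans (act-lincomb π c (gens Q)) (trans (lincomb-cong {c = c} (λ _ → refl) kills)
      (dot-ext λ w → trans (dot-lincomb w c (λ _ → 0v)) (trans (sum-zero (m Q) (λ k → trans (cong (c k *_) (dot-0v w)) (*-zeroʳ (c k))))
        (sym (dot-0v w)))))

    act-ℤ : LPt n → LPt n
    act-ℤ z = proj₁ (toLPt (act π (toℚv z)) (act-isInt π {toℚv z} (toℚv-isInt z)))

    toℚv-act-ℤ : ∀ z → toℚv (act-ℤ z) ≡ act π (toℚv z)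
    toℚv-act-ℤ z = proj₂ (toLPt (act π (toℚv z)) (act-isInt π {toℚv z} (toℚv-isInt z)))

    -- A lattice point of lin P is fixed by `π`, so it is the combination of the images of the unit
    -- vectors with its own coordinates as coefficients.
    latticeGenerators : LatticeGenerators P
    latticeGenerators = record
      { size = n
      ; vectors = λ i → proj₁ (unit i)
      ; in-span = λ i → subst (InSpan P) (sym (proj₂ (unit i))) (into (e i))
      ; generate = λ z z∈ → lookup z , trans (sym (fixes-span z∈)) (trans (cong (act π) (lincomb-e (toℚv z)))
          (trans (act-lincomb π (lookup (toℚv z)) e) (lincomb-cong (λ i → proj₂ (toℚv-isInt z i)) (λ i → sym (proj₂ (unit i)))))) }
      where
      point-isInt : ∀ {n} (i j : Fin n) → IsInt (point i 1ℚ j)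
      point-isInt i j = identity i j , sym (ℤtoℚ-identity i j)
      unit : ∀ i → Σ (LPt n) λ z → toℚv z ≡ act π (e i)
      unit i = toLPt (act π (e i)) (act-isInt π {e i} (λ j → subst IsInt (sym (lookup-e i j)) (point-isInt i j)))

  indicator : Bool → ℤ
  indicator b = if b then ℤ.+ 1 else ℤ.+ 0

  -- `π` is the product of `H`, the diagonal 0/1 matrix of `I`, and `g`: the coordinate projection
  -- carried back by the integral inverse of `g`.
  coordinate-projection : ∀ {n} (P Q : Polytope n) (g H : Matrix n) →
    (∀ i j → sumℤ n (λ k → H i k ℤ.* g k j) ≡ identity i j) → (I J : Fin n → Bool) →
    (∀ i → I i ≡ true → J i ≡ false) → LinIsCoord (actP g P) I → LinIsCoord (actP g Q) J → Projection P Q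
  coordinate-projection {n} P Q g H inv I J disjoint (P-off , P-span) (Q-off , _) = record
    { π = π
    ; fixes = λ k → trans (act-π (gens P k)) (trans (lincomb-cong {d = lookup (act g (gens P k))} {v = λ i → act H (e i)} (fixed k) (λ i → refl))
        (trans (sym (act-lincomb H (lookup (act g (gens P k))) e)) (trans (cong (act H) (sym (lincomb-e (act g (gens P k)))))
          (act-left-inverse H g inv (gens P k)))))
    ; kills = λ k → trans (act-π (gens Q k)) (dot-ext λ w → trans (dot-lincomb w (λ i → ι i * lookup (act g (gens Q k)) i) (λ i → act H (e i)))
        (trans (sum-zero n (λ i → trans (cong (_* (w · act H (e i))) (killed k i)) (*-zeroˡ (w · act H (e i))))) (sym (dot-0v w))))
    ; into = λ x → (λ j → sumℚ n (λ i → lookup (act g x) i * proj₁ (column i) j)) , sym (trans (act-π x) (trans (dot-ext λ w →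
        trans (dot-lincomb w (λ i → ι i * lookup (act g x) i) (λ i → act H (e i)))
          (trans (sum-cong (λ i → trans (*-rotate (ι i) (lookup (act g x) i) (w · act H (e i)))
            (cong (lookup (act g x) i *_) (trans (sym (dot-*v w (ι i) (act H (e i)))) (cong (w ·_) (sym (proj₂ (column i))))))))
          (sym (dot-lincomb w (lookup (act g x)) (λ i → lincomb (proj₁ (column i)) (gens P))))))
        (lincomb-lincomb (lookup (act g x)) (λ i → proj₁ (column i)) (gens P)))) }
    where
    ι : Fin n → ℚ
    ι i = ℤtoℚ (indicator (I i))
    π : Matrix n
    π a b = sumℤ n (λ i → H a i ℤ.* (indicator (I i) ℤ.* g i b))
    act-π : ∀ x → act π x ≡ lincomb (λ i → ι i * lookup (act g x) i) (λ i → act H (e i))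
    act-π x = lookup-ext λ a → begin
      lookup (act π x) a
        ≡⟨ lookup∘tabulate _ a ⟩
      sumℚ n (λ b → ℤtoℚ (π a b) * lookup x b)
        ≡⟨ sum-cong (λ b → trans (cong (_* lookup x b) (ℤtoℚ-sum n (λ i → H a i ℤ.* (indicator (I i) ℤ.* g i b))))
             (sym (sum-*ʳ n (lookup x b) (λ i → ℤtoℚ (H a i ℤ.* (indicator (I i) ℤ.* g i b)))))) ⟩
      sumℚ n (λ b → sumℚ n (λ i → ℤtoℚ (H a i ℤ.* (indicator (I i) ℤ.* g i b)) * lookup x b))
        ≡⟨ sum-swap n n (λ b i → ℤtoℚ (H a i ℤ.* (indicator (I i) ℤ.* g i b)) * lookup x b) ⟩
      sumℚ n (λ i → sumℚ n (λ b → ℤtoℚ (H a i ℤ.* (indicator (I i) ℤ.* g i b)) * lookup x b))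
        ≡⟨ sum-cong (λ i → trans (sum-cong (λ b → trans (cong (_* lookup x b) (trans (ℤtoℚ-* (H a i) _)
             (cong (ℤtoℚ (H a i) *_) (ℤtoℚ-* (indicator (I i)) (g i b))))) (regroup (ℤtoℚ (H a i)) (ι i) (ℤtoℚ (g i b)) (lookup x b))))
             (sum-*ˡ n (ι i * ℤtoℚ (H a i)) (λ b → ℤtoℚ (g i b) * lookup x b))) ⟩
      sumℚ n (λ i → ι i * ℤtoℚ (H a i) * sumℚ n (λ b → ℤtoℚ (g i b) * lookup x b))
        ≡⟨ sum-cong (λ i → trans (cong (ι i * ℤtoℚ (H a i) *_) (sym (lookup∘tabulate (λ i → sumℚ n (λ b → ℤtoℚ (g i b) * lookup x b)) i)))
             (trans (swap₂ (ι i) (ℤtoℚ (H a i)) (lookup (act g x) i))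
               (cong (ι i * lookup (act g x) i *_) (sym (entry a i))))) ⟩
      sumℚ n (λ i → ι i * lookup (act g x) i * lookup (act H (e i)) a)
        ≡⟨ sym (lookup∘tabulate (λ a → sumℚ n (λ i → ι i * lookup (act g x) i * lookup (act H (e i)) a)) a) ⟩
      lookup (lincomb (λ i → ι i * lookup (act g x) i) (λ i → act H (e i))) a ∎
      where
      open ≡-Reasoning
      regroup : ∀ h c g x → (h * (c * g)) * x ≡ c * h * (g * x)
      regroup = solve-∀ ℚ-ring
      swap₂ : ∀ a b c → a * b * c ≡ a * c * b
      swap₂ = solve-∀ ℚ-ring
      entry : ∀ a i → lookup (act H (e i)) a ≡ ℤtoℚ (H a i)
      entry a i = trans (lookup-act H (e i) a) (trans (dot-comm (row H a) (e i)) (trans (e-dot i (row H a))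
        (lookup∘tabulate (λ j → ℤtoℚ (H a j)) i)))
    fixed : ∀ k i → ι i * lookup (act g (gens P k)) i ≡ lookup (act g (gens P k)) i
    fixed k i = by-cases (I i) refl
      where
      by-cases : ∀ b → I i ≡ b → ι i * lookup (act g (gens P k)) i ≡ lookup (act g (gens P k)) i
      by-cases true eq = trans (cong (λ b → ℤtoℚ (indicator b) * lookup (act g (gens P k)) i) eq) (*-identityˡ (lookup (act g (gens P k)) i))
      by-cases false eq = trans (cong (ι i *_) (P-off k i eq)) (trans (*-zeroʳ (ι i)) (sym (P-off k i eq)))
    killed : ∀ k i → ι i * lookup (act g (gens Q k)) i ≡ 0ℚ
    killed k i = by-cases (I i) refl
      where
      by-cases : ∀ b → I i ≡ b → ι i * lookup (act g (gens Q k)) i ≡ 0ℚ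
      by-cases true eq = trans (cong (ι i *_) (Q-off k i (disjoint i eq))) (*-zeroʳ (ι i))
      by-cases false eq = trans (cong (λ b → ℤtoℚ (indicator b) * lookup (act g (gens Q k)) i) eq) (*-zeroˡ (lookup (act g (gens Q k)) i))
    column : ∀ i → Σ (Fin (m P) → ℚ) λ c → lincomb c (gens P) ≡ ι i *v act H (e i)
    column i = by-cases (I i) refl
      where
      by-cases : ∀ b → I i ≡ b → Σ (Fin (m P) → ℚ) λ c → lincomb c (gens P) ≡ ι i *v act H (e i)
      by-cases true eq = let (c , c-eq) = P-span i eq in c , trans (sym (act-left-inverse H g inv (lincomb c (gens P))))
        (trans (cong (act H) (trans (act-lincomb g c (gens P)) c-eq)) (dot-ext λ w → sym (trans (dot-*v w (ι i) (act H (e i)))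
          (trans (cong (λ b → ℤtoℚ (indicator b) * (w · act H (e i))) eq) (*-identityˡ (w · act H (e i)))))))
      by-cases false eq = (λ _ → 0ℚ) , dot-ext λ w → trans (dot-lincomb w (λ _ → 0ℚ) (gens P))
        (trans (sum-zero (m P) (λ k → *-zeroˡ (w · gens P k))) (sym (trans (dot-*v w (ι i) (act H (e i)))
          (trans (cong (λ b → ℤtoℚ (indicator b) * (w · act H (e i))) eq) (*-zeroˡ (w · act H (e i)))))))

  record Splitting {n} (P Q : Polytope n) : Set where
    field
      left : Projection P Q
      right : Projection Q P
      0∈P : 0v ∈P P
      0∈Q : 0v ∈P Q

  freeSum⇒splitting : ∀ {n} (P Q : Polytope n) → IsFreeSum P Q → Splitting P Q
  freeSum⇒splitting {n} P Q (g , det≡1 , I , J , disjoint , 0∈gP , 0∈gQ , P-coord , Q-coord) = record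
    { left = coordinate-projection P Q g H inv I J disjoint P-coord Q-coord
    ; right = coordinate-projection Q P g H inv J I disjoint′ Q-coord P-coord
    ; 0∈P = pull P 0∈gP
    ; 0∈Q = pull Q 0∈gQ }
    where
    H = proj₁ (det≡1⇒left-inverse n g det≡1)
    inv = proj₂ (det≡1⇒left-inverse n g det≡1)
    disjoint′ : ∀ i → J i ≡ true → I i ≡ false
    disjoint′ i eq = by-cases (I i) refl
      where
      by-cases : ∀ b → I i ≡ b → I i ≡ false
      by-cases false eq′ = eq′
      by-cases true eq′ with trans (sym eq) (disjoint i eq′)
      ... | ()
    pull : ∀ P → 0v ∈P actP g P → 0v ∈P P
    pull P (c , c≥0 , sum≡1 , eq) = c , c≥0 , sum≡1 , trans (sym (act-left-inverse H g inv (lincomb c (gens P))))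
      (trans (cong (act H) (trans (act-lincomb g c (gens P)) eq)) (act-0v H))

  -- Dilates

  scale⇒dilate : ∀ {n} (P : Polytope n) d {x} → x ∈P scale (ℤ.+ d / 1) P → Dilate P (ℕtoℚ d) x
  scale⇒dilate P d {x} (c , c≥0 , sum≡1 , eq) = (λ k → ℕtoℚ d * c k) , (λ k → *-nonneg (ℕtoℚ-nonneg d) (c≥0 k))
    , ≤-reflexive (trans (sum-*ˡ (m P) (ℕtoℚ d) c) (trans (cong (ℕtoℚ d *_) sum≡1) (*-identityʳ (ℕtoℚ d))))
    , trans (dot-ext λ w → trans (dot-lincomb w (λ k → ℕtoℚ d * c k) (gens P)) (trans
        (sum-cong (λ k → trans (*-rotate (ℕtoℚ d) (c k) (w · gens P k)) (cong (c k *_)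
          (trans (cong (_* (w · gens P k)) (ℕtoℚ-def d)) (sym (dot-*v w (ℤ.+ d / 1) (gens P k)))))))
        (sym (dot-lincomb w c (gens (scale (ℤ.+ d / 1) P)))))) eq

  dilate-*v : ∀ {n} (P : Polytope n) {s x t} → 0ℚ ≤ t → Dilate P s x → Dilate P (t * s) (t *v x)
  dilate-*v P {s} {x} {t} t≥0 (c , c≥0 , sum≤s , refl) = (λ k → t * c k) , (λ k → *-nonneg t≥0 (c≥0 k))
    , subst (_≤ t * s) (sym (sum-*ˡ (m P) t c)) (*-monoˡ t≥0 sum≤s) , lincomb-*v t c (gens P)

  ∈P⇒dilate : ∀ {n} (P : Polytope n) {x} → x ∈P P → Dilate P 1ℚ x
  ∈P⇒dilate P (c , c≥0 , sum≡1 , eq) = c , c≥0 , ≤-reflexive sum≡1 , eq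

  dilate⇒∈P : ∀ {n} (P : Polytope n) {x} → 0v ∈P P → Dilate P 1ℚ x → x ∈P P
  dilate⇒∈P P (o , o≥0 , sum-o≡1 , o-eq) (c , c≥0 , sum≤1 , eq) = (λ k → s * o k + c k)
    , (λ k → +-nonneg (*-nonneg (≤⇒0≤- sum≤1) (o≥0 k)) (c≥0 k))
    , trans (sum-+ (m P) (λ k → s * o k) c) (trans (cong (_+ sumℚ (m P) c) (trans (sum-*ˡ (m P) s o) (cong (s *_) sum-o≡1))) (fill (sumℚ (m P) c)))
    , trans (lincomb-addmul s o c (gens P)) (trans (dot-ext λ w → trans (dot-addmul w s (lincomb o (gens P)) (lincomb c (gens P)))
        (trans (cong (λ t → s * t + w · lincomb c (gens P)) (trans (cong (w ·_) o-eq) (dot-0v w)))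
          (trans (cong (_+ w · lincomb c (gens P)) (*-zeroʳ s)) (+-identityˡ (w · lincomb c (gens P)))))) eq)
    where
    s = 1ℚ - sumℚ (m P) c
    fill : ∀ c → (1ℚ - c) * 1ℚ + c ≡ 1ℚ
    fill = solve-∀ ℚ-ring

  *v-*v : ∀ {n} s t → s * t ≡ 1ℚ → (x : Pt n) → s *v (t *v x) ≡ x
  *v-*v s t st≡1 x = dot-ext λ w → trans (dot-*v w s (t *v x)) (trans (cong (s *_) (dot-*v w t x))
    (trans (sym (*-assoc s t (w · x))) (trans (cong (_* (w · x)) st≡1) (*-identityˡ (w · x)))))

  ∈P-scale : ∀ {n} (P : Polytope n) q {x} → x ∈P P → (q *v x) ∈P scale q P
  ∈P-scale P q (c , c≥0 , sum≡1 , refl) = c , c≥0 , sum≡1 , dot-ext λ w → trans (dot-lincomb w c (gens (scale q P)))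
    (trans (sum-cong (λ k → trans (cong (c k *_) (dot-*v w q (gens P k))) (*-swap (c k) q (w · gens P k))))
      (trans (sum-*ˡ (m P) q (λ k → c k * (w · gens P k))) (sym (trans (dot-*v w q (lincomb c (gens P))) (cong (q *_) (dot-lincomb w c (gens P)))))))

  dilate⇒scale : ∀ {n} (P : Polytope n) → 0v ∈P P → ∀ d → 1 ℕ.≤ d → ∀ {x} → Dilate P (ℕtoℚ d) x → x ∈P scale (ℤ.+ d / 1) P
  dilate⇒scale P 0∈P d d≥1 {x} dx with inverse-pos (ℕtoℚ-pos d≥1)
  ... | t , t>0 , dt≡1 = subst (_∈P scale (ℤ.+ d / 1) P) (*v-*v (ℤ.+ d / 1) t (trans (cong (_* t) (sym (ℕtoℚ-def d))) dt≡1) x)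
    (∈P-scale P (ℤ.+ d / 1) (dilate⇒∈P P 0∈P (subst (λ s → Dilate P s (t *v x)) (trans (*-comm t (ℕtoℚ d)) dt≡1)
      (dilate-*v P (<⇒≤ t>0) dx))))

  dilate-mono : ∀ {n} (P : Polytope n) {s t x} → s ≤ t → Dilate P s x → Dilate P t x
  dilate-mono P s≤t (c , c≥0 , sum≤s , eq) = c , c≥0 , ≤-trans sum≤s s≤t , eq

  dilate-exact : ∀ {n} (P : Polytope n) {x} c → (∀ k → 0ℚ ≤ c k) → lincomb c (gens P) ≡ x → Dilate P (sumℚ (m P) c) x
  dilate-exact P c c≥0 eq = c , c≥0 , ≤-refl , eq

  dilate⇒span : ∀ {n} (P : Polytope n) {t x} → Dilate P t x → InSpan P x
  dilate⇒span P (c , _ , _ , eq) = c , eq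

  dilate-0 : ∀ {n} (P : Polytope n) {x} → Dilate P 0ℚ x → x ≡ 0v
  dilate-0 P (c , c≥0 , sum≤0 , refl) = dot-ext λ w → trans (dot-lincomb w c (gens P)) (trans (sum-zero (m P)
    (λ k → trans (cong (_* (w · gens P k)) (sum-nonneg-≤0 (m P) c≥0 sum≤0 k)) (*-zeroˡ (w · gens P k)))) (sym (dot-0v w)))

  0-dilate : ∀ {n} (P : Polytope n) → Dilate P 0ℚ 0v
  0-dilate P = (λ _ → 0ℚ) , (λ _ → ≤-refl) , ≤-reflexive (sum-zero (m P) (λ _ → refl))
    , dot-ext λ w → trans (dot-lincomb w (λ _ → 0ℚ) (gens P)) (trans (sum-zero (m P) (λ k → *-zeroˡ (w · gens P k))) (sym (dot-0v w)))

  dilate-⊕ : ∀ {n} (P Q : Polytope n) {s t x y} → Dilate P s x → Dilate Q t y → Dilate (P ⊕ Q) (s + t) (addmul 1ℚ x y)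
  dilate-⊕ P Q {s} {t} (c , c≥0 , sum-c , refl) (d , d≥0 , sum-d , refl) = u , u≥0
    , ≤-trans (≤-reflexive (trans (sum-split (m P) (m Q) u) (cong₂ _+_ (sum-cong u-↑ˡ) (sum-cong u-↑ʳ)))) (+-mono-≤ sum-c sum-d)
    , trans (lincomb-join u (gens P) (gens Q)) (cong₂ (addmul 1ℚ) (lincomb-cong {d = c} {v = gens P} u-↑ˡ (λ _ → refl))
        (lincomb-cong {d = d} {v = gens Q} u-↑ʳ (λ _ → refl)))
    where
    u : Fin (m P ℕ.+ m Q) → ℚ
    u k = [ c , d ]′ (splitAt (m P) k)
    u-↑ˡ : ∀ k → u (k ↑ˡ m Q) ≡ c k
    u-↑ˡ k = cong [ c , d ]′ (splitAt-↑ˡ (m P) k (m Q))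
    u-↑ʳ : ∀ k → u (m P ↑ʳ k) ≡ d k
    u-↑ʳ k = cong [ c , d ]′ (splitAt-↑ʳ (m P) (m Q) k)
    u≥0 : ∀ k → 0ℚ ≤ u k
    u≥0 k with splitAt (m P) k
    ... | inj₁ i = c≥0 i
    ... | inj₂ j = d≥0 j

  dilate-⊕⁻ : ∀ {n} (P Q : Polytope n) {t z} → Dilate (P ⊕ Q) t z → Σ ℚ λ s₁ → Σ ℚ λ s₂ → Σ (Pt n) λ x → Σ (Pt n) λ y →
    0ℚ ≤ s₁ × 0ℚ ≤ s₂ × s₁ + s₂ ≤ t × Dilate P s₁ x × Dilate Q s₂ y × z ≡ addmul 1ℚ x y
  dilate-⊕⁻ P Q {t} (u , u≥0 , sum-u , refl) = sumℚ (m P) c , sumℚ (m Q) d , lincomb c (gens P) , lincomb d (gens Q)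
    , sum-nonneg (m P) c≥0 , sum-nonneg (m Q) d≥0 , subst (_≤ t) (sum-split (m P) (m Q) u) sum-u
    , dilate-exact P c c≥0 refl , dilate-exact Q d d≥0 refl , lincomb-join u (gens P) (gens Q)
    where
    c : Fin (m P) → ℚ
    c k = u (k ↑ˡ m Q)
    d : Fin (m Q) → ℚ
    d k = u (m P ↑ʳ k)
    c≥0 : ∀ k → 0ℚ ≤ c k
    c≥0 k = u≥0 (k ↑ˡ m Q)
    d≥0 : ∀ k → 0ℚ ≤ d k
    d≥0 k = u≥0 (m P ↑ʳ k)

  ∈P-⊕ˡ : ∀ {n} (P Q : Polytope n) {x} → x ∈P P → x ∈P (P ⊕ Q)
  ∈P-⊕ˡ P Q (c , c≥0 , sum≡1 , refl) = u , u≥0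
    , trans (sum-split (m P) (m Q) u) (trans (cong₂ _+_ (sum-cong u-↑ˡ) (sum-zero (m Q) u-↑ʳ)) (trans (+-identityʳ (sumℚ (m P) c)) sum≡1))
    , dot-ext λ w → trans (dot-lincomb w u (gens (P ⊕ Q))) (trans (sum-split (m P) (m Q) (λ k → u k * (w · gens (P ⊕ Q) k)))
        (trans (cong₂ _+_ (sum-cong (λ k → cong₂ (λ t v → t * (w · v)) (u-↑ˡ k) (join-↑ˡ (gens P) (gens Q) k)))
          (sum-zero (m Q) (λ k → trans (cong (_* (w · gens (P ⊕ Q) (m P ↑ʳ k))) (u-↑ʳ k)) (*-zeroˡ (w · gens (P ⊕ Q) (m P ↑ʳ k))))))
          (trans (+-identityʳ (sumℚ (m P) (λ k → c k * (w · gens P k)))) (sym (dot-lincomb w c (gens P))))))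
    where
    u : Fin (m P ℕ.+ m Q) → ℚ
    u k = [ c , (λ _ → 0ℚ) ]′ (splitAt (m P) k)
    u-↑ˡ : ∀ k → u (k ↑ˡ m Q) ≡ c k
    u-↑ˡ k = cong [ c , (λ _ → 0ℚ) ]′ (splitAt-↑ˡ (m P) k (m Q))
    u-↑ʳ : ∀ k → u (m P ↑ʳ k) ≡ 0ℚ
    u-↑ʳ k = cong [ c , (λ _ → 0ℚ) ]′ (splitAt-↑ʳ (m P) (m Q) k)
    u≥0 : ∀ k → 0ℚ ≤ u k
    u≥0 k with splitAt (m P) k
    ... | inj₁ i = c≥0 i
    ... | inj₂ _ = ≤-refl

  toℚv-injective : ∀ {n} {x y : LPt n} → toℚv x ≡ toℚv y → x ≡ y
  toℚv-injective {x = x} {y} eq = trans (sym (tabulate∘lookup x)) (trans (tabulate-cong λ i → ℤtoℚ-injective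
    (trans (sym (lookup-map i ℤtoℚ x)) (trans (cong (λ v → lookup v i) eq) (lookup-map i ℤtoℚ y)))) (tabulate∘lookup y))

  _≟L_ : ∀ {n} → DecidableEquality (LPt n)
  _≟L_ = ≡-dec ℤₚ._≟_

  -- The lists of `IsEhr` in terms of `Dilate`, which also covers k = 0, where the prescribed
  -- coefficient 1 counts the origin.
  record LatticePoints {n} (P : Polytope n) (count : ℕ → ℕ) : Set where
    field
      points : ℕ → List (LPt n)
      unique : ∀ k → Unique (points k)
      sound : ∀ k {z} → z ∈ points k → Dilate P (ℕtoℚ k) (toℚv z)
      complete : ∀ k {z} → Dilate P (ℕtoℚ k) (toℚv z) → z ∈ points k
      size : ∀ k → length (points k) ≡ count k

  latticePoints : ∀ {n} (P : Polytope n) {count} → 0v ∈P P → IsEhr P count → LatticePoints P count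
  latticePoints {n} P {count} 0∈P (count-0 , counts) = record
    { points = points ; unique = unique ; sound = sound ; complete = complete ; size = size }
    where
    origin : Σ (LPt n) λ z → toℚv z ≡ 0v
    origin = toLPt 0v (λ i → ℤ.+ 0 , lookup∘tabulate (λ _ → 0ℚ) i)
    points : ℕ → List (LPt n)
    points zero = proj₁ origin ∷ []
    points (suc k) = proj₁ (counts k)
    unique : ∀ k → Unique (points k)
    unique zero = [] ∷ []
    unique (suc k) = proj₁ (proj₂ (counts k))
    sound : ∀ k {z} → z ∈ points k → Dilate P (ℕtoℚ k) (toℚv z)
    sound zero (here refl) = subst₂ (Dilate P) (sym ℕtoℚ-0) (sym (proj₂ origin)) (0-dilate P)
    sound (suc k) {z} z∈ = scale⇒dilate P (suc k) (proj₁ (proj₂ (proj₂ (counts k))) z z∈)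
    complete : ∀ k {z} → Dilate P (ℕtoℚ k) (toℚv z) → z ∈ points k
    complete zero {z} d = here (toℚv-injective (trans (dilate-0 P (subst (λ t → Dilate P t (toℚv z)) ℕtoℚ-0 d)) (sym (proj₂ origin))))
    complete (suc k) {z} d = proj₁ (proj₂ (proj₂ (proj₂ (counts k)))) z (dilate⇒scale P 0∈P (suc k) (ℕ.s≤s ℕ.z≤n) d)
    size : ∀ k → length (points k) ≡ count k
    size zero = sym count-0
    size (suc k) = proj₂ (proj₂ (proj₂ (proj₂ (counts k))))

  act-addmul : ∀ {n} M t (x y : Pt n) → act M (addmul t x y) ≡ addmul t (act M x) (act M y)
  act-addmul M t x y = lookup-ext λ i → trans (lookup-act M (addmul t x y) i) (trans (dot-addmul (row M i) t x y)
    (trans (cong₂ (λ a b → t * a + b) (sym (lookup-act M x i)) (sym (lookup-act M y i)))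
      (sym (lookup∘tabulate (λ i → t * lookup (act M x) i + lookup (act M y) i) i))))

  addmul-isInt : ∀ {n} t (x y : Pt n) → IsInt t → (∀ i → IsInt (lookup x i)) → (∀ i → IsInt (lookup y i)) → ∀ i → IsInt (lookup (addmul t x y) i)
  addmul-isInt t x y ht hx hy i = subst IsInt (sym (lookup∘tabulate (λ i → t * lookup x i + lookup y i) i))
    (isInt-+ (isInt-* ht (hx i)) (hy i))

  *v-isInt : ∀ {n} t (x : Pt n) → IsInt t → (∀ i → IsInt (lookup x i)) → ∀ i → IsInt (lookup (t *v x) i)
  *v-isInt t x ht hx i = subst IsInt (sym (lookup-map i (t *_) x)) (isInt-* ht (hx i))

  -- Multiplying by denominator - 1 negates the fractional part, so it can be brought into (0, ½].
  small-fraction : ∀ q → 0ℚ ≤ q → ¬ IsInt q → Σ ℕ λ M → Σ ℕ λ i → ℕtoℚ i < ℕtoℚ M * q × ℕtoℚ M * q ≤ ℕtoℚ i + ½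
  small-fraction q q≥0 nonint = from-floor (floorℕ q q≥0)
    where
    from-floor : (Σ ℕ λ k → ℕtoℚ k ≤ q × q < ℕtoℚ (suc k)) → Σ ℕ λ M → Σ ℕ λ i → ℕtoℚ i < ℕtoℚ M * q × ℕtoℚ M * q ≤ ℕtoℚ i + ½
    from-floor (k , k≤q , q<1+k) = choose (q ≤? ℕtoℚ k + ½)
      where
      k<q : ℕtoℚ k < q
      k<q = ≤∧≢⇒< k≤q λ { refl → nonint (ℕtoℚ-isInt k) }
      choose : Dec (q ≤ ℕtoℚ k + ½) → Σ ℕ λ M → Σ ℕ λ i → ℕtoℚ i < ℕtoℚ M * q × ℕtoℚ M * q ≤ ℕtoℚ i + ½
      choose (yes le) = 1 , k , subst (ℕtoℚ k <_) one k<q , subst (_≤ ℕtoℚ k + ½) one le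
        where
        one : q ≡ ℕtoℚ 1 * q
        one = sym (trans (cong (_* q) ℕtoℚ-1) (*-identityˡ q))
      choose (no nle) = M , i , subst₂ _<_ (sym i-eq) (sym Mq) (0<-⇒< (subst (0ℚ <_) lower (<⇒0<- q<1+k)))
        , subst₂ _≤_ (sym Mq) (cong (_+ ½) (sym i-eq)) (0≤-⇒≤ (subst (0ℚ ≤_) (upper A q (ℕtoℚ k)) (≤⇒0≤- (<⇒≤ (≰⇒> nle)))))
        where
        -- With `a` the product of `q` and its denominator, `M * q` is `a - q`. As `q` lies strictly
        -- between `k + ½` and `k + 1`, this exceeds `a - (k + 1)` by at most ½.
        M = ℚ.denominator-1 q
        cleared : Σ ℕ λ a → ℕtoℚ (suc M) * q ≡ ℕtoℚ a
        cleared = isInt-nonneg (denominator-clears q) (*-nonneg (ℕtoℚ-nonneg (suc M)) q≥0)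
        a = proj₁ cleared
        A = ℕtoℚ a
        Mq : ℕtoℚ M * q ≡ A - q
        Mq = trans (peel (ℕtoℚ M) q) (cong (_- q) (trans (cong (_* q) (sym (ℕtoℚ-suc M))) (proj₂ cleared)))
          where
          peel : ∀ m q → m * q ≡ (1ℚ + m) * q - q
          peel = solve-∀ ℚ-ring
        k<a : k ℕ.< a
        k<a = ℕtoℚ-cancel-< (<-≤-trans k<q (0≤-⇒≤ (subst (0ℚ ≤_) Mq (*-nonneg (ℕtoℚ-nonneg M) q≥0))))
        i = a ℕ.∸ suc k
        i-eq : ℕtoℚ i ≡ A - (1ℚ + ℕtoℚ k)
        i-eq = trans (peel (ℕtoℚ i) (1ℚ + ℕtoℚ k)) (cong (_- (1ℚ + ℕtoℚ k)) (trans (cong (ℕtoℚ i +_) (sym (ℕtoℚ-suc k)))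
          (trans (sym (ℕtoℚ-+ i (suc k))) (cong ℕtoℚ (ℕₚ.m∸n+n≡m k<a)))))
          where
          peel : ∀ a b → a ≡ a + b - b
          peel = solve-∀ ℚ-ring
        lower : ℕtoℚ (suc k) - q ≡ (A - q) - (A - (1ℚ + ℕtoℚ k))
        lower = trans (cong (_- q) (ℕtoℚ-suc k)) (shift A q (1ℚ + ℕtoℚ k))
          where
          shift : ∀ a q k → k - q ≡ (a - q) - (a - k)
          shift = solve-∀ ℚ-ring
        upper : ∀ a q k → q - (k + ½) ≡ (a - (1ℚ + k) + ½) - (a - q)
        upper = solve-∀ ℚ-ring

  -- The product formula for the Ehrhart series of a free sum.

  module FreeSum {n} (P Q : Polytope n) (S : Splitting P Q) (eP eQ eS : ℕ → ℕ)
    (ehrP : IsEhr P eP) (ehrQ : IsEhr Q eQ) (ehrS : IsEhr (P ⊕ Q) eS) where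

    open Splitting S
    open Projection left

    0∈P⊕Q : 0v ∈P (P ⊕ Q)
    0∈P⊕Q = ∈P-⊕ˡ P Q 0∈P

    module A = LatticePoints (latticePoints P {eP} 0∈P ehrP)
    module B = LatticePoints (latticePoints Q {eQ} 0∈Q ehrQ)
    module C = LatticePoints (latticePoints (P ⊕ Q) {eS} 0∈P⊕Q ehrS)

    -- Defined as `z - π z` and not by the projection to lin Q, so that `split` is injective on all
    -- lattice points even when lin P and lin Q do not span the whole space.
    complement : LPt n → LPt n
    complement z = proj₁ (toLPt (addmul (- 1ℚ) (act π (toℚv z)) (toℚv z)) (addmul-isInt (- 1ℚ) (act π (toℚv z)) (toℚv z) (ℤ.- ℤ.+ 1 , refl) (act-isInt π {toℚv z} (toℚv-isInt z)) (toℚv-isInt z)))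

    toℚv-complement : ∀ z → toℚv (complement z) ≡ addmul (- 1ℚ) (act π (toℚv z)) (toℚv z)
    toℚv-complement z = proj₂ (toLPt (addmul (- 1ℚ) (act π (toℚv z)) (toℚv z)) (addmul-isInt (- 1ℚ) (act π (toℚv z)) (toℚv z) (ℤ.- ℤ.+ 1 , refl) (act-isInt π {toℚv z} (toℚv-isInt z)) (toℚv-isInt z)))

    split : LPt n → LPt n × LPt n
    split z = act-ℤ z , complement z

    recombine : ∀ z → toℚv z ≡ addmul 1ℚ (toℚv (act-ℤ z)) (toℚv (complement z))
    recombine z = dot-ext λ w → sym (trans (dot-addmul w 1ℚ (toℚv (act-ℤ z)) (toℚv (complement z))) (trans (cong₂ (λ x y → 1ℚ * (w · x) + w · y) (toℚv-act-ℤ z) (toℚv-complement z))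
      (trans (cong (1ℚ * (w · act π (toℚv z)) +_) (dot-addmul w (- 1ℚ) (act π (toℚv z)) (toℚv z))) (cancel (w · act π (toℚv z)) (w · toℚv z)))))
      where
      cancel : ∀ p z → 1ℚ * p + (- 1ℚ * p + z) ≡ z
      cancel = solve-∀ ℚ-ring

    split-injective : ∀ {z z′} → split z ≡ split z′ → z ≡ z′
    split-injective {z} {z′} eq = toℚv-injective (trans (recombine z) (trans
      (cong (λ p → addmul 1ℚ (toℚv (proj₁ p)) (toℚv (proj₂ p))) eq) (sym (recombine z′))))

    components : ∀ z {x y} → toℚv z ≡ addmul 1ℚ x y → InSpan P x → InSpan Q y →
      toℚv (act-ℤ z) ≡ x × toℚv (complement z) ≡ y
    components z {x} {y} eq x∈ y∈ = trans (toℚv-act-ℤ z) πz , trans (toℚv-complement z) (dot-ext λ w →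
      trans (dot-addmul w (- 1ℚ) (act π (toℚv z)) (toℚv z)) (trans (cong₂ (λ a b → - 1ℚ * (w · a) + w · b) πz eq)
        (trans (cong (- 1ℚ * (w · x) +_) (dot-addmul w 1ℚ x y)) (cancel (w · x) (w · y)))))
      where
      πz : act π (toℚv z) ≡ x
      πz = trans (cong (act π) eq) (trans (act-addmul π 1ℚ x y) (trans (cong₂ (addmul 1ℚ) (fixes-span x∈) (kills-span y∈))
        (dot-ext λ w → trans (dot-addmul w 1ℚ x 0v) (trans (cong (1ℚ * (w · x) +_) (dot-0v w)) (1*+0 (w · x))))))
      cancel : ∀ x y → - 1ℚ * x + (1ℚ * x + y) ≡ y
      cancel = solve-∀ ℚ-ring

    combine : ∀ i j {x y} → x ∈ A.points i → y ∈ B.points j → Σ (LPt n) λ z → z ∈ C.points (i ℕ.+ j) × split z ≡ (x , y)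
    combine i j {x} {y} x∈ y∈ = proj₁ z , C.complete (i ℕ.+ j) (subst₂ (Dilate (P ⊕ Q)) (sym (ℕtoℚ-+ i j)) (sym (proj₂ z))
        (dilate-⊕ P Q (A.sound i x∈) (B.sound j y∈)))
      , cong₂ _,_ (toℚv-injective (proj₁ parts)) (toℚv-injective (proj₂ parts))
      where
      z : Σ (LPt n) λ z → toℚv z ≡ addmul 1ℚ (toℚv x) (toℚv y)
      z = toLPt (addmul 1ℚ (toℚv x) (toℚv y)) (addmul-isInt 1ℚ (toℚv x) (toℚv y) (ℤ.+ 1 , refl) (toℚv-isInt x) (toℚv-isInt y))
      parts = components (proj₁ z) (proj₂ z) (dilate⇒span P (A.sound i x∈)) (dilate⇒span Q (B.sound j y∈))

    open Convolution _≟L_ (Product.≡-dec _≟L_ _≟L_) A.points B.points C.points split A.unique B.unique C.unique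
      (λ k p → A.complete (suc k) (dilate-mono P (ℕtoℚ-mono (ℕₚ.n≤1+n k)) (A.sound k p)))
      (λ k p → B.complete (suc k) (dilate-mono Q (ℕtoℚ-mono (ℕₚ.n≤1+n k)) (B.sound k p)))
      split-injective eP eQ eS A.size B.size C.size combine

    -- The slack gained by rounding s down is given to the other summand.
    round-down : ∀ {R R′ : Polytope n} → DualIsLattice R → ∀ k (x : LPt n) {y s t} → 0ℚ ≤ s → 0ℚ ≤ t → s + t ≤ ℕtoℚ k →
      Dilate R s (toℚv x) → Dilate R′ t y → Σ ℕ λ i → Σ ℕ λ j → i ℕ.+ j ≡ k × Dilate R (ℕtoℚ i) (toℚv x) × Dilate R′ (ℕtoℚ j) y
    round-down {R} {R′} lattice k x {y} {s} {t} s≥0 t≥0 le dx dy = from-floor (floorℕ s s≥0)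
      where
      from-floor : (Σ ℕ λ i → ℕtoℚ i ≤ s × s < ℕtoℚ (suc i)) → Σ ℕ λ i → Σ ℕ λ j → i ℕ.+ j ≡ k × Dilate R (ℕtoℚ i) (toℚv x) × Dilate R′ (ℕtoℚ j) y
      from-floor (i , i≤s , s<1+i) = i , k ℕ.∸ i , ℕₚ.m+[n∸m]≡n i≤k , floor-dilate R lattice x s i dx s<1+i
        , dilate-mono R′ (≤-trans (0≤-⇒≤ (subst (0ℚ ≤_) (rest (ℕtoℚ k) s t) (≤⇒0≤- le)))
            (≤-trans (+-monoʳ-≤ (ℕtoℚ k) (neg-antimono-≤ i≤s)) (≤-reflexive gap))) dy
        where
        rest : ∀ k s t → k - (s + t) ≡ (k - s) - t
        rest = solve-∀ ℚ-ring
        i≤k : i ℕ.≤ k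
        i≤k = ℕtoℚ-cancel-≤ (≤-trans i≤s (≤-trans (subst (_≤ s + t) (+-identityʳ s) (+-monoʳ-≤ s t≥0)) le))
        gap : ℕtoℚ k - ℕtoℚ i ≡ ℕtoℚ (k ℕ.∸ i)
        gap = trans (cong (_- ℕtoℚ i) (trans (cong ℕtoℚ (sym (ℕₚ.m∸n+n≡m i≤k))) (ℕtoℚ-+ (k ℕ.∸ i) i))) (peel (ℕtoℚ (k ℕ.∸ i)) (ℕtoℚ i))
          where
          peel : ∀ a b → a + b - b ≡ a
          peel = solve-∀ ℚ-ring

    lattice⇒decompose : DualIsLattice P ⊎ DualIsLattice Q → ∀ k z → z ∈ C.points k → Decomposes k z
    lattice⇒decompose lattice k z z∈ = from-dilates (dilate-⊕⁻ P Q (C.sound k z∈))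
      where
      from-dilates : (Σ ℚ λ s → Σ ℚ λ t → Σ (Pt n) λ x → Σ (Pt n) λ y → 0ℚ ≤ s × 0ℚ ≤ t × s + t ≤ ℕtoℚ k ×
        Dilate P s x × Dilate Q t y × toℚv z ≡ addmul 1ℚ x y) → Decomposes k z
      from-dilates (s , t , x , y , s≥0 , t≥0 , le , dx , dy , eq) = [ left-lattice , right-lattice ]′ lattice
        where
        parts : toℚv (act-ℤ z) ≡ x × toℚv (complement z) ≡ y
        parts = components z {x} {y} eq (dilate⇒span P dx) (dilate⇒span Q dy)
        dx′ : Dilate P s (toℚv (act-ℤ z))
        dx′ = subst (Dilate P s) (sym (proj₁ parts)) dx
        dy′ : Dilate Q t (toℚv (complement z))
        dy′ = subst (Dilate Q t) (sym (proj₂ parts)) dy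
        left-lattice : DualIsLattice P → Decomposes k z
        left-lattice h = let (i , j , i+j , di , dj) = round-down {P} {Q} h k (act-ℤ z) s≥0 t≥0 le dx′ dy′ in
          i , j , i+j , A.complete i di , B.complete j dj
        right-lattice : DualIsLattice Q → Decomposes k z
        right-lattice h = let (j , i , j+i , dj , di) = round-down {Q} {P} h k (complement z) t≥0 s≥0
                                (subst (_≤ ℕtoℚ k) (+-comm s t) le) dy′ dx′ in
          i , j , trans (ℕₚ.+-comm i j) j+i , A.complete i di , B.complete j dj

    -- The certificate `φ` bounds every dilate containing the multiple from below, whatever
    -- representation of the point is used.
    gauge-multiple : ∀ {R : Polytope n} (G : NonIntegralGauge R) → let open NonIntegralGauge G in ∀ M {i} → ℕtoℚ i < ℕtoℚ M * sumℚ (m R) c →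
      ∀ {k} → Dilate R (ℕtoℚ k) (ℕtoℚ M *v toℚv z) → i ℕ.< k
    gauge-multiple {R} G M {i} i< {k} d = ℕtoℚ-cancel-< (<-≤-trans i< (subst (_≤ ℕtoℚ k)
      (trans (dot-*v φ (ℕtoℚ M) (toℚv z)) (cong (ℕtoℚ M *_) (sym gauge))) (dual-bound R {φ = φ} φ∈ d)))
      where open NonIntegralGauge G

    -- The chosen multiples have gauges in (i, i + ½] and (j, j + ½]. Their sum therefore lies in
    -- the dilate of P ⊕ Q by i + j + 1, but splitting it takes at least i + 1 for the first
    -- component and j + 1 for the second.
    decompose⇒not-both : (∀ k z → z ∈ C.points k → Decomposes k z) → NonIntegralGauge P → NonIntegralGauge Q → ⊥
    decompose⇒not-both h G G′ = conclude (small-fraction (sumℚ (m P) G.c) (sum-nonneg (m P) G.c≥0) G.nonintegral)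
      (small-fraction (sumℚ (m Q) G′.c) (sum-nonneg (m Q) G′.c≥0) G′.nonintegral)
      where
      module G = NonIntegralGauge G
      module G′ = NonIntegralGauge G′
      conclude : (Σ ℕ λ M → Σ ℕ λ i → ℕtoℚ i < ℕtoℚ M * sumℚ (m P) G.c × ℕtoℚ M * sumℚ (m P) G.c ≤ ℕtoℚ i + ½) →
        (Σ ℕ λ M → Σ ℕ λ i → ℕtoℚ i < ℕtoℚ M * sumℚ (m Q) G′.c × ℕtoℚ M * sumℚ (m Q) G′.c ≤ ℕtoℚ i + ½) → ⊥
      conclude (M , i , i< , ≤i+½) (N , j , j< , ≤j+½) =
        let (i′ , j′ , i′+j′ , x∈ , y∈) = h (suc (i ℕ.+ j)) (proj₁ z) (C.complete (suc (i ℕ.+ j)) (subst (Dilate (P ⊕ Q) (ℕtoℚ (suc (i ℕ.+ j)))) (sym (proj₂ z))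
              (dilate-mono (P ⊕ Q) bound (dilate-⊕ P Q dx dy))))
            i<i′ = gauge-multiple {P} G M i< (subst (Dilate P (ℕtoℚ i′)) (proj₁ parts) (A.sound i′ x∈))
            j<j′ = gauge-multiple {Q} G′ N j< (subst (Dilate Q (ℕtoℚ j′)) (proj₂ parts) (B.sound j′ y∈))
        in ℕₚ.<-irrefl (sym i′+j′) (subst (ℕ._≤ i′ ℕ.+ j′) (cong suc (ℕₚ.+-suc i j)) (ℕₚ.+-mono-≤ i<i′ j<j′))
        where
        x = ℕtoℚ M *v toℚv G.z
        y = ℕtoℚ N *v toℚv G′.z
        dx : Dilate P (ℕtoℚ M * sumℚ (m P) G.c) x
        dx = dilate-*v P (ℕtoℚ-nonneg M) (dilate-exact P G.c G.c≥0 G.z-eq)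
        dy : Dilate Q (ℕtoℚ N * sumℚ (m Q) G′.c) y
        dy = dilate-*v Q (ℕtoℚ-nonneg N) (dilate-exact Q G′.c G′.c≥0 G′.z-eq)
        z : Σ (LPt n) λ z → toℚv z ≡ addmul 1ℚ x y
        z = toLPt (addmul 1ℚ x y) (addmul-isInt 1ℚ x y (ℤ.+ 1 , refl) (*v-isInt (ℕtoℚ M) (toℚv G.z) (ℕtoℚ-isInt M) (toℚv-isInt G.z))
          (*v-isInt (ℕtoℚ N) (toℚv G′.z) (ℕtoℚ-isInt N) (toℚv-isInt G′.z)))
        parts = components (proj₁ z) (proj₂ z) (dilate⇒span P dx) (dilate⇒span Q dy)
        bound : ℕtoℚ M * sumℚ (m P) G.c + ℕtoℚ N * sumℚ (m Q) G′.c ≤ ℕtoℚ (suc (i ℕ.+ j))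
        bound = ≤-trans (+-mono-≤ ≤i+½ ≤j+½) (≤-reflexive (trans (halves (ℕtoℚ i) (ℕtoℚ j)) (sym (trans (ℕtoℚ-suc (i ℕ.+ j)) (cong (1ℚ +_) (ℕtoℚ-+ i j))))))
          where
          halves : ∀ i j → (i + ½) + (j + ½) ≡ 1ℚ + (i + j)
          halves = solve-∀ ℚ-ring

    lattice⇒product : DualIsLattice P ⊎ DualIsLattice Q → natS eS ≈s (oneMinusT^ 1 ⋆ (natS eP ⋆ natS eQ))
    lattice⇒product lattice = decompose⇒count (lattice⇒decompose lattice)

    product⇒lattice : natS eS ≈s (oneMinusT^ 1 ⋆ (natS eP ⋆ natS eQ)) → DualIsLattice P ⊎ DualIsLattice Q
    product⇒lattice eq = [ inj₁ , (λ G → [ inj₂ , (λ G′ → ⊥-elim (decompose⇒not-both (count⇒decompose eq) G G′)) ]′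
      (dualIsLattice? Q (Projection.latticeGenerators right))) ]′ (dualIsLattice? P latticeGenerators)

  -- Dimension

  LinInd : ∀ {n r} → (Fin r → Pt n) → Set
  LinInd {r = r} w = ∀ (c : Fin r → ℚ) → lincomb c w ≡ 0v → ∀ i → c i ≡ 0ℚ

  sum-punchIn : ∀ {s} (k : Fin (suc s)) (f : Fin (suc s) → ℚ) → sumℚ (suc s) f ≡ f k + sumℚ s (f ∘ punchIn k)
  sum-punchIn zero f = refl
  sum-punchIn {suc s} (suc k) f = trans (cong (f zero +_) (sum-punchIn k (f ∘ suc))) (swap (f zero) (f (suc k)) _)
    where
    swap : ∀ a b c → a + (b + c) ≡ b + (a + c)
    swap = solve-∀ ℚ-ring

  -- Gaussian elimination on the first coordinate: if it vanishes on all vectors, it is dropped;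
  -- otherwise a pivot `v k` clears it from the other vectors and is dropped along with it.
  dependent : ∀ r s → r ℕ.< s → (v : Fin s → Pt r) → Σ (Fin s → ℚ) λ c → (Σ (Fin s) λ i → c i ≢ 0ℚ) × lincomb c v ≡ 0v
  dependent zero (suc s) _ v = (λ _ → 1ℚ) , (zero , λ ()) , refl
  dependent (suc r) (suc s) (ℕ.s≤s r<s) v = [ zero-row , pivot ]′ (allOrSome (λ j → zero? (lookup (v j) zero)))
    where
    zero? : ∀ q → q ≡ 0ℚ ⊎ q ≢ 0ℚ
    zero? q with q ≟ 0ℚ
    ... | yes h = inj₁ h
    ... | no h = inj₂ h
    t : Fin (suc s) → Pt r
    t j = Vec.tail (v j)
    lookup-tail : ∀ {n} (x : Pt (suc n)) i → lookup x (suc i) ≡ lookup (Vec.tail x) i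
    lookup-tail (_ ∷ x) i = refl
    rows : ∀ c → sumℚ (suc s) (λ j → c j * lookup (v j) zero) ≡ 0ℚ → lincomb c t ≡ 0v → lincomb c v ≡ 0v
    rows c first rest = lookup-ext λ { zero → first ; (suc i) → trans (lookup∘tabulate _ i)
      (trans (trans (sum-cong (λ j → cong (c j *_) (lookup-tail (v j) i))) (sym (lookup∘tabulate (λ i → sumℚ (suc s) (λ j → c j * lookup (t j) i)) i)))
        (cong (λ x → lookup x i) rest)) }
    zero-row : (∀ j → lookup (v j) zero ≡ 0ℚ) → Σ (Fin (suc s) → ℚ) λ c → (Σ (Fin (suc s)) λ i → c i ≢ 0ℚ) × lincomb c v ≡ 0v
    zero-row h = let (c , nonzero , eq) = dependent r (suc s) (ℕₚ.m≤n⇒m≤1+n r<s) t in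
      c , nonzero , rows c (sum-zero (suc s) (λ j → trans (cong (c j *_) (h j)) (*-zeroʳ (c j)))) eq
    pivot : (Σ (Fin (suc s)) λ k → lookup (v k) zero ≢ 0ℚ) → Σ (Fin (suc s) → ℚ) λ c → (Σ (Fin (suc s)) λ i → c i ≢ 0ℚ) × lincomb c v ≡ 0v
    pivot (k , h≢0) with inverse h≢0
    ... | p , hp≡1 with dependent r s r<s (λ j → addmul (- (p * lookup (v (punchIn k j)) zero)) (t k) (t (punchIn k j)))
    ... | c′ , (i , nonzero) , eq = c , (punchIn k i , λ h → nonzero (trans (sym (c-off i)) h)) , rows c first rest
      where
      h : Fin s → ℚ
      h j = lookup (v (punchIn k j)) zero
      B = sumℚ s (λ j → c′ j * h j)
      -- `B` is the first coordinate of the combination of the other vectors and `p` the inverse of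
      -- that of the pivot, so the coefficient inserted at `k` cancels it.
      c : Fin (suc s) → ℚ
      c = insertAt c′ k (- (p * B))
      c-off : ∀ j → c (punchIn k j) ≡ c′ j
      c-off = insertAt-punchIn c′ k (- (p * B))
      expand : ∀ (f : Fin (suc s) → ℚ) → sumℚ (suc s) (λ j → c j * f j) ≡ - (p * B) * f k + sumℚ s (λ j → c′ j * f (punchIn k j))
      expand f = trans (sum-punchIn k (λ j → c j * f j)) (cong₂ _+_ (cong (_* f k) (insertAt-lookup c′ k (- (p * B))))
        (sum-cong (λ j → cong (_* f (punchIn k j)) (c-off j))))
      first : sumℚ (suc s) (λ j → c j * lookup (v j) zero) ≡ 0ℚ
      first = trans (expand (λ j → lookup (v j) zero)) (trans (regroup p B (lookup (v k) zero)) (trans (cong (λ x → - (x * B) + B) hp≡1) (cancel B)))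
        where
        regroup : ∀ p B h → - (p * B) * h + B ≡ - ((h * p) * B) + B
        regroup = solve-∀ ℚ-ring
        cancel : ∀ B → - (1ℚ * B) + B ≡ 0ℚ
        cancel = solve-∀ ℚ-ring
      rest : lincomb c t ≡ 0v
      rest = dot-ext λ w → begin
        w · lincomb c t
          ≡⟨ trans (dot-lincomb w c t) (expand (λ j → w · t j)) ⟩
        - (p * B) * (w · t k) + sumℚ s (λ j → c′ j * (w · t (punchIn k j)))
          ≡⟨ cong (_+ sumℚ s (λ j → c′ j * (w · t (punchIn k j)))) (trans (regroup p B (w · t k)) (sym (sum-*ˡ s (- p * (w · t k)) (λ j → c′ j * h j)))) ⟩
        sumℚ s (λ j → - p * (w · t k) * (c′ j * h j)) + sumℚ s (λ j → c′ j * (w · t (punchIn k j)))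
          ≡⟨ sym (sum-+ s (λ j → - p * (w · t k) * (c′ j * h j)) (λ j → c′ j * (w · t (punchIn k j)))) ⟩
        sumℚ s (λ j → - p * (w · t k) * (c′ j * h j) + c′ j * (w · t (punchIn k j)))
          ≡⟨ sum-cong (λ j → trans (factor p (w · t k) (c′ j) (h j) (w · t (punchIn k j)))
               (cong (c′ j *_) (sym (dot-addmul w (- (p * h j)) (t k) (t (punchIn k j)))))) ⟩
        sumℚ s (λ j → c′ j * (w · addmul (- (p * h j)) (t k) (t (punchIn k j))))
          ≡⟨ sym (dot-lincomb w c′ (λ j → addmul (- (p * h j)) (t k) (t (punchIn k j)))) ⟩
        w · lincomb c′ (λ j → addmul (- (p * h j)) (t k) (t (punchIn k j)))
          ≡⟨ cong (w ·_) eq ⟩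
        w · 0v ∎
        where
        open ≡-Reasoning
        regroup : ∀ p B x → - (p * B) * x ≡ - p * x * B
        regroup = solve-∀ ℚ-ring
        factor : ∀ p x c h y → - p * x * (c * h) + c * y ≡ c * (- (p * h) * x + y)
        factor = solve-∀ ℚ-ring

  -- Too many coefficient vectors with respect to `b` are dependent, and their relation carries over
  -- to `w`.
  steinitz : ∀ {n r s} (b : Fin r → Pt n) (w : Fin s → Pt n) → (∀ j → InSpanOf b (w j)) → LinInd w → s ℕ.≤ r
  steinitz {r = r} {s} b w span indep with ℕₚ.≤-<-connex s r
  ... | inj₁ s≤r = s≤r
  ... | inj₂ r<s with dependent r s r<s (λ j → tabulate (proj₁ (span j)))
  ... | c , (i , nonzero) , eq = ⊥-elim (nonzero (indep c relation i))
    where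
    relation : lincomb c w ≡ 0v
    relation = trans (lincomb-cong {c = c} {v = w} (λ _ → refl) (λ j → sym (proj₂ (span j)))) (trans (lincomb-lincomb c (λ j → proj₁ (span j)) b)
      (dot-ext λ u → trans (dot-lincomb u (λ i → sumℚ s (λ j → c j * proj₁ (span j) i)) b) (trans (sum-zero r (λ i →
        trans (cong (_* (u · b i)) (trans (sum-cong (λ j → cong (c j *_) (sym (lookup∘tabulate (proj₁ (span j)) i))))
          (trans (sym (lookup∘tabulate (λ i → sumℚ s (λ j → c j * lookup (tabulate (proj₁ (span j))) i)) i))
            (trans (cong (λ x → lookup x i) eq) (lookup∘tabulate (λ _ → 0ℚ) i))))) (*-zeroˡ (u · b i)))) (sym (dot-0v u)))))

  LinInd-sub : ∀ {n r s} → r ℕ.≤′ s → (b : Fin s → Pt n) → LinInd b → Σ (Fin r → Fin s) λ σ → LinInd (b ∘ σ)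
  LinInd-sub ℕ.≤′-refl b indep = id , indep
  LinInd-sub {n} (ℕ.≤′-step {s} le) b indep = let (σ , h) = LinInd-sub le (b ∘ suc) tail-indep in suc ∘ σ , h
    where
    tail-indep : LinInd (b ∘ suc)
    tail-indep c eq i = indep (prepend0 c) (trans (lincomb-prepend0 c b) eq) (suc i)

  -- Fredholm decides whether the next vector lies in the span of those already chosen. If not, its
  -- functional `d` vanishes on them and shows that the new coefficient is zero in any relation.
  independent-subfamily : ∀ {n} m (v : Fin m → Pt n) → Σ ℕ λ r → Σ (Fin r → Fin m) λ σ → LinInd (v ∘ σ) × (∀ k → InSpanOf (v ∘ σ) (v k))
  independent-subfamily zero v = 0 , (λ ()) , (λ _ _ ()) , λ ()
  independent-subfamily {n} (suc m) v =
    let (r , σ , indep , span) = independent-subfamily m (v ∘ suc) in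
    [ (λ inside → r , suc ∘ σ , indep , λ { zero → inside ; (suc k) → span k })
    , (λ (d , d⊥ , pos) → suc r , extend r σ , extend-indep r σ indep d d⊥ pos , λ { zero → head-span r σ ; (suc k) → tail-span r σ (span k) }) ]′
    (fredholm r (v ∘ suc ∘ σ) (v zero))
    where
    extend : ∀ r → (Fin r → Fin m) → Fin (suc r) → Fin (suc m)
    extend r σ zero = zero
    extend r σ (suc i) = suc (σ i)
    head-span : ∀ r σ → InSpanOf (v ∘ extend r σ) (v zero)
    head-span r σ = point zero 1ℚ , trans (lincomb-point zero 1ℚ (v ∘ extend r σ)) (dot-ext λ w → trans (dot-*v w 1ℚ (v zero)) (*-identityˡ (w · v zero)))
    tail-span : ∀ r σ {x} → InSpanOf (v ∘ suc ∘ σ) x → InSpanOf (v ∘ extend r σ) x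
    tail-span r σ (u , eq) = prepend0 u , trans (lincomb-prepend0 u (v ∘ extend r σ)) eq
    extend-indep : ∀ r σ → LinInd (v ∘ suc ∘ σ) → ∀ d → (∀ k → d · v (suc (σ k)) ≡ 0ℚ) → 0ℚ < d · v zero → LinInd (v ∘ extend r σ)
    extend-indep r σ indep d d⊥ pos c eq = λ { zero → c₀≡0 ; (suc i) → indep (c ∘ suc) rest i }
      where
      c₀≡0 : c zero ≡ 0ℚ
      c₀≡0 = *-cancelˡ-≡0 (λ h → <-irrefl (sym h) pos) (trans (*-comm (d · v zero) (c zero)) (trans (sym (+-identityʳ (c zero * (d · v zero))))
        (trans (cong (c zero * (d · v zero) +_) (sym (sum-zero r (λ j → trans (cong (c (suc j) *_) (d⊥ j)) (*-zeroʳ (c (suc j)))))))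
          (trans (sym (dot-lincomb d c (v ∘ extend r σ))) (trans (cong (d ·_) eq) (dot-0v d))))))
      rest : lincomb (c ∘ suc) (v ∘ suc ∘ σ) ≡ 0v
      rest = trans (dot-ext λ w → trans (dot-lincomb w (c ∘ suc) (v ∘ suc ∘ σ)) (trans (sym (+-identityˡ (sumℚ r (λ j → c (suc j) * (w · v (suc (σ j)))))))
        (trans (cong (_+ sumℚ r (λ j → c (suc j) * (w · v (suc (σ j))))) (sym (trans (cong (_* (w · v zero)) c₀≡0) (*-zeroˡ (w · v zero)))))
          (sym (dot-lincomb w c (v ∘ extend r σ)))))) eq

  gen∈P : ∀ {n} (P : Polytope n) k → gens P k ∈P P
  gen∈P P k = point k 1ℚ , point-nonneg k (<⇒≤ 0<1) , sum-point k 1ℚ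
    , trans (lincomb-point k 1ℚ (gens P)) (dot-ext λ w → trans (dot-*v w 1ℚ (gens P k)) (*-identityˡ (w · gens P k)))

  ∈P-⊕ʳ : ∀ {n} (P Q : Polytope n) {x} → 0v ∈P P → x ∈P Q → x ∈P (P ⊕ Q)
  ∈P-⊕ʳ P Q {x} 0∈P x∈ = dilate⇒∈P (P ⊕ Q) (∈P-⊕ˡ P Q 0∈P) (subst₂ (Dilate (P ⊕ Q)) (+-identityˡ 1ℚ)
    (dot-ext λ w → trans (dot-addmul w 1ℚ 0v x) (trans (cong (λ t → 1ℚ * t + w · x) (dot-0v w)) (1*0+ (w · x))))
    (dilate-⊕ P Q (0-dilate P) (∈P⇒dilate Q x∈)))

  -- The basis vectors are taken inside `P`, so that together with the origin they span a simplex in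
  -- `P`.
  record Basis {n} (P : Polytope n) (r : ℕ) : Set where
    field
      basis : Fin r → Pt n
      independent : LinInd basis
      inside : ∀ i → basis i ∈P P
      spans : ∀ {x} → InSpan P x → InSpanOf basis x

  basis-exists : ∀ {n} (P : Polytope n) → Σ ℕ (Basis P)
  basis-exists P = let (r , σ , indep , span) = independent-subfamily (m P) (gens P) in r , record
    { basis = gens P ∘ σ ; independent = indep ; inside = λ i → gen∈P P (σ i)
    ; spans = λ { (c , refl) → (λ j → sumℚ (m P) (λ k → c k * proj₁ (span k) j))
        , trans (sym (lincomb-lincomb c (λ k → proj₁ (span k)) (gens P ∘ σ))) (lincomb-cong {c = c} {w = gens P} (λ _ → refl) (λ k → proj₂ (span k))) } }

  -- Since `P` contains the origin, its affine dimension is that of lin P. Differences from `w zero`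
  -- are independent in lin P, which bounds `d`; the origin with `d + 1` basis vectors would be a
  -- simplex too large for `P`, which bounds `r`.
  dim≡basis : ∀ {n} (P : Polytope n) {d r} → 0v ∈P P → IsDim P d → Basis P r → d ≡ r
  dim≡basis {n} P {d} {r} 0∈P ((w , w∈ , affine) , maximal) B = ℕₚ.≤-antisym d≤r r≤d
    where
    open Basis B
    difference : Fin d → Pt n
    difference i = addmul (- 1ℚ) (w zero) (w (suc i))
    difference-span : ∀ i → InSpanOf basis (difference i)
    difference-span i = let (u , u-eq) = spans (in-span zero) ; (v , v-eq) = spans (in-span (suc i)) in
      (λ j → - 1ℚ * u j + v j) , trans (lincomb-addmul (- 1ℚ) u v basis) (cong₂ (addmul (- 1ℚ)) u-eq v-eq)
      where
      in-span : ∀ i → InSpan P (w i)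
      in-span i = proj₁ (w∈ i) , proj₂ (proj₂ (proj₂ (w∈ i)))
    difference-indep : LinInd difference
    difference-indep c eq i = affine c′ sum≡0 combination (suc i)
      where
      c′ : Fin (suc d) → ℚ
      c′ zero = - sumℚ d c
      c′ (suc i) = c i
      sum≡0 : sumℚ (suc d) c′ ≡ 0ℚ
      sum≡0 = +-inverseˡ (sumℚ d c)
      combination : lincomb c′ w ≡ 0v
      combination = trans (dot-ext λ u → sym (trans (dot-lincomb u c difference) (trans
        (sum-cong (λ i → trans (cong (c i *_) (dot-addmul u (- 1ℚ) (w zero) (w (suc i)))) (expand (c i) (u · w zero) (u · w (suc i)))))
        (trans (sum-+ d (λ i → - (u · w zero) * c i) (λ i → c i * (u · w (suc i)))) (trans
          (cong (_+ sumℚ d (λ i → c i * (u · w (suc i)))) (trans (sum-*ˡ d (- (u · w zero)) c) (flip (u · w zero) (sumℚ d c))))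
          (sym (dot-lincomb u c′ w))))))) eq
        where
        expand : ∀ c x y → c * (- 1ℚ * x + y) ≡ - x * c + c * y
        expand = solve-∀ ℚ-ring
        flip : ∀ x s → - x * s ≡ - s * x
        flip = solve-∀ ℚ-ring
    d≤r : d ℕ.≤ r
    d≤r = steinitz basis difference difference-span difference-indep
    r≤d : r ℕ.≤ d
    r≤d with ℕₚ.≤-<-connex r d
    ... | inj₁ le = le
    ... | inj₂ lt with LinInd-sub (ℕₚ.≤⇒≤′ lt) basis independent
    ... | σ , indep = ⊥-elim (maximal simplex (λ { zero → 0∈P ; (suc i) → inside (σ i) }) affine-simplex)
      where
      simplex : Fin (suc (suc d)) → Pt n
      simplex zero = 0v
      simplex (suc i) = basis (σ i)
      affine-simplex : AffInd simplex
      affine-simplex c sum≡0 eq = λ { zero → trans (sym (+-identityʳ (c zero))) (trans (cong (c zero +_) (sym (sum-zero (suc d) tail-zero))) sum≡0) ; (suc i) → tail-zero i }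
        where
        tail-zero : ∀ i → c (suc i) ≡ 0ℚ
        tail-zero = indep (c ∘ suc) (trans (dot-ext λ u → sym (trans (dot-lincomb u c simplex) (trans
          (cong (_+ sumℚ (suc d) (λ i → c (suc i) * (u · basis (σ i)))) (trans (cong (c zero *_) (dot-0v u)) (*-zeroʳ (c zero))))
          (trans (+-identityˡ (sumℚ (suc d) (λ i → c (suc i) * (u · basis (σ i))))) (sym (dot-lincomb u (c ∘ suc) (basis ∘ σ))))))) eq)

  lincomb-join-↑ : ∀ {n r s} (c : Fin r → ℚ) (d : Fin s → ℚ) (a : Fin r → Pt n) (b : Fin s → Pt n) →
    lincomb ([ c , d ]′ ∘ splitAt r) (join a b) ≡ addmul 1ℚ (lincomb c a) (lincomb d b)
  lincomb-join-↑ {r = r} {s} c d a b = trans (lincomb-join ([ c , d ]′ ∘ splitAt r) a b) (cong₂ (addmul 1ℚ)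
    (lincomb-cong {d = c} {v = a} (λ k → cong [ c , d ]′ (splitAt-↑ˡ r k s)) (λ _ → refl))
    (lincomb-cong {d = d} {v = b} (λ k → cong [ c , d ]′ (splitAt-↑ʳ r s k)) (λ _ → refl)))

  -- Independence: `π` keeps the first half of a relation and kills the second, so each half
  -- vanishes by itself.
  basis-⊕ : ∀ {n} (P Q : Polytope n) → Splitting P Q → ∀ {r s} → Basis P r → Basis Q s → Basis (P ⊕ Q) (r ℕ.+ s)
  basis-⊕ {n} P Q S {r} {s} BP BQ = record
    { basis = join BP.basis BQ.basis
    ; independent = independent
    ; inside = inside
    ; spans = λ { (c , refl) →
        let (u , u-eq) = BP.spans ((λ k → c (k ↑ˡ m Q)) , refl) ; (v , v-eq) = BQ.spans ((λ k → c (m P ↑ʳ k)) , refl) in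
        [ u , v ]′ ∘ splitAt r , trans (lincomb-join-↑ u v BP.basis BQ.basis) (trans (cong₂ (addmul 1ℚ) u-eq v-eq) (sym (lincomb-join c (gens P) (gens Q)))) } }
    where
    module BP = Basis BP
    module BQ = Basis BQ
    open Splitting S
    open Projection left
    inside : ∀ i → join BP.basis BQ.basis i ∈P (P ⊕ Q)
    inside i with splitAt r i
    ... | inj₁ j = ∈P-⊕ˡ P Q (BP.inside j)
    ... | inj₂ j = ∈P-⊕ʳ P Q 0∈P (BQ.inside j)
    ∈P⇒span : ∀ (R : Polytope n) {x} → x ∈P R → InSpan R x
    ∈P⇒span R (c , _ , _ , eq) = c , eq
    independent : LinInd (join BP.basis BQ.basis)
    independent c eq = λ k → by-cases k (splitAt r k) refl
      where
      c₁ : Fin r → ℚ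
      c₁ i = c (i ↑ˡ s)
      c₂ : Fin s → ℚ
      c₂ j = c (r ↑ʳ j)
      x = lincomb c₁ BP.basis
      y = lincomb c₂ BQ.basis
      x+y≡0 : addmul 1ℚ x y ≡ 0v
      x+y≡0 = trans (sym (lincomb-join c BP.basis BQ.basis)) eq
      πx : act π x ≡ x
      πx = trans (act-lincomb π c₁ BP.basis) (lincomb-cong {c = c₁} {w = BP.basis} (λ _ → refl) (λ i → fixes-span (∈P⇒span P (BP.inside i))))
      πy : act π y ≡ 0v
      πy = trans (act-lincomb π c₂ BQ.basis) (dot-ext λ w → trans (dot-lincomb w c₂ (act π ∘ BQ.basis)) (trans (sum-zero s (λ j →
        trans (cong (c₂ j *_) (trans (cong (w ·_) (kills-span (∈P⇒span Q (BQ.inside j)))) (dot-0v w))) (*-zeroʳ (c₂ j)))) (sym (dot-0v w))))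
      x≡0 : x ≡ 0v
      x≡0 = trans (dot-ext λ w → trans (sym (1*+0 (w · x))) (trans (cong (1ℚ * (w · x) +_) (sym (dot-0v w))) (trans (sym (dot-addmul w 1ℚ x 0v))
        (cong (w ·_) (trans (cong₂ (addmul 1ℚ) (sym πx) (sym πy)) (sym (act-addmul π 1ℚ x y))))))) (trans (cong (act π) x+y≡0) (act-0v π))
      y≡0 : y ≡ 0v
      y≡0 = trans (dot-ext λ w → sym (trans (dot-addmul w 1ℚ x y) (trans (cong (λ t → 1ℚ * t + w · y) (trans (cong (w ·_) x≡0) (dot-0v w))) (1*0+ (w · y))))) x+y≡0
      by-cases : ∀ k → (t : Fin r ⊎ Fin s) → splitAt r k ≡ t → c k ≡ 0ℚ
      by-cases k (inj₁ i) h = trans (cong c (sym (splitAt⁻¹-↑ˡ h))) (BP.independent c₁ x≡0 i)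
      by-cases k (inj₂ j) h = trans (cong c (sym (splitAt⁻¹-↑ʳ h))) (BQ.independent c₂ y≡0 j)

  dim-⊕ : ∀ {n} (P Q : Polytope n) → Splitting P Q → ∀ {p q s} → IsDim P p → IsDim Q q → IsDim (P ⊕ Q) s → s ≡ p ℕ.+ q
  dim-⊕ P Q S dP dQ dS =
    let (r , BP) = basis-exists P ; (t , BQ) = basis-exists Q in
    trans (dim≡basis (P ⊕ Q) (∈P-⊕ˡ P Q 0∈P) dS (basis-⊕ P Q S BP BQ))
      (sym (cong₂ ℕ._+_ (dim≡basis P 0∈P dP BP) (dim≡basis Q 0∈Q dQ BQ)))
    where open Splitting S

  -- Denominators

  hull-⊆ : ∀ {n} (V W : Polytope n) → (∀ k → gens V k ∈P W) → ∀ {x} → x ∈P V → x ∈P W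
  hull-⊆ V W h (c , c≥0 , sum≡1 , refl) = (λ j → sumℚ (m V) (λ k → c k * d k j))
    , (λ j → sum-nonneg (m V) (λ k → *-nonneg (c≥0 k) (proj₁ (proj₂ (h k)) j)))
    , trans (sym (sum-swap (m V) (m W) (λ k j → c k * d k j))) (trans (sum-cong (λ k → trans (sum-*ˡ (m W) (c k) (d k))
        (trans (cong (c k *_) (proj₁ (proj₂ (proj₂ (h k))))) (*-identityʳ (c k))))) sum≡1)
    , trans (sym (lincomb-lincomb c d (gens W))) (lincomb-cong {c = c} {w = gens V} (λ _ → refl) (λ k → proj₂ (proj₂ (proj₂ (h k)))))
    where
    d : Fin (m V) → Fin (m W) → ℚ
    d k = proj₁ (h k)

  samePoly : ∀ {n} (V W : Polytope n) → (∀ k → gens V k ∈P W) → (∀ k → gens W k ∈P V) → SamePoly V W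
  samePoly V W f g x = hull-⊆ V W f , hull-⊆ W V g

  samePoly-trans : ∀ {n} {U V W : Polytope n} → SamePoly U V → SamePoly V W → SamePoly U W
  samePoly-trans f g x = proj₁ (g x) ∘ proj₁ (f x) , proj₂ (f x) ∘ proj₂ (g x)

  ∈P-unscale : ∀ {n} (P : Polytope n) s t → s * t ≡ 1ℚ → ∀ {x} → (t *v x) ∈P scale t P → x ∈P P
  ∈P-unscale P s t st≡1 {x} x∈ = let (c , c≥0 , sum≡1 , eq) = ∈P-scale (scale t P) s x∈ in
    c , c≥0 , sum≡1 , trans (lincomb-cong {c = c} {v = gens P} (λ _ → refl) (λ k → sym (*v-*v s t st≡1 (gens P k)))) (trans eq (*v-*v s t st≡1 x))

  samePoly-scale : ∀ {n} (P Q : Polytope n) s → SamePoly P Q → SamePoly (scale s P) (scale s Q)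
  samePoly-scale P Q s same = samePoly (scale s P) (scale s Q)
    (λ k → ∈P-scale Q s (proj₁ (same (gens P k)) (gen∈P P k)))
    (λ k → ∈P-scale P s (proj₂ (same (gens Q k)) (gen∈P Q k)))

  samePoly-unscale : ∀ {n} (P W : Polytope n) s t → s * t ≡ 1ℚ → SamePoly (scale s P) W → SamePoly P (scale t W)
  samePoly-unscale P W s t st≡1 same x = forth , back
    where
    ts≡1 : t * s ≡ 1ℚ
    ts≡1 = trans (*-comm t s) st≡1
    forth : x ∈P P → x ∈P scale t W
    forth x∈ = subst (_∈P scale t W) (*v-*v t s ts≡1 x) (∈P-scale W t (proj₁ (same (s *v x)) (∈P-scale P s x∈)))
    back : x ∈P scale t W → x ∈P P
    back x∈ = ∈P-unscale P t s ts≡1 (proj₂ (same (s *v x)) (∈P-unscale W s t st≡1 (subst (_∈P scale t W) (sym (*v-*v t s ts≡1 x)) x∈)))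

  -- Expresses, for d ≥ 1, that d P is a lattice polytope by points generating `P` itself, so that
  -- different multiples can be compared on one polytope.
  record LatticeAt {n} (P : Polytope n) (d : ℕ) : Set where
    constructor latticeAt
    field
      size : ℕ
      vertex : Fin size → Pt n
      same : SamePoly P (poly size vertex)
      integral : ∀ k i → IsInt (ℕtoℚ d * lookup (vertex k) i)

  reciprocal : ∀ d → 1 ℕ.≤ d → Σ ℚ λ t → (ℤ.+ d / 1) * t ≡ 1ℚ
  reciprocal d d≥1 = let (t , _ , eq) = inverse-pos (ℕtoℚ-pos d≥1) in t , trans (cong (_* t) (sym (ℕtoℚ-def d))) eq

  scale⇒latticeAt : ∀ {n} (P : Polytope n) d → 1 ℕ.≤ d → IsLatticePolytope (scale (ℤ.+ d / 1) P) → LatticeAt P d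
  scale⇒latticeAt P d d≥1 (r , w , same) with reciprocal d d≥1
  ... | t , qt≡1 = latticeAt r (λ k → t *v toℚv (w k)) (samePoly-unscale P (poly r (toℚv ∘ w)) (ℤ.+ d / 1) t qt≡1 same)
    λ k i → subst IsInt (sym (trans (cong₂ _*_ (ℕtoℚ-def d) (lookup-map i (t *_) (toℚv (w k)))) (trans (sym (*-assoc (ℤ.+ d / 1) t (lookup (toℚv (w k)) i)))
      (trans (cong (_* lookup (toℚv (w k)) i) qt≡1) (*-identityˡ (lookup (toℚv (w k)) i)))))) (toℚv-isInt (w k) i)

  latticeAt⇒scale : ∀ {n} (P : Polytope n) d → 1 ℕ.≤ d → LatticeAt P d → IsLatticePolytope (scale (ℤ.+ d / 1) P)
  latticeAt⇒scale {n} P d d≥1 (latticeAt r v same int) = r , proj₁ ∘ w , samePoly-trans {U = scale q P} {V = scale q V} {W = poly r (toℚv ∘ proj₁ ∘ w)}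
    (samePoly-scale P V q same)
    (samePoly (scale q V) (poly r (toℚv ∘ proj₁ ∘ w)) (λ k → subst (_∈P poly r (toℚv ∘ proj₁ ∘ w)) (proj₂ (w k)) (gen∈P (poly r (toℚv ∘ proj₁ ∘ w)) k))
      (λ k → subst (_∈P scale q V) (sym (proj₂ (w k))) (gen∈P (scale q V) k)))
    where
    q = ℤ.+ d / 1
    V = poly r v
    w : ∀ k → Σ (LPt n) λ z → toℚv z ≡ q *v v k
    w k = toLPt (q *v v k) (λ i → subst IsInt (trans (cong (_* lookup (v k) i) (ℕtoℚ-def d)) (sym (lookup-map i (q *_) (v k)))) (int k i))

  latticeAt-∣ : ∀ {n} {P : Polytope n} {a b} → a ∣ b → LatticeAt P a → LatticeAt P b
  latticeAt-∣ {a = a} (divides c refl) (latticeAt r v same int) = latticeAt r v same λ k i →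
    subst IsInt (sym (trans (cong (_* lookup (v k) i) (ℕtoℚ-* c a)) (*-assoc (ℕtoℚ c) (ℕtoℚ a) (lookup (v k) i)))) (isInt-* (ℕtoℚ-isInt c) (int k i))

  latticeAt-⊕ : ∀ {n} (P Q : Polytope n) {d} → 0v ∈P P → LatticeAt P d → LatticeAt Q d → LatticeAt (P ⊕ Q) d
  latticeAt-⊕ P Q {d} 0∈P (latticeAt r v same int) (latticeAt s u same′ int′) = latticeAt (r ℕ.+ s) (join v u)
    (samePoly (P ⊕ Q) (V ⊕ U) forth back) integral
    where
    V = poly r v
    U = poly s u
    forth : ∀ k → gens (P ⊕ Q) k ∈P (V ⊕ U)
    forth k with splitAt (m P) k
    ... | inj₁ i = ∈P-⊕ˡ V U (proj₁ (same (gens P i)) (gen∈P P i))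
    ... | inj₂ j = ∈P-⊕ʳ V U (proj₁ (same 0v) 0∈P) (proj₁ (same′ (gens Q j)) (gen∈P Q j))
    back : ∀ k → gens (V ⊕ U) k ∈P (P ⊕ Q)
    back k with splitAt r k
    ... | inj₁ i = ∈P-⊕ˡ P Q (proj₂ (same (v i)) (gen∈P V i))
    ... | inj₂ j = ∈P-⊕ʳ P Q 0∈P (proj₂ (same′ (u j)) (gen∈P U j))
    integral : ∀ k i → IsInt (ℕtoℚ d * lookup (join v u k) i)
    integral k i with splitAt r k
    ... | inj₁ j = int j i
    ... | inj₂ j = int′ j i

  -- Since P contains the origin, it is the projection of R, which stands for P ⊕ Q seen from either summand.
  latticeAt-project : ∀ {n} (P Q R : Polytope n) {d} → Projection P Q → 0v ∈P P → (∀ {x} → x ∈P P → x ∈P R) →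
    (∀ {x} → x ∈P R → Σ ℚ λ s → Σ (Pt n) λ p → Σ (Pt n) λ q → s ≤ 1ℚ × Dilate P s p × InSpan Q q × x ≡ addmul 1ℚ p q) →
    LatticeAt R d → LatticeAt P d
  latticeAt-project {n} P Q R {d} proj 0∈P include decompose (latticeAt r v same int) = latticeAt r (act π ∘ v)
    (λ x → forth x , hull-⊆ (poly r (act π ∘ v)) P (λ k → project (proj₂ (same (v k)) (gen∈P (poly r v) k)))) integral
    where
    open Projection proj
    forth : ∀ x → x ∈P P → x ∈P poly r (act π ∘ v)
    forth x x∈ = let (c , c≥0 , sum≡1 , eq) = proj₁ (same x) (include x∈) in
      c , c≥0 , sum≡1 , trans (sym (act-lincomb π c v)) (trans (cong (act π) eq) (fixes-span (dilate⇒span P (∈P⇒dilate P x∈))))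
    project : ∀ {x} → x ∈P R → act π x ∈P P
    project {x} x∈ = from (decompose x∈)
      where
      from : (Σ ℚ λ s → Σ (Pt n) λ p → Σ (Pt n) λ q → s ≤ 1ℚ × Dilate P s p × InSpan Q q × x ≡ addmul 1ℚ p q) → act π x ∈P P
      from (s , p , q , s≤1 , dp , q∈ , eq) = subst (_∈P P) (sym (trans (cong (act π) eq) (trans (act-addmul π 1ℚ p q)
        (trans (cong₂ (addmul 1ℚ) (fixes-span (dilate⇒span P dp)) (kills-span q∈))
          (dot-ext λ w → trans (dot-addmul w 1ℚ p 0v) (trans (cong (1ℚ * (w · p) +_) (dot-0v w)) (1*+0 (w · p))))))))
        (dilate⇒∈P P 0∈P (dilate-mono P s≤1 dp))
    integral : ∀ k i → IsInt (ℕtoℚ d * lookup (act π (v k)) i)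
    integral k i = subst IsInt (trans (lookup-act π (ℕtoℚ d *v v k) i) (trans (dot-*v (row π i) (ℕtoℚ d) (v k)) (cong (ℕtoℚ d *_) (sym (lookup-act π (v k) i)))))
      (act-isInt π {ℕtoℚ d *v v k} (λ j → subst IsInt (sym (lookup-map j (ℕtoℚ d *_) (v k))) (int k j)) i)

  summand-≤-sum : ∀ {r} {d : Fin (suc r) → ℚ} → (∀ i → 0ℚ ≤ d i) → ∀ k → d k ≤ sumℚ (suc r) d
  summand-≤-sum {r} {d} d≥0 k = subst₂ _≤_ (+-identityʳ (d k)) (sym (sum-punchIn k d))
    (+-monoʳ-≤ (d k) (sum-nonneg r (λ i → d≥0 (punchIn k i))))

  sole-generator : ∀ {n r} (v : Fin (suc r) → Pt n) k (d : Fin (suc r) → ℚ) → (∀ i → 0ℚ ≤ d i) → sumℚ (suc r) d ≡ 1ℚ → d k ≡ 1ℚ → lincomb d v ≡ v k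
  sole-generator {r = r} v k d d≥0 sum≡1 dk≡1 = dot-ext λ w → trans (dot-lincomb w d v) (trans (sum-punchIn k (λ i → d i * (w · v i)))
    (trans (cong₂ _+_ (trans (cong (_* (w · v k)) dk≡1) (*-identityˡ (w · v k)))
      (sum-zero r (λ i → trans (cong (_* (w · v (punchIn k i))) (others i)) (*-zeroˡ (w · v (punchIn k i)))))) (+-identityʳ (w · v k))))
    where
    others : ∀ i → d (punchIn k i) ≡ 0ℚ
    others = sum-nonneg-≤0 r (λ i → d≥0 (punchIn k i)) (≤-reflexive (trans (isolateʳ (d k) (sumℚ r (d ∘ punchIn k)))
      (trans (cong₂ _-_ (trans (sym (sum-punchIn k d)) sum≡1) dk≡1) (+-inverseʳ 1ℚ))))

  -- Otherwise v k would be a vertex of the common hull, hence one of the u j.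
  redundant : ∀ {n r s} (v : Fin (suc r) → Pt n) (u : Fin s → Pt n) k → v k ∈P poly s u → (∀ j → u j ∈P poly (suc r) v) →
    (∀ j → v k ≢ u j) → v k ∈P poly r (v ∘ punchIn k)
  redundant {n} {r} {s} v u k (c , c≥0 , sum-c , c-eq) u∈ distinct = [ shrink , (λ h → ⊥-elim (sole h)) ]′ (below? (κ k))
    where
    d : Fin s → Fin (suc r) → ℚ
    d j = proj₁ (u∈ j)
    d≥0 : ∀ j i → 0ℚ ≤ d j i
    d≥0 j = proj₁ (proj₂ (u∈ j))
    sum-d : ∀ j → sumℚ (suc r) (d j) ≡ 1ℚ
    sum-d j = proj₁ (proj₂ (proj₂ (u∈ j)))
    d-eq : ∀ j → lincomb (d j) v ≡ u j
    d-eq j = proj₂ (proj₂ (proj₂ (u∈ j)))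
    -- Writing `v k` through `u` and each `u j` back through `v` represents `v k` by a family
    -- containing it. If its own weight `κ k` is below 1, the equation can be solved for `v k`;
    -- otherwise every `u j` of positive weight equals `v k`.
    κ : Fin (suc r) → ℚ
    κ i = sumℚ s (λ j → c j * d j i)
    κ≥0 : ∀ i → 0ℚ ≤ κ i
    κ≥0 i = sum-nonneg s (λ j → *-nonneg (c≥0 j) (d≥0 j i))
    sum-κ : sumℚ (suc r) κ ≡ 1ℚ
    sum-κ = trans (sym (sum-swap s (suc r) (λ j i → c j * d j i))) (trans (sum-cong (λ j → trans (sum-*ˡ (suc r) (c j) (d j))
      (trans (cong (c j *_) (sum-d j)) (*-identityʳ (c j))))) sum-c)
    κ-eq : lincomb κ v ≡ v k
    κ-eq = trans (sym (lincomb-lincomb c d v)) (trans (lincomb-cong {c = c} {w = u} (λ _ → refl) d-eq) c-eq)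
    below? : ∀ q → q < 1ℚ ⊎ 1ℚ ≤ q
    below? q with 1ℚ ≤? q
    ... | yes h = inj₂ h
    ... | no h = inj₁ (≰⇒> h)
    shrink : κ k < 1ℚ → v k ∈P poly r (v ∘ punchIn k)
    shrink κ<1 with inverse-pos (<⇒0<- κ<1)
    ... | t , t>0 , gap = (λ i → t * κ (punchIn k i)) , (λ i → *-nonneg (<⇒≤ t>0) (κ≥0 (punchIn k i)))
      , trans (sum-*ˡ r t (κ ∘ punchIn k)) (trans (cong (t *_) (trans (isolateʳ (κ k) (sumℚ r (κ ∘ punchIn k)))
          (cong (_- κ k) (trans (sym (sum-punchIn k κ)) sum-κ)))) (trans (*-comm t (1ℚ - κ k)) gap))
      , trans (lincomb-*v t (κ ∘ punchIn k) (v ∘ punchIn k)) (dot-ext λ w → trans (dot-*v w t (lincomb (κ ∘ punchIn k) (v ∘ punchIn k)))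
          (trans (cong (t *_) (trans (dot-lincomb w (κ ∘ punchIn k) (v ∘ punchIn k)) (trans (isolateʳ (κ k * (w · v k)) (sumℚ r (λ i → κ (punchIn k i) * (w · v (punchIn k i)))))
            (cong (_- κ k * (w · v k)) (trans (sym (sum-punchIn k (λ i → κ i * (w · v i)))) (trans (sym (dot-lincomb w κ v)) (cong (w ·_) κ-eq)))))))
            (trans (factor t (κ k) (w · v k)) (trans (cong (_* (w · v k)) gap) (*-identityˡ (w · v k))))))
      where
      factor : ∀ t κ x → t * (x - κ * x) ≡ (1ℚ - κ) * t * x
      factor = solve-∀ ℚ-ring
    sole : 1ℚ ≤ κ k → ⊥
    sole 1≤κ = 1≢0 (trans (sym sum-c) (sum-zero s c-zero))
      where
      d≤1 : ∀ j → d j k ≤ 1ℚ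
      d≤1 j = subst (d j k ≤_) (sum-d j) (summand-≤-sum (d≥0 j) k)
      slack : ∀ j → c j * (1ℚ - d j k) ≡ 0ℚ
      slack = sum-nonneg-≤0 s (λ j → *-nonneg (c≥0 j) (≤⇒0≤- (d≤1 j))) (≤-trans (≤-reflexive total) nonpos)
        where
        total : sumℚ s (λ j → c j * (1ℚ - d j k)) ≡ 1ℚ - κ k
        total = trans (sum-cong (λ j → expand (c j) (d j k))) (trans (sum-+ s c (λ j → - 1ℚ * (c j * d j k)))
          (cong₂ _+_ sum-c (trans (sum-*ˡ s (- 1ℚ) (λ j → c j * d j k)) (-1*-≡- (κ k)))))
          where
          expand : ∀ c d → c * (1ℚ - d) ≡ c + - 1ℚ * (c * d)
          expand = solve-∀ ℚ-ring
        nonpos : 1ℚ - κ k ≤ 0ℚ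
        nonpos = subst (1ℚ - κ k ≤_) (+-inverseʳ (κ k)) (+-monoˡ-≤ (- κ k) 1≤κ)
      c-zero : ∀ j → c j ≡ 0ℚ
      c-zero j with 1ℚ - d j k ≤? 0ℚ
      ... | yes h = ⊥-elim (distinct j (trans (sym (sole-generator v k (d j) (d≥0 j) (sum-d j) (≤-antisym (d≤1 j) (0≤⇒1≤ h)))) (d-eq j)))
        where
        0≤⇒1≤ : ∀ {a} → 1ℚ - a ≤ 0ℚ → 1ℚ ≤ a
        0≤⇒1≤ {a} h = 0≤-⇒≤ (subst (0ℚ ≤_) (flip a) (neg-nonneg h))
          where
          flip : ∀ a → - (1ℚ - a) ≡ a - 1ℚ
          flip = solve-∀ ℚ-ring
      ... | no h = *-cancelˡ-≡0 (λ eq → h (≤-reflexive eq)) (trans (*-comm (1ℚ - d j k) (c j)) (slack j))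

  -- Both families contain every vertex of P, so v can be thinned out to points of u.
  prune : ∀ {n} (P : Polytope n) r (v : Fin r → Pt n) s (u : Fin s → Pt n) → SamePoly P (poly r v) → SamePoly P (poly s u) →
    Σ ℕ λ r′ → Σ (Fin r′ → Fin r) λ σ → SamePoly P (poly r′ (v ∘ σ)) × (∀ k → Σ (Fin s) λ j → v (σ k) ≡ u j)
  prune P zero v s u same same′ = 0 , id , same , λ ()
  prune {n} P (suc r) v s u same same′ = [ (λ h → suc r , id , same , h) , remove ]′ (allOrSome (λ k → among? (v k)))
    where
    among? : ∀ x → (Σ (Fin s) λ j → x ≡ u j) ⊎ (∀ j → x ≢ u j)
    among? x = [ inj₂ , inj₁ ]′ (allOrSome (λ j → compare (≡-dec _≟_ x (u j))))
      where
      compare : ∀ {A : Set} → Dec A → ¬ A ⊎ A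
      compare (yes a) = inj₂ a
      compare (no ¬a) = inj₁ ¬a
    remove : (Σ (Fin (suc r)) λ k → ∀ j → v k ≢ u j) →
      Σ ℕ λ r′ → Σ (Fin r′ → Fin (suc r)) λ σ → SamePoly P (poly r′ (v ∘ σ)) × (∀ k → Σ (Fin s) λ j → v (σ k) ≡ u j)
    remove (k , distinct) = let (r′ , σ , same″ , among) = prune P r (v ∘ punchIn k) s u
                                  (samePoly-trans {U = P} {V = poly (suc r) v} {W = poly r (v ∘ punchIn k)} same fewer) same′ in
      r′ , punchIn k ∘ σ , same″ , among
      where
      v∈P : ∀ i → v i ∈P P
      v∈P i = proj₂ (same (v i)) (gen∈P (poly (suc r) v) i)
      covered : ∀ i → v i ∈P poly r (v ∘ punchIn k)
      covered i with k ≟F i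
      ... | yes refl = redundant v u k (proj₁ (same′ (v k)) (v∈P k))
        (λ j → proj₁ (same (u j)) (proj₂ (same′ (u j)) (gen∈P (poly s u) j))) distinct
      ... | no k≢i = subst (λ j → v j ∈P poly r (v ∘ punchIn k)) (punchIn-punchOut k≢i) (gen∈P (poly r (v ∘ punchIn k)) (punchOut k≢i))
      fewer : SamePoly (poly (suc r) v) (poly r (v ∘ punchIn k))
      fewer = samePoly (poly (suc r) v) (poly r (v ∘ punchIn k)) covered (λ i → gen∈P (poly (suc r) v) (punchIn k i))

  bézout-combine : ∀ q x y g a b → g ℕ.+ y ℕ.* b ≡ x ℕ.* a →
    ℕtoℚ x * (ℕtoℚ a * q) + - (ℕtoℚ y * (ℕtoℚ b * q)) ≡ ℕtoℚ g * q
  bézout-combine q x y g a b eq = trans (regroup (ℕtoℚ x) (ℕtoℚ a) (ℕtoℚ y) (ℕtoℚ b) q) (trans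
    (cong (λ t → (t - ℕtoℚ y * ℕtoℚ b) * q) (trans (sym (ℕtoℚ-* x a)) (trans (cong ℕtoℚ (sym eq))
      (trans (ℕtoℚ-+ g (y ℕ.* b)) (cong (ℕtoℚ g +_) (ℕtoℚ-* y b))))))
    (cancel (ℕtoℚ g) (ℕtoℚ y * ℕtoℚ b) q))
    where
    regroup : ∀ x a y b q → x * (a * q) + - (y * (b * q)) ≡ (x * a - y * b) * q
    regroup = solve-∀ ℚ-ring
    cancel : ∀ g t q → (g + t - t) * q ≡ g * q
    cancel = solve-∀ ℚ-ring

  isInt-gcd : ∀ a b q → IsInt (ℕtoℚ a * q) → IsInt (ℕtoℚ b * q) → IsInt (ℕtoℚ (gcd a b) * q)
  isInt-gcd a b q ha hb with Bézout.identity (gcd-GCD a b)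
  ... | Bézout.+- x y eq = subst IsInt (bézout-combine q x y (gcd a b) a b eq)
    (isInt-+ (isInt-* (ℕtoℚ-isInt x) ha) (isInt-neg (isInt-* (ℕtoℚ-isInt y) hb)))
  ... | Bézout.-+ x y eq = subst IsInt (bézout-combine q y x (gcd a b) b a eq)
    (isInt-+ (isInt-* (ℕtoℚ-isInt y) hb) (isInt-neg (isInt-* (ℕtoℚ-isInt x) ha)))

  -- The points given for `a` and for `b` may differ. After pruning, each remaining point belongs to
  -- both families, so both multiples of its coordinates are integral, and Bézout applies.
  latticeAt-gcd : ∀ {n} (P : Polytope n) {a b} → LatticeAt P a → LatticeAt P b → LatticeAt P (gcd a b)
  latticeAt-gcd P {a} {b} (latticeAt r v same int) (latticeAt s u same′ int′) =
    let (r′ , σ , same″ , among) = prune P r v s u same same′ in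
    latticeAt r′ (v ∘ σ) same″ λ k i → isInt-gcd a b (lookup (v (σ k)) i) (int (σ k) i)
      (subst (λ x → IsInt (ℕtoℚ b * lookup x i)) (sym (proj₂ (among k))) (int′ (proj₁ (among k)) i))

  -- The admissible multiples are closed under gcd, so the least one divides all others.
  den-∣ : ∀ {n} (P : Polytope n) {a d} → IsDen P a → 1 ℕ.≤ d → LatticeAt P d → a ∣ d
  den-∣ P {a} {d} (a≥1 , lattice , minimal) d≥1 at with ℕₚ.≤-<-connex a (gcd d a)
  ... | inj₁ le = subst (_∣ d) (ℕₚ.≤-antisym (∣⇒≤ {{ℕ.>-nonZero a≥1}} (gcd[m,n]∣n d a)) le) (gcd[m,n]∣m d a)
  ... | inj₂ lt = ⊥-elim (minimal (gcd d a) g≥1 lt (latticeAt⇒scale P (gcd d a) g≥1 (latticeAt-gcd P at (scale⇒latticeAt P a a≥1 lattice))))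
    where
    g≥1 : 1 ℕ.≤ gcd d a
    g≥1 = ℕₚ.n≢0⇒n>0 (gcd[m,n]≢0 d a (inj₁ (ℕₚ.n>0⇒n≢0 d≥1)))

  -- The lcm is admissible for the union of the two families of points. Conversely each summand is a
  -- projection of the sum, so both denominators divide that of the sum.
  den-⊕ : ∀ {n} (P Q : Polytope n) → Splitting P Q → ∀ {a b d} → IsDen P a → IsDen Q b → IsDen (P ⊕ Q) d → d ≡ lcm a b
  den-⊕ P Q S {a} {b} {d} denP@(a≥1 , latP , _) denQ@(b≥1 , latQ , _) (d≥1 , latS , minimal) =
    ℕₚ.≤-antisym (ℕₚ.≮⇒≥ (λ lt → minimal (lcm a b) lcm≥1 lt (latticeAt⇒scale (P ⊕ Q) (lcm a b) lcm≥1 at-lcm)))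
      (∣⇒≤ {{ℕ.>-nonZero d≥1}} (lcm-least (den-∣ P denP d≥1 atP) (den-∣ Q denQ d≥1 atQ)))
    where
    open Splitting S
    lcm≥1 : 1 ℕ.≤ lcm a b
    lcm≥1 = ℕₚ.n≢0⇒n>0 λ eq → ℕₚ.<⇒≢ (ℕₚ.*-mono-≤ a≥1 b≥1) (sym (0∣⇒≡0 (subst (_∣ a ℕ.* b) eq
      (lcm-least (divides b (ℕₚ.*-comm a b)) (divides a refl)))))
    at-lcm : LatticeAt (P ⊕ Q) (lcm a b)
    at-lcm = latticeAt-⊕ P Q 0∈P (latticeAt-∣ (m∣lcm[m,n] a b) (scale⇒latticeAt P a a≥1 latP)) (latticeAt-∣ (n∣lcm[m,n] a b) (scale⇒latticeAt Q b b≥1 latQ))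
    at : LatticeAt (P ⊕ Q) d
    at = scale⇒latticeAt (P ⊕ Q) d d≥1 latS
    atP : LatticeAt P d
    atP = latticeAt-project P Q (P ⊕ Q) left 0∈P (∈P-⊕ˡ P Q) (λ x∈ →
      let (s , t , p , q , s≥0 , t≥0 , le , dp , dq , eq) = dilate-⊕⁻ P Q (∈P⇒dilate (P ⊕ Q) x∈) in
      s , p , q , ≤-trans (subst (_≤ s + t) (+-identityʳ s) (+-monoʳ-≤ s t≥0)) le , dp , dilate⇒span Q dq , eq) at
    atQ : LatticeAt Q d
    atQ = latticeAt-project Q P (P ⊕ Q) right 0∈Q (∈P-⊕ʳ P Q 0∈P) (λ x∈ →
      let (s , t , p , q , s≥0 , t≥0 , le , dp , dq , eq) = dilate-⊕⁻ P Q (∈P⇒dilate (P ⊕ Q) x∈) in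
      t , q , p , ≤-trans (subst (_≤ s + t) (+-identityˡ t) (+-monoˡ-≤ t s≥0)) le , dq , dilate⇒span P dp
      , trans eq (dot-ext λ w → trans (dot-addmul w 1ℚ p q) (trans (swap (w · p) (w · q)) (sym (dot-addmul w 1ℚ q p))))) at
      where
      swap : ∀ a b → 1ℚ * a + b ≡ 1ℚ * b + a
      swap = solve-∀ ℚ-ring

  den-lattice : ∀ {n} (P : Polytope n) {d} → IsDen P d → IsLatticePolytope P → d ≡ 1
  den-lattice P {d} (d≥1 , _ , minimal) (r , w , same) = ℕₚ.≤-antisym (ℕₚ.≮⇒≥ (λ lt → minimal 1 ℕₚ.≤-refl lt (latticeAt⇒scale P 1 ℕₚ.≤-refl
    (latticeAt r (toℚv ∘ w) same (λ k i → isInt-* (ℕtoℚ-isInt 1) (toℚv-isInt (w k) i)))))) d≥1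

-- From Ehrhart series to δ-polynomials.

module Delta where

  open import Defs using (Series; _≈s_; _⋆_; oneMinusT^; powS; natS; delta)
  open Series
  open import Data.Nat using (ℕ; suc; _+_)
  open import Data.Nat.LCM using (lcm)
  open import Data.Integer using (+_)
  open import Data.Product using (_×_; _,_)
  open import Relation.Binary.PropositionalEquality
  open import Algebra.Solver.CommutativeMonoid ⋆-commutativeMonoid using (solve; _⊜_; _⊕_)

  factor⇔ : ∀ K {f g F G : Series} → K 0 ≡ + 1 → F ≈s (K ⋆ f) → G ≈s (K ⋆ g) → (f ≈s g → F ≈s G) × (F ≈s G → f ≈s g)
  factor⇔ K {f} {g} K₀ F≈ G≈ = (λ eq k → trans (F≈ k) (trans (⋆-congʳ K eq k) (sym (G≈ k))))
    , λ eq → ⋆-cancelˡ K K₀ (λ k → trans (sym (F≈ k)) (trans (eq k) (G≈ k)))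

  -- The quotient is cleared of denominators. On the left `L` comes from the δ-polynomial of the sum
  -- and `p`, `q` from clearing; on the right `p` and `q` come from the δ-polynomials of the
  -- summands.
  product⇔delta : ∀ (eP eQ eS : ℕ → ℕ) dP dQ {d dS} rP rQ {rS} → dS ≡ d → rS ≡ rP + rQ →
    let product = natS eS ≈s (oneMinusT^ 1 ⋆ (natS eP ⋆ natS eQ))
        deltas = (delta eS dS rS ⋆ (powS (oneMinusT^ dP) (suc rP) ⋆ powS (oneMinusT^ dQ) (suc rQ)))
          ≈s (oneMinusT^ 1 ⋆ (powS (oneMinusT^ d) (suc (rP + rQ)) ⋆ (delta eP dP rP ⋆ delta eQ dQ rQ)))
    in (product → deltas) × (deltas → product)
  product⇔delta eP eQ eS dP dQ {d} rP rQ refl refl = factor⇔ (L ⋆ (p ⋆ q))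
    (⋆-constant {L} {p ⋆ q} (powS-constant {oneMinusT^ d} refl (suc (rP + rQ)))
      (⋆-constant {p} {q} (powS-constant {oneMinusT^ dP} refl (suc rP)) (powS-constant {oneMinusT^ dQ} refl (suc rQ))))
    (solve 4 (λ s l p q → ((s ⊕ l) ⊕ (p ⊕ q)) ⊜ ((l ⊕ (p ⊕ q)) ⊕ s)) (λ _ → refl) (natS eS) L p q)
    (solve 6 (λ t l p q x y → (t ⊕ (l ⊕ ((x ⊕ p) ⊕ (y ⊕ q)))) ⊜ ((l ⊕ (p ⊕ q)) ⊕ (t ⊕ (x ⊕ y)))) (λ _ → refl)
      (oneMinusT^ 1) L p q (natS eP) (natS eQ))
    where
    L = powS (oneMinusT^ d) (suc (rP + rQ))
    p = powS (oneMinusT^ dP) (suc rP)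
    q = powS (oneMinusT^ dQ) (suc rQ)

  -- With all denominators equal to 1, the δ-polynomials of the summands bring `rP + rQ + 2` factors
  -- 1 - t, one more than that of the sum; the extra one is the factor 1 - t of the product formula.
  product⇔lattice-delta : ∀ (eP eQ eS : ℕ → ℕ) {dP dQ dS} rP rQ {rS} → dP ≡ 1 → dQ ≡ 1 → dS ≡ lcm dP dQ → rS ≡ rP + rQ →
    let product = natS eS ≈s (oneMinusT^ 1 ⋆ (natS eP ⋆ natS eQ))
        deltas = delta eS dS rS ≈s (delta eP dP rP ⋆ delta eQ dQ rQ)
    in (product → deltas) × (deltas → product)
  product⇔lattice-delta eP eQ eS rP rQ refl refl refl refl = factor⇔ (t ⋆ (p ⋆ q))
    (⋆-constant {t} {p ⋆ q} refl (⋆-constant {p} {q} (powS-constant {t} refl rP) (powS-constant {t} refl rQ)))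
    (λ k → trans (⋆-congʳ (natS eS) (⋆-congʳ t (powS-+ t rP rQ)) k)
      (solve 4 (λ s t p q → (s ⊕ (t ⊕ (p ⊕ q))) ⊜ ((t ⊕ (p ⊕ q)) ⊕ s)) (λ _ → refl) (natS eS) t p q k))
    (solve 5 (λ t p q x y → ((x ⊕ (t ⊕ p)) ⊕ (y ⊕ (t ⊕ q))) ⊜ ((t ⊕ (p ⊕ q)) ⊕ (t ⊕ (x ⊕ y)))) (λ _ → refl) t p q (natS eP) (natS eQ))
    where
    t = oneMinusT^ 1
    p = powS t rP
    q = powS t rQ

open import Defs
open Polytopes using (freeSum⇒splitting; module FreeSum; den-⊕; den-lattice; dim-⊕)
open Delta using (product⇔delta; product⇔lattice-delta)
open import Data.Nat using (ℕ; suc; _+_)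
open import Data.Nat.LCM using (lcm)
open import Data.Product using (_×_; _,_; proj₁; proj₂)
open import Data.Sum using (_⊎_; inj₁; inj₂; [_,_]′)
open import Function using (_∘_; id)
open import Relation.Binary.PropositionalEquality using (_≡_)

theorem1p4 : ∀ {n : ℕ} (P Q : Polytope n) → IsFreeSum P Q →
    ∀ (eP eQ eS : ℕ → ℕ) (dP dQ dS rP rQ rS : ℕ) →
    IsEhr P eP → IsEhr Q eQ → IsEhr (P ⊕ Q) eS →
    IsDen P dP → IsDen Q dQ → IsDen (P ⊕ Q) dS →
    IsDim P rP → IsDim Q rQ → IsDim (P ⊕ Q) rS →
    ((DualIsLattice P ⊎ DualIsLattice Q) →
    (natS eS ≈s (oneMinusT^ 1 ⋆ (natS eP ⋆ natS eQ)))
    × ((delta eS dS rS ⋆ (powS (oneMinusT^ dP) (suc rP) ⋆ powS (oneMinusT^ dQ) (suc rQ)))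
    ≈s (oneMinusT^ 1 ⋆ (powS (oneMinusT^ (lcm dP dQ)) (suc (rP + rQ))
    ⋆ (delta eP dP rP ⋆ delta eQ dQ rQ)))))
    × ((natS eS ≈s (oneMinusT^ 1 ⋆ (natS eP ⋆ natS eQ)))
    ⊎ ((delta eS dS rS ⋆ (powS (oneMinusT^ dP) (suc rP) ⋆ powS (oneMinusT^ dQ) (suc rQ)))
    ≈s (oneMinusT^ 1 ⋆ (powS (oneMinusT^ (lcm dP dQ)) (suc (rP + rQ))
    ⋆ (delta eP dP rP ⋆ delta eQ dQ rQ))))
    → (DualIsLattice P ⊎ DualIsLattice Q))
    × (IsLatticePolytope P → IsLatticePolytope Q →
    ((delta eS dS rS ≈s (delta eP dP rP ⋆ delta eQ dQ rQ)) → (DualIsLattice P ⊎ DualIsLattice Q))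
    × ((DualIsLattice P ⊎ DualIsLattice Q) → (delta eS dS rS ≈s (delta eP dP rP ⋆ delta eQ dQ rQ))))
theorem1p4 P Q freeSum eP eQ eS dP dQ dS rP rQ rS ehrP ehrQ ehrS denP denQ denS dimP dimQ dimS =
  (λ lattice → lattice⇒product lattice , proj₁ deltas (lattice⇒product lattice))
  , product⇒lattice ∘ [ id , proj₂ deltas ]′
  , λ P-lattice Q-lattice →
      let (to , from) = product⇔lattice-delta eP eQ eS rP rQ
            (den-lattice P denP P-lattice) (den-lattice Q denQ Q-lattice) den dim
      in product⇒lattice ∘ from , to ∘ lattice⇒product
  where
  splitting = freeSum⇒splitting P Q freeSum
  open FreeSum P Q splitting eP eQ eS ehrP ehrQ ehrS using (lattice⇒product; product⇒lattice)
  den : dS ≡ lcm dP dQ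
  den = den-⊕ P Q splitting denP denQ denS
  dim : rS ≡ rP + rQ
  dim = dim-⊕ P Q splitting dimP dimQ dimS
  deltas = product⇔delta eP eQ eS dP dQ rP rQ den dim
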